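{- Let $m\ge2$ and let $\mathcal{H}\in\mathcal{P}(\mathcal{H})$ be a connected $3$-cyclic Type II linear $m$-uniform hypergraph with $k$ edges. Then: (i) $\lambda_1(\mathcal{H})\le\lambda_1(T_2C(c_1=k-9))$, and equality holds only when $\mathcal{H}=T_2C(c_1=k-9)$. (ii) $\lambda_1(T_2C(c_1=k-9))=\gamma/(m-1)$ and $\gamma<\dfrac{m+4+\sqrt{(m+4)^2+4(k-3)(m-1)}}{2}$, where $\gamma$ is the root with the largest modulus of the polynomial (in $\lambda$) $$\big(\lambda^2-(m-2)\lambda-2m+3\big)\Big((\lambda-m+3)\big(\lambda(\lambda-m+2)-(k-3)(m-1)+6\big)+6(m-2)\Big)-6(\lambda+1)^2(\lambda-m+2).$$
   Context: A hypergraph has a finite vertex set and an edge set of non-empty subsets of the vertex set; it is $m$-uniform if all edges have cardinality $m$, and linear if two distinct edges share at most one vertex. The adjacency matrix of a linear $m$-uniform hypergraph has $(i,j)$ entry $\frac{1}{m-1}$ if $i\ne j$ lie in a common edge, and $0$ otherwise; $\lambda_1$ denotes the spectral radius of this matrix. The $m$-th power hypergraph of a graph $G(V,E)$ is the $m$-uniform hypergraph obtained by adding to each edge $e\in E$ $m-2$ new vertices $v_{e,1},\dots,v_{e,m-2}$ (distinct for distinct edges). $\mathcal{P}(\mathcal{H})$ denotes the set of $m$-th power hypergraphs of graphs (a fixed notation for the set, not depending on the particular hypergraph $\mathcal{H}$). A loose cycle of length $l\ge3$, $v_1e_1v_2e_2\dots v_le_lv_1$, is the $m$-uniform hypergraph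 with edges $e_1,\dots,e_l$ in which $e_{i-1}\cap e_i=\{v_i\}$ (indices mod $l$, the $v_i$ distinct) and non-consecutive edges are disjoint. A linear hypergraph is $3$-cyclic if it contains exactly three loose cycles. An $m$-uniform $3$-cyclic linear hypergraph with $n$ vertices and $k$ edges is of Type II if $n=k(m-1)-2$. Attaching a pendant edge at a vertex $v$ means adding a new edge consisting of $v$ and $m-1$ new vertices. $T_2C(c_1=l_1,\dots,c_7=l_7)$ is the hypergraph consisting of three loose cycles of length $3$, $v_1e_1v_2e_2v_3e_3v_1$, $v_1e_4v_4e_5v_5e_6v_1$ and $v_1e_7v_6e_8v_7e_9v_1$, pairwise sharing only the vertex $v_1$, together with $l_i$ pendant edges attached at $v_i$ for $i=1,\dots,7$; when only some of the $c_i$ are listed, the others are $0$. Equality of hypergraphs means isomorphism. -}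

module Defs where

open import Algebra.Bundles using (CommutativeRing; RawRing)
import Algebra.Definitions.RawSemiring as RawSemiringDefs
open import Data.Bool.Base using (true; false; if_then_else_)
import Data.Bool.Properties as Bool
open import Data.Fin.Base
  using (Fin; zero; suc; toℕ; splitAt; join; quotient; combine; _↑ˡ_)
open import Data.Fin.Patterns using (0F; 1F; 2F; 3F; 4F; 5F; 6F)
open import Data.Fin.Properties using (_≟_; any?; all?; remQuot-combine; join-splitAt)
open import Data.Fin.Subset
  using (Subset; _∈_; _∩_; _∪_; ⁅_⁆; ∣_∣; Empty; Nonempty; ⊥)
open import Data.Fin.Subset.Properties using (_∈?_; x∈⁅x⁆; nonempty?)
open import Data.List.Base as List using (List)
open import Data.Nat.Base as ℕ using (ℕ; zero; suc; _∸_; z≤n; s≤s)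
open import Data.Nat.DivMod using (_mod_)
open import Data.Product.Base using (∃; Σ-syntax; _×_; _,_; proj₁)
open import Data.Sum.Base using (_⊎_; inj₁; inj₂)
open import Data.Vec.Base as Vec using (Vec; []; _∷_; _++_)
open import Data.Vec.Functional using (Vector)
import Data.Vec.Properties as Vec
open import Function.Bundles using (_⇔_; _↔_; module Inverse)
open import Function.Definitions using (Injective)
open import Level using (0ℓ)
open import Relation.Binary.Construct.Closure.ReflexiveTransitive using (Star)
open import Relation.Binary.PropositionalEquality
  using (_≡_; _≢_; refl; sym; trans; cong; module ≡-Reasoning)
open import Relation.Binary.Structures using (IsDecTotalOrder)
open import Relation.Nullary using (¬_; Dec; does; yes; no; contradiction)
open import Relation.Nullary.Decidable
  using (_×-dec_; ¬?; _→-dec_; from-yes; dec-true)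

-- The edges form a set: distinct indices name distinct subsets.

record Hypergraph : Set where
  field
    order          : ℕ
    size           : ℕ
    edge           : Fin size → Subset order
    edge-nonempty  : ∀ e → Nonempty (edge e)
    edge-injective : Injective _≡_ _≡_ edge

  Vertex : Set
  Vertex = Fin order

  Edge : Set
  Edge = Fin size

open Hypergraph public

Uniform : ℕ → Hypergraph → Set
Uniform m H = ∀ e → ∣ edge H e ∣ ≡ m

Linear : Hypergraph → Set
Linear H = ∀ e f → e ≢ f → ∣ edge H e ∩ edge H f ∣ ℕ.≤ 1

Adjacent : (H : Hypergraph) → Vertex H → Vertex H → Set
Adjacent H i j = i ≢ j × ∃ λ e → i ∈ edge H e × j ∈ edge H e

adjacent? : (H : Hypergraph) (i j : Vertex H) → Dec (Adjacent H i j)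
adjacent? H i j =
  ¬? (i ≟ j) ×-dec any? λ e → (i ∈? edge H e) ×-dec (j ∈? edge H e)

Connected : Hypergraph → Set
Connected H = ∀ u v → Star (Adjacent H) u v

infix 4 _≅_

record _≅_ (H K : Hypergraph) : Set where
  field
    vertices  : Vertex H ↔ Vertex K
    edges     : Edge H ↔ Edge K
    incidence : ∀ v e →
      v ∈ edge H e ⇔ Inverse.to vertices v ∈ edge K (Inverse.to edges e)

next : ∀ {l} → Fin l → Fin l
next {suc l} i = suc (toℕ i) mod suc l

-- A loose cycle in H, regarded as a subhypergraph, is determined by its set
-- C of edges; the enumeration v₁ e₁ v₂ e₂ … is only a witness, so rotations
-- and reflections of it do not count as further cycles.  Here edge i joins
-- vertex i to vertex (next i).

record IsLooseCycle (H : Hypergraph) (C : Subset (size H)) : Set where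
  field
    len         : ℕ
    len≥3       : 3 ℕ.≤ len
    v           : Fin len → Vertex H
    e           : Fin len → Edge H
    v-injective : Injective _≡_ _≡_ v
    e-injective : Injective _≡_ _≡_ e
    consecutive : ∀ i → edge H (e i) ∩ edge H (e (next i)) ≡ ⁅ v (next i) ⁆
    disjoint    : ∀ i j → i ≢ j → j ≢ next i → i ≢ next j →
                  Empty (edge H (e i) ∩ edge H (e j))
    edges       : ∀ f → f ∈ C ⇔ ∃ λ i → e i ≡ f

ThreeCyclic : Hypergraph → Set
ThreeCyclic H =
  Σ[ c ∈ (Fin 3 → Subset (size H)) ]
    Injective _≡_ _≡_ c × (∀ C → IsLooseCycle H C ⇔ ∃ λ i → c i ≡ C)

-- n = k (m - 1) - 2, without truncated subtraction of the 2.

TypeII : ℕ → Hypergraph → Set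
TypeII m H = order H ℕ.+ 2 ≡ size H ℕ.* (m ∸ 1)

-- The e-th of k disjoint blocks of d vertices each.

block : ∀ {k} d → Fin k → Subset (k ℕ.* d)
block d e = Vec.tabulate λ w → does (quotient d w ≟ e)

[]=-++ˡ : ∀ {p q} {i : Fin p} {b} (xs : Subset p) {ys : Subset q} →
          xs Vec.[ i ]= b → (xs ++ ys) Vec.[ i ↑ˡ q ]= b
[]=-++ˡ (_ ∷ xs) Vec.here        = Vec.here
[]=-++ˡ (_ ∷ xs) (Vec.there x∈s) = Vec.there ([]=-++ˡ xs x∈s)

lookup-block : ∀ {k} d (e f : Fin k) (r : Fin d) →
               Vec.lookup (block d f) (combine e r) ≡ does (e ≟ f)
lookup-block d e f r = trans
  (Vec.lookup∘tabulate (λ w → does (quotient d w ≟ f)) (combine e r))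
  (cong (λ qr → does (proj₁ qr ≟ f)) (remQuot-combine e r))

lookup-block-self : ∀ {k} d (e : Fin k) (r : Fin d) →
                    Vec.lookup (block d e) (combine e r) ≡ true
lookup-block-self d e r = trans (lookup-block d e e r) (dec-true (e ≟ e) refl)

block≢⊥ : ∀ {k} d (e : Fin k) → Fin d → ⊥ ≢ block d e
block≢⊥ d e r eq with trans (trans (sym (lookup-block-self d e r))
                               (cong (λ s → Vec.lookup s (combine e r)) (sym eq)))
                        (Vec.lookup-replicate (combine e r) false)
... | ()

block-injective : ∀ {k} d → Fin d → Injective _≡_ _≡_ (block {k} d)
block-injective d r {e} {f} eq with e ≟ f | trans
  (trans (sym (lookup-block d e f r)) (cong (λ s → Vec.lookup s (combine e r)) (sym eq)))
  (lookup-block-self d e r)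
... | yes e≡f | _  = e≡f
... | no  _   | ()

Fin[m-1]-inhabited : ∀ {m} → 2 ℕ.≤ m → Fin (m ∸ 1)
Fin[m-1]-inhabited (s≤s (s≤s z≤n)) = zero

-- The e-th edge of the base graph receives the e-th block of m - 2 new vertices.

power : ℕ → Hypergraph → Hypergraph
power m G = record
  { order          = order G ℕ.+ size G ℕ.* (m ∸ 2)
  ; size           = size G
  ; edge           = λ e → edge G e ++ block (m ∸ 2) e
  ; edge-nonempty  = λ e → let (v , v∈e) = edge-nonempty G e in
                           v ↑ˡ _ , []=-++ˡ (edge G e) v∈e
  ; edge-injective = λ {e} {f} eq →
      edge-injective G (Vec.++-injectiveˡ (edge G e) (edge G f) eq)
  }

-- A (simple) graph is a 2-uniform hypergraph.

IsPower : ℕ → Hypergraph → Set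
IsPower m H = Σ[ G ∈ Hypergraph ] Uniform 2 G × H ≅ power m G

-- One pendant edge with m - 1 new vertices is attached at each vertex of the
-- list, so that a vertex occurring l times receives l pendant edges.

module _ {m : ℕ} (2≤m : 2 ℕ.≤ m) (H : Hypergraph) (vs : List (Vertex H)) where

  private
    p = List.length vs
    d = m ∸ 1

    r₀ : Fin d
    r₀ = Fin[m-1]-inhabited 2≤m

  pendantEdge : Edge H ⊎ Fin p → Subset (order H ℕ.+ p ℕ.* d)
  pendantEdge (inj₁ e) = edge H e ++ ⊥
  pendantEdge (inj₂ q) = ⁅ List.lookup vs q ⁆ ++ block d q

  pendantEdge-nonempty : ∀ x → Nonempty (pendantEdge x)
  pendantEdge-nonempty (inj₁ e) =
    let (v , v∈e) = edge-nonempty H e in v ↑ˡ _ , []=-++ˡ (edge H e) v∈e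
  pendantEdge-nonempty (inj₂ q) =
    List.lookup vs q ↑ˡ _ , []=-++ˡ ⁅ List.lookup vs q ⁆ (x∈⁅x⁆ (List.lookup vs q))

  pendantEdge-injective : Injective _≡_ _≡_ pendantEdge
  pendantEdge-injective {inj₁ e} {inj₁ f} eq =
    cong inj₁ (edge-injective H (Vec.++-injectiveˡ (edge H e) (edge H f) eq))
  pendantEdge-injective {inj₁ e} {inj₂ q} eq = contradiction
    (Vec.++-injectiveʳ (edge H e) ⁅ List.lookup vs q ⁆ eq) (block≢⊥ d q r₀)
  pendantEdge-injective {inj₂ q} {inj₁ e} eq = contradiction
    (Vec.++-injectiveʳ (edge H e) ⁅ List.lookup vs q ⁆ (sym eq)) (block≢⊥ d q r₀)
  pendantEdge-injective {inj₂ q} {inj₂ r} eq = cong inj₂ (block-injective d r₀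
    (Vec.++-injectiveʳ ⁅ List.lookup vs q ⁆ ⁅ List.lookup vs r ⁆ eq))

  attachPendants : Hypergraph
  attachPendants = record
    { order          = order H ℕ.+ p ℕ.* d
    ; size           = size H ℕ.+ p
    ; edge           = λ e → pendantEdge (splitAt (size H) e)
    ; edge-nonempty  = λ e → pendantEdge-nonempty (splitAt (size H) e)
    ; edge-injective = λ {e} {f} eq → begin
        e
          ≡⟨ join-splitAt (size H) p e ⟨
        join (size H) p (splitAt (size H) e)
          ≡⟨ cong (join (size H) p)
               (pendantEdge-injective {splitAt (size H) e} {splitAt (size H) f} eq) ⟩
        join (size H) p (splitAt (size H) f)
          ≡⟨ join-splitAt (size H) p f ⟩
        f ∎
    }
    where open ≡-Reasoning

-- Here iF stands for the vertex v_{i+1}.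

threeTriangles : Hypergraph
threeTriangles = record
  { order          = 7
  ; size           = 9
  ; edge           = Vec.lookup edges
  ; edge-nonempty  = from-yes (all? λ e → nonempty? (Vec.lookup edges e))
  ; edge-injective = λ {e} {f} → from-yes
      (all? λ e → all? λ f →
        Vec.≡-dec Bool._≟_ (Vec.lookup edges e) (Vec.lookup edges f) →-dec e ≟ f) e f
  }
  where
  infix 8 _–_
  _–_ : Fin 7 → Fin 7 → Subset 7
  u – v = ⁅ u ⁆ ∪ ⁅ v ⁆

  edges : Vec (Subset 7) 9
  edges = 0F – 1F ∷ 1F – 2F ∷ 2F – 0F
        ∷ 0F – 3F ∷ 3F – 4F ∷ 4F – 0F
        ∷ 0F – 5F ∷ 5F – 6F ∷ 6F – 0F ∷ []

-- The three loose cycles of length 3 sharing v₁ are the m-th power of three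
-- triangles sharing a vertex; l i is the number of pendant edges at v_{i+1}.

T₂C : (m : ℕ) → 2 ℕ.≤ m → (l : Fin 7 → ℕ) → Hypergraph
T₂C m 2≤m l = attachPendants 2≤m (power m threeTriangles)
  (List.concatMap (λ i → List.replicate (l i) (i ↑ˡ _)) (List.allFin 7))

c₁=_ : ℕ → Fin 7 → ℕ
(c₁= l) zero    = l
(c₁= l) (suc _) = 0

-- The real numbers enter through their axioms as a complete ordered field,
-- which determine them up to isomorphism; decidability of the order holds
-- classically.  The square root, whose existence follows from completeness, is
-- included as an operation.  Inverse and square root are total, their values at
-- 0 and at negative numbers, respectively, being left unspecified.

record RealNumbers : Set₁ where
  field
    commutativeRing : CommutativeRing 0ℓ 0ℓ

  open CommutativeRing commutativeRing public

  infix  4 _≤_ _<_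
  infix  9 _⁻¹
  infixl 7 _/_

  field
    _≤_             : Carrier → Carrier → Set
    isDecTotalOrder : IsDecTotalOrder _≈_ _≤_
    +-monoˡ-≤       : ∀ {x y} z → x ≤ y → x + z ≤ y + z
    *-nonneg        : ∀ {x y} → 0# ≤ x → 0# ≤ y → 0# ≤ x * y
    0≉1             : ¬ 0# ≈ 1#
    _⁻¹             : Carrier → Carrier
    ⁻¹-inverseʳ     : ∀ {x} → ¬ x ≈ 0# → x * x ⁻¹ ≈ 1#
    √               : Carrier → Carrier
    √-nonneg        : ∀ {x} → 0# ≤ x → 0# ≤ √ x
    √-square        : ∀ {x} → 0# ≤ x → √ x * √ x ≈ x

  IsUpperBound : (Carrier → Set) → Carrier → Set
  IsUpperBound P b = ∀ x → P x → x ≤ b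

  field
    complete : (P : Carrier → Set) → ∃ P → ∃ (IsUpperBound P) →
               ∃ λ s → IsUpperBound P s × (∀ b → IsUpperBound P b → s ≤ b)

  _<_ : Carrier → Carrier → Set
  x < y = x ≤ y × ¬ x ≈ y

  _/_ : Carrier → Carrier → Carrier
  x / y = x * y ⁻¹

module RingExpressions (R : RawRing 0ℓ 0ℓ) where
  open RawRing R
  open RawSemiringDefs rawSemiring public using (sum; _^_) renaming (_×_ to _·_)

  infixl 6 _-_

  _-_ : Carrier → Carrier → Carrier
  x - y = x + - y

  ι : ℕ → Carrier
  ι n = n · 1#

  T₂C-polynomial : (m k : ℕ) → Carrier → Carrier
  T₂C-polynomial m k x =
      (x ^ 2 - (M - ι 2) * x - ι 2 * M + ι 3)
    * ( (x - M + ι 3) * (x * (x - M + ι 2) - (K - ι 3) * (M - ι 1) + ι 6)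
      + ι 6 * (M - ι 2))
    - ι 6 * (x + 1#) ^ 2 * (x - M + ι 2)
    where
    M = ι m
    K = ι k

module Spectral (ℝ : RealNumbers) where

  open RealNumbers ℝ public hiding (_-_)
  open RingExpressions rawRing public using (ι; _-_)

  record ℂ : Set where
    constructor _+i_
    field
      re im : Carrier

  open ℂ public

  fromℝ : Carrier → ℂ
  fromℝ x = x +i 0#

  ℂ-rawRing : RawRing 0ℓ 0ℓ
  ℂ-rawRing = record
    { Carrier = ℂ
    ; _≈_     = λ z w → re z ≈ re w × im z ≈ im w
    ; _+_     = λ z w → (re z + re w) +i (im z + im w)
    ; _*_     = λ z w → (re z * re w - im z * im w) +i (re z * im w + im z * re w)
    ; -_      = λ z → (- re z) +i (- im z)
    ; 0#      = fromℝ 0#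
    ; 1#      = fromℝ 1#
    }

  module ℂ-Ops where
    open RawRing ℂ-rawRing public using (_≈_; _*_; 0#)
    open RingExpressions ℂ-rawRing public using (sum)

  modulus : ℂ → Carrier
  modulus z = √ (re z * re z + im z * im z)

  Matrix : ℕ → Set
  Matrix n = Fin n → Fin n → Carrier

  IsEigenvalue : ∀ {n} → Matrix n → ℂ → Set
  IsEigenvalue {n} A μ = Σ[ x ∈ Vector ℂ n ]
      (∃ λ i → ¬ x i ≈ᶜ 0ᶜ)
    × (∀ i → ℂ-Ops.sum (λ j → fromℝ (A i j) *ᶜ x j) ≈ᶜ μ *ᶜ x i)
    where open ℂ-Ops renaming (_≈_ to _≈ᶜ_; _*_ to _*ᶜ_; 0# to 0ᶜ) using ()

  IsSpectralRadius : ∀ {n} → Matrix n → Carrier → Set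
  IsSpectralRadius A ρ =
      (∃ λ μ → IsEigenvalue A μ × modulus μ ≈ ρ)
    × (∀ μ → IsEigenvalue A μ → modulus μ ≤ ρ)

  adjacencyMatrix : ℕ → (H : Hypergraph) → Matrix (order H)
  adjacencyMatrix m H i j =
    if does (adjacent? H i j) then (ι (m ∸ 1)) ⁻¹ else 0#

  Isλ₁ : ℕ → Hypergraph → Carrier → Set
  Isλ₁ m H ρ = IsSpectralRadius (adjacencyMatrix m H) ρ

  -- "The root with the largest modulus": every other root has a strictly
  -- smaller modulus.

  IsLargestRoot : (ℂ → ℂ) → ℂ → Set
  IsLargestRoot f z =
      f z ≈ᶜ 0ᶜ
    × (∀ w → f w ≈ᶜ 0ᶜ → ¬ w ≈ᶜ z → modulus w < modulus z)
    where open ℂ-Ops renaming (_≈_ to _≈ᶜ_; 0# to 0ᶜ) using ()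

  ℂ-T₂C-polynomial : (m k : ℕ) → ℂ → ℂ
  ℂ-T₂C-polynomial = RingExpressions.T₂C-polynomial ℂ-rawRing

  γ-bound : (m k : ℕ) → Carrier
  γ-bound m k =
    (ι m + ι 4 + √ ((ι m + ι 4) * (ι m + ι 4) + ι 4 * (ι k - ι 3) * (ι m - ι 1))) / ι 2

module Submission where

-- H is the power of a connected graph G with two more edges than vertices
-- and only three cycles.  Let v be a real eigenvector of H with |eigenvalue| =
-- λ₁ (the adjacency matrix is symmetric), root G at a vertex u where |v| is
-- largest among the vertices of G, and take a breadth-first tree from u.  It
-- leaves three chords, which miss u and are pairwise disjoint: two chords with
-- a common end would give a fourth cycle.  Replacing every tree edge
-- {w, parent w} by {w, u} therefore turns H into T = T₂C(c₁ = k − 9) on the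
-- same vertices, and since |v| is largest at u, the quadratic form at |v| does
-- not decrease.  By the Rayleigh principle for the positive eigenvector of T,
-- λ₁(H) ≤ λ₁(T).  In the case of equality |v| is proportional to that
-- eigenvector, whose value at u exceeds those at all other vertices of G, so
-- no edge has been moved.
--
-- The eigenvector of T is constant on five classes of vertices, which leads to
-- the polynomial; its root γ is found between m + 1 and the bound by the
-- intermediate value theorem.  Conversely a root of the polynomial is
-- essentially an eigenvalue of T, hence real and at most γ in modulus.

open import Algebra.Bundles using (CommutativeRing)
open import Algebra.Structures using (IsCommutativeRing)
open import Data.Bool.Base using (Bool; true; false; if_then_else_; _∨_)
open import Data.Bool.Properties using (∨-identityʳ)
open import Data.Fin.Base as Fin using (Fin; zero; suc; _↑ˡ_; _↑ʳ_; combine)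
open import Data.Fin.Patterns using (0F; 1F; 2F; 3F; 4F; 5F; 6F; 7F; 8F)
open import Data.Fin.Properties as Fin using (_≟_)
open import Data.Fin.Subset using (_∈_)
open import Data.Fin.Subset.Properties using (_∈?_)
open import Data.Nat.Base as ℕ using (ℕ; zero; suc; z≤n; s≤s; _∸_)
open import Data.Nat.Base using () renaming (_≤_ to _≤ℕ_)
import Data.Nat.Properties as ℕ
open import Data.Product.Base using (∃; _×_; _,_; proj₁; proj₂)
open import Data.Sum.Base as Sum using (_⊎_; inj₁; inj₂; [_,_]′)
open import Data.Sum.Function.Propositional using (_⊎-↔_)
open import Function.Base using (_∘_)
open import Function.Bundles using (_⇔_; _↔_; mk⇔; module Equivalence; module Inverse)
open import Function.Properties.Inverse using (↔-sym; ↔-trans; ↔-refl)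
open import Level using (0ℓ)
open import Relation.Binary.PropositionalEquality as ≡ using (_≡_; _≢_)
open import Relation.Binary.Structures using (IsDecTotalOrder)
open import Relation.Nullary using (¬_; Dec; yes; no; does; contradiction)
open import Relation.Nullary.Decidable using (dec-true; _⊎-dec_; _×-dec_; does-⇔)
open import Defs

open Equivalence using (to; from)
module ↔ = Inverse

-- Breadth-first search is what makes the chords behave. Depths of adjacent vertices differ by at
-- most one, so neither end of a chord is an ancestor of the other. Hence a chord misses the root,
-- and a common end of two chords stays off the tree path between their other ends, so that the
-- combined closed walk is simple.
--
-- The quadratic form splits into one term per edge. Such a term is affine in the value at each end,
-- with nonnegative slope at a nonnegative vector. All tree edges can therefore be moved at once:
-- the vertices, the vector and its norm stay the same, and only the values at the moved ends are
-- compared. The argument uses the 0/1 adjacency matrix; the factor 1/(m-1) enters at the end.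
--
-- The eigenvector attached to a root of the polynomial is written without division, at the price
-- that it may vanish. It is nonzero for non-real roots and for real roots of modulus at least m +
-- 1, and this is why m + 1 is the lower end of the interval searched for the root.

module Combinatorics where

  open import Data.Empty as Empty using ()
  open import Data.Fin.Base using (toℕ; inject₁; fromℕ; splitAt; remQuot; join; punchOut)
  open import Data.Fin.Permutation as Perm
    using (Permutation′; _⟨$⟩ʳ_; _⟨$⟩ˡ_; _∘ₚ_; lift₀; transpose; ↔⇒≡)
  import Data.Fin.Permutation.Components as PC
  open import Data.Fin.Properties using (any?; all?; pigeonhole; injective⇒≤)
  open import Data.Fin.Relation.Unary.Top using (view; ‵fromℕ; ‵inject₁)
  open import Data.Fin.Subset using (Subset; inside; _∉_; _∩_; ⁅_⁆; ∣_∣)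
  open import Data.Fin.Subset.Properties as Subset using ()
  open import Data.List.Base as List using (List)
  open import Data.Nat.Base using (_+_; _*_; _≤_; _<_)
  import Data.Nat.DivMod as ℕ
  open import Data.Product.Base using (∃₂; Σ-syntax)
  open import Data.Product.Function.NonDependent.Propositional using (_×-↔_)
  open import Data.Unit.Base using (⊤; tt)
  open import Data.Vec.Base as Vec using ([]; _∷_; _++_)
  import Data.Vec.Properties as Vec
  open import Function.Base using (id; case_of_)
  open import Function.Bundles using (mk↔ₛ′)
  open import Function.Definitions using (Injective)
  open import Relation.Binary.Construct.Closure.ReflexiveTransitive using (Star; ε; _◅_)
  open import Relation.Binary.PropositionalEquality
    using (refl; sym; trans; cong; subst; subst₂; module ≡-Reasoning)
  open import Relation.Nullary.Decidable using (from-yes; _→-dec_)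

  -- Bijections of finite sets

  ↔-injective : ∀ {A B : Set} (π : A ↔ B) → Injective _≡_ _≡_ (↔.to π)
  ↔-injective π eq = trans (sym (↔.strictlyInverseʳ π _))
    (trans (cong (↔.from π) eq) (↔.strictlyInverseʳ π _))

  ↔-from-injective : ∀ {A B : Set} (π : A ↔ B) → Injective _≡_ _≡_ (↔.from π)
  ↔-from-injective π = ↔-injective (↔-sym π)

  ∈⇔lookup : ∀ {n} {x : Fin n} {S : Subset n} → x ∈ S ⇔ Vec.lookup S x ≡ inside
  ∈⇔lookup {x = x} {S} = mk⇔ Vec.[]=⇒lookup (Vec.lookup⇒[]= x S)

  transpose-fst : ∀ {n} (i j : Fin n) → PC.transpose i j i ≡ j
  transpose-fst i j rewrite dec-true (i ≟ i) refl = refl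

  -- By induction on `k`: the transposition of `zero` and `f zero` clears `zero` from the remaining
  -- values, which can then be lowered by one. It serves to renumber edges with the tree edges
  -- first, and vertices with the hub and the chord ends first.
  extend-injection : ∀ {k p} (f : Fin k → Fin (k + p)) → Injective _≡_ _≡_ f →
                     Σ[ π ∈ Permutation′ (k + p) ] (∀ i → π ⟨$⟩ʳ (i ↑ˡ p) ≡ f i)
  extend-injection {zero}  f f-inj = Perm.id , λ ()
  extend-injection {suc k} {p} f f-inj = lift₀ σ ∘ₚ τ , extends
    where
    τ : Permutation′ (suc k + p)
    τ = transpose zero (f zero)

    zero≢τ⁻¹f : ∀ i → zero ≢ τ ⟨$⟩ˡ f (suc i)
    zero≢τ⁻¹f i eq with f-inj {zero} {suc i} (begin
      f zero                      ≡⟨ transpose-fst zero (f zero) ⟨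
      τ ⟨$⟩ʳ zero                 ≡⟨ cong (τ ⟨$⟩ʳ_) eq ⟩
      τ ⟨$⟩ʳ (τ ⟨$⟩ˡ f (suc i))   ≡⟨ ↔.strictlyInverseˡ τ (f (suc i)) ⟩
      f (suc i)                   ∎)
      where open ≡-Reasoning
    ... | ()

    g : Fin k → Fin (k + p)
    g i = punchOut (zero≢τ⁻¹f i)

    suc-g : ∀ i → suc (g i) ≡ τ ⟨$⟩ˡ f (suc i)
    suc-g i = Fin.punchIn-punchOut (zero≢τ⁻¹f i)

    g-inj : Injective _≡_ _≡_ g
    g-inj {i} {j} eq = Fin.suc-injective (f-inj
      (↔-from-injective τ (trans (sym (suc-g i)) (trans (cong suc eq) (suc-g j)))))

    IH = extend-injection g g-inj
    σ  = proj₁ IH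

    extends : ∀ i → (lift₀ σ ∘ₚ τ) ⟨$⟩ʳ (i ↑ˡ p) ≡ f i
    extends zero    = transpose-fst zero (f zero)
    extends (suc i) = begin
      τ ⟨$⟩ʳ suc (σ ⟨$⟩ʳ (i ↑ˡ p))     ≡⟨ cong (λ j → τ ⟨$⟩ʳ suc j) (proj₂ IH i) ⟩
      τ ⟨$⟩ʳ suc (g i)                 ≡⟨ cong (τ ⟨$⟩ʳ_) (suc-g i) ⟩
      τ ⟨$⟩ʳ (τ ⟨$⟩ˡ f (suc i))        ≡⟨ ↔.strictlyInverseˡ τ (f (suc i)) ⟩
      f (suc i)                        ∎
      where open ≡-Reasoning

  -- Graphs and presentations of their powers

  module Ends {V E : Set} (src tgt : E → V) where

    -- `src` and `tgt` orient each edge arbitrarily; `Joins` and `Incident` forget the orientation.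
    -- The edge type is arbitrary because the windmill is first studied with its edges sorted into a
    -- disjoint sum.
    Joins : E → V → V → Set
    Joins e x y = (x ≡ src e × y ≡ tgt e) ⊎ (x ≡ tgt e × y ≡ src e)

    Incident : V → E → Set
    Incident x e = x ≡ src e ⊎ x ≡ tgt e

    Joins-sym : ∀ {e x y} → Joins e x y → Joins e y x
    Joins-sym (inj₁ (p , q)) = inj₂ (q , p)
    Joins-sym (inj₂ (p , q)) = inj₁ (q , p)

    Joins⇒Incidentˡ : ∀ {e x y} → Joins e x y → Incident x e
    Joins⇒Incidentˡ (inj₁ (p , _)) = inj₁ p
    Joins⇒Incidentˡ (inj₂ (p , _)) = inj₂ p

    Joins⇒Incidentʳ : ∀ {e x y} → Joins e x y → Incident y e
    Joins⇒Incidentʳ = Joins⇒Incidentˡ ∘ Joins-sym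

    Joins-end : ∀ {e x y z} → Joins e x y → Incident z e → z ≡ x ⊎ z ≡ y
    Joins-end (inj₁ (x≡ , y≡)) (inj₁ z≡) = inj₁ (trans z≡ (sym x≡))
    Joins-end (inj₁ (x≡ , y≡)) (inj₂ z≡) = inj₂ (trans z≡ (sym y≡))
    Joins-end (inj₂ (x≡ , y≡)) (inj₁ z≡) = inj₂ (trans z≡ (sym y≡))
    Joins-end (inj₂ (x≡ , y≡)) (inj₂ z≡) = inj₁ (trans z≡ (sym x≡))

    Incident⇒Joins : ∀ {e x} → Incident x e → ∃ λ y → Joins e x y
    Incident⇒Joins (inj₁ x≡) = _ , inj₁ (x≡ , refl)
    Incident⇒Joins (inj₂ x≡) = _ , inj₂ (x≡ , refl)

    Incident²⇒Joins : ∀ {e x y} → x ≢ y → Incident x e → Incident y e → Joins e x y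
    Incident²⇒Joins x≢y (inj₁ p) (inj₁ q) = contradiction (trans p (sym q)) x≢y
    Incident²⇒Joins x≢y (inj₁ p) (inj₂ q) = inj₁ (p , q)
    Incident²⇒Joins x≢y (inj₂ p) (inj₁ q) = inj₂ (p , q)
    Incident²⇒Joins x≢y (inj₂ p) (inj₂ q) = contradiction (trans p (sym q)) x≢y

  record Graph (n k : ℕ) : Set where
    field
      src tgt : Fin k → Fin n

    open Ends src tgt public

    field
      loopless : ∀ {e x y} → Joins e x y → x ≢ y
      simple   : ∀ {e f x y} → Joins e x y → Joins f x y → e ≡ f

    Joins? : ∀ e x y → Dec (Joins e x y)
    Joins? e x y = ((x ≟ src e) ×-dec (y ≟ tgt e)) ⊎-dec ((x ≟ tgt e) ×-dec (y ≟ src e))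

    Adj : Fin n → Fin n → Set
    Adj x y = ∃ λ e → Joins e x y

  -- The vertices of the power of a graph: old vertices, and new vertices
  -- labelled by their edges.

  Point : (n k M : ℕ) → Set
  Point n k M = Fin n ⊎ Fin k × Fin M

  On : ∀ {n k} (Γ : Graph n k) {M} → Point n k M → Fin k → Set
  On Γ (inj₁ x)       e = Graph.Incident Γ x e
  On Γ (inj₂ (f , r)) e = f ≡ e

  -- H is the (2 + M)-th power of Γ.

  record Presentation {n k} (M : ℕ) (Γ : Graph n k) (H : Hypergraph) : Set where
    field
      vertices  : Point n k M ↔ Vertex H
      edges     : Fin k ↔ Edge H
      incidence : ∀ p e → ↔.to vertices p ∈ edge H (↔.to edges e) ⇔ On Γ p e

    base : Fin n → Vertex H
    base x = ↔.to vertices (inj₁ x)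

    point : Vertex H → Point n k M
    point = ↔.from vertices

    incidence′ : ∀ v e → v ∈ edge H (↔.to edges e) ⇔ On Γ (point v) e
    incidence′ v e = mk⇔
      (λ v∈e → to (incidence _ e)
        (subst (_∈ edge H (↔.to edges e)) (sym (↔.strictlyInverseˡ vertices v)) v∈e))
      (λ on → subst (_∈ edge H (↔.to edges e)) (↔.strictlyInverseˡ vertices v)
        (from (incidence _ e) on))

  module _ {n k M : ℕ} {Γ : Graph n k} where

    ≅-presentation : ∀ {H K} → H ≅ K → Presentation M Γ K → Presentation M Γ H
    ≅-presentation {H} {K} iso P = record
      { vertices  = ↔-trans P.vertices (↔-sym iso.vertices)
      ; edges     = ↔-trans P.edges (↔-sym iso.edges)
      ; incidence = λ p e → mk⇔
          (λ on → to (P.incidence p e) (subst₂ (λ v f → v ∈ edge K f)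
            (↔.strictlyInverseˡ iso.vertices _) (↔.strictlyInverseˡ iso.edges _)
            (to (iso.incidence _ _) on)))
          (λ on → from (iso.incidence _ _) (subst₂ (λ v f → v ∈ edge K f)
            (sym (↔.strictlyInverseˡ iso.vertices _)) (sym (↔.strictlyInverseˡ iso.edges _))
            (from (P.incidence p e) on)))
      }
      where
      module iso = _≅_ iso
      module P = Presentation P

    -- New vertices are labelled by their edges in both presentations and so correspond
    -- automatically; only the incidence of old vertices has to be compared.
    presentations⇒≅ : ∀ {Δ : Graph n k} {H K} → Presentation M Γ H → Presentation M Δ K →
                      (∀ x e → Graph.Incident Γ x e ⇔ Graph.Incident Δ x e) → H ≅ K
    presentations⇒≅ {Δ} {H} {K} P Q same = record
      { vertices  = ↔-trans (↔-sym P.vertices) Q.vertices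
      ; edges     = ↔-trans (↔-sym P.edges) Q.edges
      ; incidence = λ v e → mk⇔
          (λ v∈e → from (Q.incidence _ _) (to (same-On (P.point v) (↔.from P.edges e))
            (to (P.incidence′ v _)
              (subst (λ f → v ∈ edge H f) (sym (↔.strictlyInverseˡ P.edges e)) v∈e))))
          (λ v∈e → subst (λ f → v ∈ edge H f) (↔.strictlyInverseˡ P.edges e)
            (from (P.incidence′ v _) (from (same-On (P.point v) (↔.from P.edges e))
              (to (Q.incidence _ _) v∈e))))
      }
      where
      module P = Presentation P
      module Q = Presentation Q
      same-On : ∀ (p : Point n k M) e → On Γ p e ⇔ On Δ p e
      same-On (inj₁ x) e = same x e
      same-On (inj₂ _) e = mk⇔ id id

    -- New vertices travel with their edges along `ψ`, so the condition again concerns old vertices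
    -- only.
    relabel : ∀ {n′ k′} {Δ : Graph n′ k′} {H} → Presentation M Γ H →
              (π : Fin n′ ↔ Fin n) (ψ : Fin k′ ↔ Fin k) →
              (∀ x e → Graph.Incident Γ (↔.to π x) (↔.to ψ e) ⇔ Graph.Incident Δ x e) →
              Presentation M Δ H
                
    relabel {Δ = Δ} {H} P π ψ inc = record
      { vertices  = ↔-trans (π ⊎-↔ (ψ ×-↔ ↔-refl)) P.vertices
      ; edges     = ↔-trans ψ P.edges
      ; incidence = λ
          { (inj₁ x)       e → mk⇔ (λ on → to (inc x e) (to (P.incidence _ _) on))
                                   (λ on → from (P.incidence _ _) (from (inc x e) on))
          ; (inj₂ (f , r)) e → mk⇔ (λ on → ↔-injective ψ (to (P.incidence _ _) on))
                                   (λ on → from (P.incidence _ _) (cong (↔.to ψ) on))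
          }
      }
      where module P = Presentation P

  -- Paths and loose cycles

  toℕ-next-< : ∀ {l} (i : Fin (suc l)) → toℕ i < l → toℕ (next i) ≡ suc (toℕ i)
  toℕ-next-< i i<l = trans (Fin.toℕ-fromℕ< _) (ℕ.m<n⇒m%n≡m (s≤s i<l))

  toℕ-next-≡ : ∀ {l} (i : Fin (suc l)) → toℕ i ≡ l → toℕ (next i) ≡ 0
  toℕ-next-≡ {l} i i≡l = trans (Fin.toℕ-fromℕ< _)
    (trans (cong (λ j → suc j ℕ.% suc l) i≡l) (ℕ.n%n≡0 (suc l)))

  next-inject₁ : ∀ {l} (j : Fin l) → next (inject₁ j) ≡ suc j
  next-inject₁ {l} j = Fin.toℕ-injective (trans
    (toℕ-next-< (inject₁ j) (subst (ℕ._< l) (sym (Fin.toℕ-inject₁ j)) (Fin.toℕ<n j)))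
    (cong suc (Fin.toℕ-inject₁ j)))

  next-fromℕ : ∀ l → next (fromℕ l) ≡ zero
  next-fromℕ l = Fin.toℕ-injective (toℕ-next-≡ (fromℕ l) (Fin.toℕ-fromℕ l))

  next-injective : ∀ {l} → Injective _≡_ _≡_ (next {l})
  next-injective {suc l} {i} {j} eq with view i | view j
  ... | ‵fromℕ     | ‵fromℕ     = refl
  ... | ‵fromℕ     | ‵inject₁ b with trans (sym (next-fromℕ l)) (trans eq (next-inject₁ b))
  ...   | ()
  next-injective {suc l} {i} {j} eq | ‵inject₁ a | ‵fromℕ
    with trans (sym (next-inject₁ a)) (trans eq (next-fromℕ l))
  ... | ()
  next-injective {suc l} {i} {j} eq | ‵inject₁ a | ‵inject₁ b =
    cong inject₁ (Fin.suc-injective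
      (trans (sym (next-inject₁ a)) (trans eq (next-inject₁ b))))

  next≢ : ∀ {l} → 2 ≤ l → (i : Fin l) → next i ≢ i
  next≢ {suc (suc l)} (s≤s (s≤s _)) i eq with view i
  ... | ‵fromℕ     with trans (sym eq) (next-fromℕ (suc l))
  ...   | ()
  next≢ {suc (suc l)} (s≤s (s≤s _)) i eq | ‵inject₁ j = ℕ.1+n≢n (begin
    suc (toℕ j)          ≡⟨ cong toℕ (next-inject₁ j) ⟨
    toℕ (next (inject₁ j)) ≡⟨ cong toℕ eq ⟩
    toℕ (inject₁ j)      ≡⟨ Fin.toℕ-inject₁ j ⟩
    toℕ j                ∎)
    where open ≡-Reasoning

  next²≢ : ∀ {l} → 3 ≤ l → (i : Fin l) → next (next i) ≢ i
  next²≢ {suc (suc (suc l))} (s≤s (s≤s (s≤s _))) i eq with view i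
  ... | ‵fromℕ with trans (sym eq) (trans (cong next (next-fromℕ (suc (suc l)))) (next-inject₁ zero))
  ...   | ()
  next²≢ {suc (suc (suc l))} (s≤s (s≤s (s≤s _))) i eq | ‵inject₁ j
    with toℕ j ℕ.<? suc l
  ... | yes j<l = ℕ.1+n≰n (ℕ.≤-trans (ℕ.n≤1+n _) (ℕ.≤-reflexive (begin
    suc (suc (toℕ j))            ≡⟨ toℕ-next-< (suc j) (s≤s j<l) ⟨
    toℕ (next (suc j))           ≡⟨ cong (toℕ ∘ next) (next-inject₁ j) ⟨
    toℕ (next (next (inject₁ j))) ≡⟨ cong toℕ eq ⟩
    toℕ (inject₁ j)              ≡⟨ Fin.toℕ-inject₁ j ⟩
    toℕ j                        ∎)))
    where open ≡-Reasoning
  ... | no j≮l with trans (sym (trans (cong (toℕ ∘ next) (next-inject₁ j))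
                      (toℕ-next-≡ (suc j) (cong suc j≡l)))) (trans (cong toℕ eq) (Fin.toℕ-inject₁ j))
    where
    j≡l : toℕ j ≡ suc l
    j≡l = ℕ.≤-antisym (ℕ.s≤s⁻¹ (Fin.toℕ<n j)) (ℕ.≮⇒≥ j≮l)
  ...   | 0≡j = contradiction (trans 0≡j (ℕ.≤-antisym (ℕ.s≤s⁻¹ (Fin.toℕ<n j)) (ℕ.≮⇒≥ j≮l))) λ ()

  module _ {n k} (Γ : Graph n k) where

    open Graph Γ

    data Path : Fin n → Fin n → Set where
      trivial : ∀ x → Path x x
      step    : ∀ {x y z} e → Joins e x y → Path y z → Path x z

  module _ {n k} {Γ : Graph n k} where

    open Graph Γ

    infix 4 _∈ᵛ_ _∈ᵉ_

    _∈ᵛ_ : ∀ {x z} → Fin n → Path Γ x z → Set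
    w ∈ᵛ trivial x        = w ≡ x
    w ∈ᵛ step {x} e j p = w ≡ x ⊎ w ∈ᵛ p

    _∈ᵉ_ : ∀ {x z} → Fin k → Path Γ x z → Set
    f ∈ᵉ trivial x  = Empty.⊥
    f ∈ᵉ step e j p = f ≡ e ⊎ f ∈ᵉ p

    Simple : ∀ {x z} → Path Γ x z → Set
    Simple (trivial x)      = ⊤
    Simple (step {x} e j p) = ¬ x ∈ᵛ p × Simple p

    length : ∀ {x z} → Path Γ x z → ℕ
    length (trivial x)  = 0
    length (step e j p) = suc (length p)

    snoc : ∀ {x y z} → Path Γ x y → ∀ e → Joins e y z → Path Γ x z
    snoc (trivial x)    f j = step f j (trivial _)
    snoc (step e i p) f j = step e i (snoc p f j)

    ∈ᵛ-snoc : ∀ {x y z w} (p : Path Γ x y) {e} (j : Joins e y z) →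
              w ∈ᵛ snoc p e j → w ∈ᵛ p ⊎ w ≡ z
    ∈ᵛ-snoc (trivial x)  j (inj₁ w≡) = inj₁ w≡
    ∈ᵛ-snoc (trivial x)  j (inj₂ w≡) = inj₂ w≡
    ∈ᵛ-snoc (step e i p) j (inj₁ w≡) = inj₁ (inj₁ w≡)
    ∈ᵛ-snoc (step e i p) j (inj₂ w∈) = Sum.map₁ inj₂ (∈ᵛ-snoc p j w∈)

    ∈ᵉ-snoc : ∀ {x y z f} (p : Path Γ x y) {e} (j : Joins e y z) →
              f ∈ᵉ snoc p e j → f ∈ᵉ p ⊎ f ≡ e
    ∈ᵉ-snoc (trivial x)  j (inj₁ f≡) = inj₂ f≡
    ∈ᵉ-snoc (step e i p) j (inj₁ f≡) = inj₁ (inj₁ f≡)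
    ∈ᵉ-snoc (step e i p) j (inj₂ f∈) = Sum.map₁ inj₂ (∈ᵉ-snoc p j f∈)

    Simple-snoc : ∀ {x y z} (p : Path Γ x y) {e} (j : Joins e y z) →
                  Simple p → ¬ z ∈ᵛ p → Simple (snoc p e j)
    Simple-snoc (trivial x)  j _         z∉p = (λ x≡z → z∉p (sym x≡z)) , tt
    Simple-snoc (step e i p) j (x∉p , s) z∉p =
      (λ x∈ → [ x∉p , (λ x≡z → z∉p (inj₁ (sym x≡z))) ]′ (∈ᵛ-snoc p j x∈)) ,
      Simple-snoc p j s (z∉p ∘ inj₂)

    vertexAt : ∀ {x z} (p : Path Γ x z) → Fin (suc (length p)) → Fin n
    vertexAt {x} p          zero    = x
    vertexAt (step e j p)   (suc i) = vertexAt p i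

    -- The i-th edge of the closed walk which f completes.

    edgeAt : ∀ {x z} (p : Path Γ x z) → Fin k → Fin (suc (length p)) → Fin k
    edgeAt (trivial x)  f _       = f
    edgeAt (step e j p) f zero    = e
    edgeAt (step e j p) f (suc i) = edgeAt p f i

    vertexAt-fromℕ : ∀ {x z} (p : Path Γ x z) → vertexAt p (fromℕ (length p)) ≡ z
    vertexAt-fromℕ (trivial x)  = refl
    vertexAt-fromℕ (step e j p) = vertexAt-fromℕ p

    edgeAt-fromℕ : ∀ {x z} (p : Path Γ x z) f → edgeAt p f (fromℕ (length p)) ≡ f
    edgeAt-fromℕ (trivial x)  f = refl
    edgeAt-fromℕ (step e j p) f = edgeAt-fromℕ p f

    Joins-edgeAt : ∀ {x z} (p : Path Γ x z) f (i : Fin (length p)) →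
                   Joins (edgeAt p f (inject₁ i)) (vertexAt p (inject₁ i)) (vertexAt p (suc i))
    Joins-edgeAt (step e j p)              f zero    = j
    Joins-edgeAt (step e j p@(step _ _ _)) f (suc i) = Joins-edgeAt p f i

    vertexAt-∈ᵛ : ∀ {x z} (p : Path Γ x z) i → vertexAt p i ∈ᵛ p
    vertexAt-∈ᵛ (trivial x)  zero    = refl
    vertexAt-∈ᵛ (step e j p) zero    = inj₁ refl
    vertexAt-∈ᵛ (step e j p) (suc i) = inj₂ (vertexAt-∈ᵛ p i)

    vertexAt-injective : ∀ {x z} (p : Path Γ x z) → Simple p → Injective _≡_ _≡_ (vertexAt p)
    vertexAt-injective p            s         {zero}  {zero}  eq = refl
    vertexAt-injective (step e j p) (x∉p , s) {zero}  {suc i} eq =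
      contradiction (subst (_∈ᵛ p) (sym eq) (vertexAt-∈ᵛ p i)) x∉p
    vertexAt-injective (step e j p) (x∉p , s) {suc i} {zero}  eq =
      contradiction (subst (_∈ᵛ p) eq (vertexAt-∈ᵛ p i)) x∉p
    vertexAt-injective (step e j p) (x∉p , s) {suc i} {suc l} eq =
      cong suc (vertexAt-injective p s eq)

    edgeAt⇔ : ∀ {x z} (p : Path Γ x z) {f e} → (∃ λ i → edgeAt p f i ≡ e) ⇔ (e ∈ᵉ p ⊎ e ≡ f)
    edgeAt⇔ p = mk⇔ (λ (i , eq) → forth p i eq) (back p)
      where
      forth : ∀ {x z} (p : Path Γ x z) {f e} i → edgeAt p f i ≡ e → e ∈ᵉ p ⊎ e ≡ f
      forth (trivial x)  zero    eq = inj₂ (sym eq)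
      forth (step e j p) zero    eq = inj₁ (inj₁ (sym eq))
      forth (step e j p) (suc i) eq = Sum.map₁ inj₂ (forth p i eq)

      back : ∀ {x z} (p : Path Γ x z) {f e} → e ∈ᵉ p ⊎ e ≡ f → ∃ λ i → edgeAt p f i ≡ e
      back p            {f} (inj₂ refl)        = fromℕ _ , edgeAt-fromℕ p f
      back (step e j p) (inj₁ (inj₁ e≡))   = zero , sym e≡
      back (step e j p) (inj₁ (inj₂ e∈)) =
        let (i , eq) = back p (inj₁ e∈) in suc i , eq

    module _ {M H} (P : Presentation M Γ H) where

      open Presentation P

      -- Distinct vertices are enough. If two edges of the walk coincide, their ends agree either in
      -- order, which gives equal indices, or crosswise, which `next²≢` excludes from length 3 on. A
      -- new vertex lies on a single edge, so every intersection of two edges of the walk consists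
      -- of old vertices.
      looseCycle : ∀ {l} → 3 ≤ l → (v : Fin l → Fin n) (e : Fin l → Fin k) →
                   Injective _≡_ _≡_ v → (∀ i → Joins (e i) (v i) (v (next i))) →
                   ∃ λ C → IsLooseCycle H C × (∀ f → ↔.to edges f ∈ C ⇔ ∃ λ i → e i ≡ f)
      looseCycle {l} 3≤l v e v-inj joins = C , isCycle , λ f → mk⇔
        (λ f∈C → let (i , eq) = to (C-spec _) f∈C in i , ↔-injective edges eq)
        (λ (i , eq) → from (C-spec _) (i , cong (↔.to edges) eq))
        where
        hit? : ∀ f → Dec (∃ λ i → ↔.to edges (e i) ≡ f)
        hit? f = any? λ i → ↔.to edges (e i) ≟ f

        C : Subset (size H)
        C = Vec.tabulate λ f → does (hit? f)

        C-spec : ∀ f → f ∈ C ⇔ ∃ λ i → ↔.to edges (e i) ≡ f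
        C-spec f with hit? f in eq
        ... | yes hit = mk⇔ (λ _ → hit) (λ _ → from ∈⇔lookup
                (trans (Vec.lookup∘tabulate _ f) (cong does eq)))
        ... | no ¬hit = mk⇔ (λ f∈C → contradiction
                (trans (sym (trans (Vec.lookup∘tabulate _ f) (cong does eq))) (to ∈⇔lookup f∈C)) λ ())
                (λ hit → contradiction hit ¬hit)

        e-inj : Injective _≡_ _≡_ e
        e-inj {i} {j} eq
          with Joins-end (joins j) (subst (Incident (v i)) eq (Joins⇒Incidentˡ (joins i)))
             | Joins-end (joins j) (subst (Incident (v (next i))) eq (Joins⇒Incidentʳ (joins i)))
        ... | inj₁ p | _      = v-inj p
        ... | inj₂ p | inj₂ q = next-injective (v-inj q)
        ... | inj₂ p | inj₁ q =
          contradiction (trans (cong next (v-inj q)) (sym (v-inj p))) (next²≢ 3≤l i)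

        common : ∀ {i j p} → i ≢ j → On Γ {M} p (e i) → On Γ p (e j) →
                 ∃ λ x → p ≡ inj₁ x × Incident x (e i) × Incident x (e j)
        common {p = inj₁ x}       i≢j on on′ = x , refl , on , on′
        common {p = inj₂ (f , r)} i≢j on on′ = contradiction (e-inj (trans (sym on) on′)) i≢j

        common-base : ∀ {i j w} → i ≢ j →
          w ∈ edge H (↔.to edges (e i)) ∩ edge H (↔.to edges (e j)) →
          ∃ λ x → w ≡ base x × (x ≡ v i ⊎ x ≡ v (next i)) × (x ≡ v j ⊎ x ≡ v (next j))
        common-base {i} {j} {w} i≢j w∈ with Subset.x∈p∩q⁻ _ _ w∈
        ... | w∈i , w∈j with common i≢j (to (incidence′ w _) w∈i) (to (incidence′ w _) w∈j)
        ... | x , p≡ , x∈i , x∈j = x ,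
          trans (sym (↔.strictlyInverseˡ vertices w)) (cong (↔.to vertices) p≡) ,
          Joins-end (joins i) x∈i , Joins-end (joins j) x∈j

        isCycle : IsLooseCycle H C
        isCycle = record
          { len         = l
          ; len≥3       = 3≤l
          ; v           = base ∘ v
          ; e           = ↔.to edges ∘ e
          ; v-injective = λ eq → v-inj (Sum-inj (↔-injective vertices eq))
          ; e-injective = λ eq → e-inj (↔-injective edges eq)
          ; consecutive = λ i → Subset.⊆-antisym (meet⊆ i) (meet⊇ i)
          ; disjoint    = λ i j i≢j j≢ni i≢nj (w , w∈) →
              case common-base i≢j w∈ of λ
                { (x , _ , inj₁ p , inj₁ q) → i≢j (v-inj (trans (sym p) q))
                ; (x , _ , inj₁ p , inj₂ q) → i≢nj (v-inj (trans (sym p) q))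
                ; (x , _ , inj₂ p , inj₁ q) → j≢ni (v-inj (trans (sym q) p))
                ; (x , _ , inj₂ p , inj₂ q) → i≢j (next-injective (v-inj (trans (sym p) q)))
                }
          ; edges       = C-spec
          }
          where
          Sum-inj : ∀ {A B : Set} {x y : A} → inj₁ {B = B} x ≡ inj₁ y → x ≡ y
          Sum-inj refl = refl

          meet⊆ : ∀ i {w} → w ∈ edge H (↔.to edges (e i)) ∩ edge H (↔.to edges (e (next i))) →
                  w ∈ ⁅ base (v (next i)) ⁆
          meet⊆ i w∈ with common-base (next≢ (ℕ.<⇒≤ 3≤l) i ∘ sym) w∈
          ... | x , refl , inj₂ refl , _         = Subset.x∈⁅x⁆ _
          ... | x , refl , inj₁ _    , inj₁ refl = Subset.x∈⁅x⁆ _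
          ... | x , refl , inj₁ p    , inj₂ q    =
            contradiction (v-inj (trans (sym q) p)) (next²≢ 3≤l i)

          meet⊇ : ∀ i {w} → w ∈ ⁅ base (v (next i)) ⁆ →
                  w ∈ edge H (↔.to edges (e i)) ∩ edge H (↔.to edges (e (next i)))
          meet⊇ i w∈ rewrite Subset.x∈⁅y⁆⇒x≡y _ w∈ = Subset.x∈p∩q⁺
            ( from (incidence (inj₁ _) _) (Joins⇒Incidentʳ (joins i))
            , from (incidence (inj₁ _) _) (Joins⇒Incidentˡ (joins (next i))))

      -- The set `C` is described by the edges of the path, because cycles are told apart below by
      -- the chords which they contain.
      close : ∀ {x z f} (p : Path Γ x z) → Simple p → 2 ≤ length p → Joins f z x →
              ∃ λ C → IsLooseCycle H C × (∀ e → ↔.to edges e ∈ C ⇔ (e ∈ᵉ p ⊎ e ≡ f))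
      close {x} {z} {f} p s 2≤l j =
        let (C , isCycle , spec) = looseCycle (s≤s 2≤l) (vertexAt p) (edgeAt p f)
                                     (vertexAt-injective p s) joins
        in C , isCycle , λ e → mk⇔
             (λ e∈C → to (edgeAt⇔ p) (to (spec e) e∈C))
             (λ e∈p → from (spec e) (from (edgeAt⇔ p) e∈p))
        where
        joins : ∀ i → Joins (edgeAt p f i) (vertexAt p i) (vertexAt p (next i))
        joins i with view i
        ... | ‵inject₁ a rewrite next-inject₁ a = Joins-edgeAt p f a
        ... | ‵fromℕ rewrite next-fromℕ (length p) | edgeAt-fromℕ p f | vertexAt-fromℕ p = j

  -- Breadth-first trees

  -- The witness `b` only bounds the upward search.
  least : ∀ {P : ℕ → Set} → (∀ l → Dec (P l)) → ∀ b → P b →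
          ∃ λ l → P l × (∀ l′ → P l′ → l ≤ l′)
  least P? b Pb with P? 0
  ... | yes P0 = 0 , P0 , λ _ _ → z≤n
  least P? zero    P0 | no ¬P0 = contradiction P0 ¬P0
  least P? (suc b) Pb | no ¬P0 with least (P? ∘ suc) b Pb
  ... | l , Pl , min = suc l , Pl , λ { zero P0 → contradiction P0 ¬P0 ; (suc l′) P → s≤s (min l′ P) }

  module SearchTree {n k} (Γ : Graph (suc n) k) (connected : ∀ x y → Star (Graph.Adj Γ) x y) where

    open Graph Γ

    -- Walks to the root of length exactly `l`. Fixing the length makes the predicate decidable by
    -- finite search, and the least such length is the distance to the root.
    Reach : ℕ → Fin (suc n) → Set
    Reach zero    x = x ≡ zero
    Reach (suc l) x = ∃₂ λ y e → Joins e x y × Reach l y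

    Reach? : ∀ l x → Dec (Reach l x)
    Reach? zero    x = x ≟ zero
    Reach? (suc l) x = any? λ y → any? λ e → Joins? e x y ×-dec Reach? l y

    reach : ∀ {x} → Star Adj x zero → ∃ λ l → Reach l x
    reach ε             = 0 , refl
    reach ((e , j) ◅ s) = let (l , r) = reach s in suc l , _ , e , j , r

    abstract
      shortest : ∀ x → ∃ λ l → Reach l x × (∀ l′ → Reach l′ x → l ≤ l′)
      shortest x = let (l , r) = reach (connected x zero) in least (λ l → Reach? l x) l r

    depth : Fin (suc n) → ℕ
    depth x = proj₁ (shortest x)

    depth-≤ : ∀ {l x} → Reach l x → depth x ≤ l
    depth-≤ {x = x} r = proj₂ (proj₂ (shortest x)) _ r

    depth-Joins : ∀ {e x y} → Joins e x y → depth x ≤ suc (depth y)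
    depth-Joins {y = y} j = depth-≤ (_ , _ , j , proj₁ (proj₂ (shortest y)))

    abstract
      tree : ∀ i → ∃₂ λ e y → Joins e (suc i) y × depth (suc i) ≡ suc (depth y)
      tree i with shortest (suc i)
      ... | suc l , (y , e , j , r) , min =
        e , y , j , cong suc (ℕ.≤-antisym (ℕ.s≤s⁻¹ (min _ (_ , _ , j , proj₁ (proj₂ (shortest y)))))
                                          (depth-≤ r))

    treeEdge : Fin n → Fin k
    treeEdge i = proj₁ (tree i)

    parent : Fin n → Fin (suc n)
    parent i = proj₁ (proj₂ (tree i))

    treeEdge-Joins : ∀ i → Joins (treeEdge i) (suc i) (parent i)
    treeEdge-Joins i = proj₁ (proj₂ (proj₂ (tree i)))

    depth-parent : ∀ i → depth (suc i) ≡ suc (depth (parent i))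
    depth-parent i = proj₂ (proj₂ (proj₂ (tree i)))

    depth≡0 : ∀ {x} → depth x ≡ 0 → x ≡ zero
    depth≡0 {zero}  _  = refl
    depth≡0 {suc i} eq with trans (sym (depth-parent i)) eq
    ... | ()

    -- Two distinct vertices with the same tree edge would be each other's parents, and each would
    -- be deeper than the other.
    treeEdge-injective : Injective _≡_ _≡_ treeEdge
    treeEdge-injective {i} {j} eq
      with Joins-end (treeEdge-Joins j) (subst (Incident (suc i)) eq (Joins⇒Incidentˡ (treeEdge-Joins i)))
         | Joins-end (treeEdge-Joins i) (subst (Incident (suc j)) (sym eq) (Joins⇒Incidentˡ (treeEdge-Joins j)))
    ... | inj₁ p | _      = Fin.suc-injective p
    ... | inj₂ _ | inj₁ q = Fin.suc-injective (sym q)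
    ... | inj₂ p | inj₂ q = contradiction
      (trans (depth-parent i) (cong suc (trans (cong depth (sym q)) (trans (depth-parent j)
        (cong (suc ∘ depth) (sym p))))))
      (ℕ.<⇒≢ (ℕ.<-trans (ℕ.n<1+n _) (ℕ.n<1+n _)))

    data Ancestor (x : Fin (suc n)) : Fin (suc n) → Set where
      self  : Ancestor x x
      above : ∀ {i} → Ancestor x (parent i) → Ancestor x (suc i)

    Ancestor-depth : ∀ {x y} → Ancestor x y → x ≡ y ⊎ depth x < depth y
    Ancestor-depth self              = inj₁ refl
    Ancestor-depth (above {i} a) rewrite depth-parent i with Ancestor-depth a
    ... | inj₁ refl = inj₂ ℕ.≤-refl
    ... | inj₂ x<y  = inj₂ (ℕ.m<n⇒m<1+n x<y)

    Ancestor⇒depth-≤ : ∀ {x y} → Ancestor x y → depth x ≤ depth y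
    Ancestor⇒depth-≤ a with Ancestor-depth a
    ... | inj₁ refl = ℕ.≤-refl
    ... | inj₂ x<y  = ℕ.<⇒≤ x<y

    root-Ancestor : ∀ x → Ancestor zero x
    root-Ancestor x = go (depth x) x refl
      where
      go : ∀ d x → depth x ≡ d → Ancestor zero x
      go d       zero    eq = self
      go zero    (suc i) eq with trans (sym (depth-parent i)) eq
      ... | ()
      go (suc d) (suc i) eq = above (go d (parent i) (ℕ.suc-injective (trans (sym (depth-parent i)) eq)))

    IsTree : Fin k → Set
    IsTree e = ∃ λ i → treeEdge i ≡ e

    record TreePath (x y : Fin (suc n)) : Set where
      field
        path       : Path Γ x y
        isSimple   : Simple path
        isTree     : ∀ {e} → e ∈ᵉ path → IsTree e
        isAncestor : ∀ {w} → w ∈ᵛ path → Ancestor w x ⊎ Ancestor w y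

    open TreePath public

    -- Move the deeper of the two ends to its parent until the ends meet; `b` bounds the sum of the
    -- depths. The end just left does not recur: every vertex of the remaining path is an ancestor
    -- of one of its ends, the parent lies higher, and the other end is distinct from the end left
    -- and no deeper.
    treePath : ∀ x y → TreePath x y
    treePath x y = go _ x y ℕ.≤-refl
      where
      go : ∀ b x y → depth x + depth y ≤ b → TreePath x y
      go b x y x+y≤b with x ≟ y
      ... | yes refl = record
        { path       = trivial x
        ; isSimple   = tt
        ; isTree     = λ ()
        ; isAncestor = λ { refl → inj₁ self }
        }
      ... | no x≢y with depth y ℕ.≤? depth x
      go b zero y _ | no x≢y | yes y≤x =
        contradiction (sym (depth≡0 (ℕ.n≤0⇒n≡0 (ℕ.≤-trans y≤x (depth-≤ refl))))) x≢y
      go zero (suc i) y x+y≤b | no x≢y | yes y≤x =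
        contradiction (trans (sym (depth-parent i)) (ℕ.m+n≡0⇒m≡0 (depth (suc i)) (ℕ.n≤0⇒n≡0 x+y≤b))) λ ()
      go (suc b) (suc i) y x+y≤b | no x≢y | yes y≤x = record
        { path       = step (treeEdge i) (treeEdge-Joins i) (path IH)
        ; isSimple   = x∉ , isSimple IH
        ; isTree     = λ { (inj₁ refl) → i , refl ; (inj₂ e∈) → isTree IH e∈ }
        ; isAncestor = λ { (inj₁ refl) → inj₁ self ; (inj₂ w∈) → Sum.map₁ above (isAncestor IH w∈) }
        }
        where
        IH = go b (parent i) y (ℕ.s≤s⁻¹ (subst (λ d → d + depth y ≤ suc b) (depth-parent i) x+y≤b))
        x∉ : ¬ suc i ∈ᵛ path IH
        x∉ x∈ with isAncestor IH x∈
        ... | inj₁ a = ℕ.<⇒≱ (ℕ.≤-reflexive (sym (depth-parent i))) (Ancestor⇒depth-≤ a)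
        ... | inj₂ a with Ancestor-depth a
        ...   | inj₁ x≡y = x≢y x≡y
        ...   | inj₂ x<y = ℕ.<⇒≱ x<y y≤x
      go b x zero _ | no x≢y | no y≰x =
        contradiction (ℕ.≤-trans (depth-≤ refl) z≤n) y≰x
      go zero x (suc i) x+y≤b | no x≢y | no y≰x =
        contradiction (trans (sym (depth-parent i)) (ℕ.m+n≡0⇒n≡0 (depth x) (ℕ.n≤0⇒n≡0 x+y≤b))) λ ()
      go (suc b) x (suc i) x+y≤b | no x≢y | no y≰x = record
        { path       = snoc (path IH) (treeEdge i) joins
        ; isSimple   = Simple-snoc (path IH) joins (isSimple IH) y∉
        ; isTree     = λ e∈ → [ isTree IH , (λ { refl → i , refl }) ]′ (∈ᵉ-snoc (path IH) joins e∈)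
        ; isAncestor = λ w∈ → [ (λ w∈ → Sum.map₂ above (isAncestor IH w∈)) , (λ { refl → inj₂ self }) ]′
                                (∈ᵛ-snoc (path IH) joins w∈)
        }
        where
        joins = Joins-sym (treeEdge-Joins i)
        IH = go b x (parent i) (ℕ.s≤s⁻¹ (subst (ℕ._≤ suc b)
               (trans (cong (depth x ℕ.+_) (depth-parent i)) (ℕ.+-suc (depth x) _)) x+y≤b))
        y∉ : ¬ suc i ∈ᵛ path IH
        y∉ y∈ with isAncestor IH y∈
        ... | inj₁ a = y≰x (Ancestor⇒depth-≤ a)
        ... | inj₂ a = ℕ.<⇒≱ (ℕ.≤-reflexive (sym (depth-parent i))) (Ancestor⇒depth-≤ a)

    -- In a breadth-first tree the depths of the ends of an edge differ by at
    -- most 1, so the only ancestor which could be a neighbour is the parent.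

    nontree⇒¬Ancestor : ∀ {e x y} → ¬ IsTree e → Joins e x y → ¬ Ancestor x y
    nontree⇒¬Ancestor ¬tree j self = loopless j refl
    nontree⇒¬Ancestor ¬tree j (above {i} a) with Ancestor-depth a
    ... | inj₁ refl = ¬tree (i , simple (treeEdge-Joins i) (Joins-sym j))
    ... | inj₂ x<p  = ℕ.<⇒≱ (s≤s x<p) (subst (ℕ._≤ _) (depth-parent i) (depth-Joins (Joins-sym j)))

    nontree-misses-root : ∀ {e} → ¬ IsTree e → ¬ Incident zero e
    nontree-misses-root ¬tree inc with Incident⇒Joins inc
    ... | y , j = nontree⇒¬Ancestor ¬tree j (root-Ancestor y)

    module _ {M H} (P : Presentation M Γ H) where

      open Presentation P

      -- The tree path between the ends of `f` has at least two edges, since length 0 would make `f`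
      -- a loop and length 1 would make it a tree edge. Among the non-tree edges the cycle contains
      -- `f` alone, so distinct chords give distinct cycles.
      fundamentalCycle : ∀ f → ¬ IsTree f →
        ∃ λ C → IsLooseCycle H C × (∀ e → ¬ IsTree e → ↔.to edges e ∈ C ⇔ e ≡ f)
      fundamentalCycle f ¬tree
        with treePath (src f) (tgt f)
      ... | p with close P (path p) (isSimple p) (long (path p) (isTree p)) (inj₂ (refl , refl))
        where
        long : (q : Path Γ (src f) (tgt f)) → (∀ {e} → e ∈ᵉ q → IsTree e) → 2 ≤ length q
        long q t = long′ q t refl refl
          where
          long′ : ∀ {x y} (q : Path Γ x y) → (∀ {e} → e ∈ᵉ q → IsTree e) →
                  x ≡ src f → y ≡ tgt f → 2 ≤ length q
          long′ (trivial x)                 t x≡ y≡ = contradiction refl (loopless (inj₁ (x≡ , y≡)))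
          long′ (step e j (trivial _))      t x≡ y≡ = contradiction
            (subst IsTree (simple j (inj₁ (x≡ , y≡))) (t (inj₁ refl))) ¬tree
          long′ (step e j (step _ _ _))     t x≡ y≡ = s≤s (s≤s z≤n)
      ... | C , isCycle , spec = C , isCycle , λ e ¬tree′ → mk⇔
        (λ e∈C → [ (λ e∈ → contradiction (isTree p e∈) ¬tree′) , id ]′ (to (spec e) e∈C))
        (λ e≡f → from (spec e) (inj₂ e≡f))

      -- Go from `x` along `f`, then through the tree, and back along `g`. The vertex `x` is not on
      -- the tree path, whose vertices are ancestors of `y` or of `z`, because `x` is joined to both
      -- by non-tree edges. If `y` and `z` were equal, `f` and `g` would be parallel.
      combinedCycle : ∀ {f g x} → ¬ IsTree f → ¬ IsTree g → f ≢ g → Incident x f → Incident x g →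
        ∃ λ C → IsLooseCycle H C × ↔.to edges f ∈ C × ↔.to edges g ∈ C
      combinedCycle {f} {g} {x} ¬tf ¬tg f≢g x∈f x∈g
        with Incident⇒Joins x∈f | Incident⇒Joins x∈g
      ... | y , jf | z , jg with treePath y z
      ... | p with close P (step f jf (path p)) (x∉ , isSimple p) (long (path p)) (Joins-sym jg)
        where
        x∉ : ¬ x ∈ᵛ path p
        x∉ x∈ = [ nontree⇒¬Ancestor ¬tf jf , nontree⇒¬Ancestor ¬tg jg ]′ (isAncestor p x∈)
        long : (q : Path Γ y z) → 2 ≤ suc (length q)
        long (trivial _)  = contradiction (simple jf jg) f≢g
        long (step _ _ _) = s≤s (s≤s z≤n)
      ... | C , isCycle , spec = C , isCycle , from (spec f) (inj₁ (inj₁ refl)) , from (spec g) (inj₂ refl)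

      module _ (three : ThreeCyclic H) (f : Fin 3 → Fin k)
               (f-inj : Injective _≡_ _≡_ f) (¬tree : ∀ i → ¬ IsTree (f i)) where

        -- Otherwise the three fundamental cycles and the combined cycle are
        -- four loose cycles.

        nontree-disjoint : ∀ {i j x} → i ≢ j → Incident x (f i) → ¬ Incident x (f j)
        nontree-disjoint {i} {j} i≢j x∈i x∈j =
          let (C , isCycle , fi∈C , fj∈C) = combinedCycle (¬tree i) (¬tree j) (i≢j ∘ f-inj) x∈i x∈j
              -- Four loose cycles are indexed by `Fin 3`; two with equal indices have equal edge
              -- sets, which `separate` refutes.
              (a , b , a<b , eq) = pigeonhole ℕ.≤-refl (index C isCycle)
          in separate C fi∈C fj∈C a b a<b
               (trans (sym (proj₂ (indexed C isCycle a))) (trans (cong (proj₁ three) eq)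
                 (proj₂ (indexed C isCycle b))))
          where
          F : Fin 3 → Subset (size H)
          F l = proj₁ (fundamentalCycle (f l) (¬tree l))

          F-spec : ∀ l l′ → ↔.to edges (f l) ∈ F l′ ⇔ f l ≡ f l′
          F-spec l l′ = proj₂ (proj₂ (fundamentalCycle (f l′) (¬tree l′))) (f l) (¬tree l)

          cycle : Subset (size H) → Fin 4 → Subset (size H)
          cycle C zero    = C
          cycle C (suc l) = F l

          indexed : ∀ C → IsLooseCycle H C → ∀ a → ∃ λ l → proj₁ three l ≡ cycle C a
          indexed C isCycle zero    = to (proj₂ (proj₂ three) C) isCycle
          indexed C isCycle (suc l) =
            to (proj₂ (proj₂ three) (F l)) (proj₁ (proj₂ (fundamentalCycle (f l) (¬tree l))))

          index : ∀ C → IsLooseCycle H C → Fin 4 → Fin 3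
          index C isCycle a = proj₁ (indexed C isCycle a)

          separate : ∀ C → ↔.to edges (f i) ∈ C → ↔.to edges (f j) ∈ C →
                     ∀ a b → a Fin.< b → cycle C a ≢ cycle C b
          -- `C` contains two chords, a fundamental cycle only one.
          separate C i∈ j∈ zero (suc l) _ refl = i≢j (trans (f-inj (to (F-spec i l) i∈))
                                                       (sym (f-inj (to (F-spec j l) j∈))))
          separate C i∈ j∈ (suc l) (suc l′) l<l′ eq = Fin.<⇒≢ l<l′ (cong suc (f-inj
            (to (F-spec l l′) (subst (↔.to edges (f l) ∈_) eq (from (F-spec l l) refl)))))

  -- Windmills

  -- `ends` asks only that the prescribed ends be joined by the corresponding edge, so the
  -- orientation may change edge by edge.
  module Pullback {n k n′ k′} (Γ : Graph n k) (φ : Fin n′ ↔ Fin n) (ψ : Fin k′ ↔ Fin k)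
    (src′ tgt′ : Fin k′ → Fin n′)
    (ends : ∀ e → Graph.Joins Γ (↔.to ψ e) (↔.to φ (src′ e)) (↔.to φ (tgt′ e))) where

    open Graph Γ

    Joins⁺ : ∀ {e x y} → Ends.Joins src′ tgt′ e x y → Joins (↔.to ψ e) (↔.to φ x) (↔.to φ y)
    Joins⁺ {e} (inj₁ (refl , refl)) = ends e
    Joins⁺ {e} (inj₂ (refl , refl)) = Joins-sym (ends e)

    graph : Graph n′ k′
    graph = record
      { src      = src′
      ; tgt      = tgt′
      ; loopless = λ j x≡y → loopless (Joins⁺ j) (cong (↔.to φ) x≡y)
      ; simple   = λ i j → ↔-injective ψ (simple (Joins⁺ i) (Joins⁺ j))
      }

    presentation : ∀ {M H} → Presentation M Γ H → Presentation M graph H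
    presentation P = relabel P φ ψ λ x e → mk⇔
      (λ inc → Sum.map (↔-injective φ) (↔-injective φ) (Joins-end (ends e) inc))
      (λ { (inj₁ refl) → Joins⇒Incidentˡ (ends e) ; (inj₂ refl) → Joins⇒Incidentʳ (ends e) })

  pattern suc⁶ q = suc (suc (suc (suc (suc (suc q)))))
  pattern suc⁷ q = suc (suc⁶ q)
  pattern suc⁹ q = suc (suc (suc⁷ q))

  -- A windmill has three blades, two vertices each, and ℓ further vertices
  -- besides the hub; its edges are the blades and one edge for each vertex
  -- other than the hub.  They are numbered as in T₂C.

  module _ {ℓ : ℕ} where

    -- `inj₁ j` will be the edge from vertex `suc j` to its parent, and `inj₂ i` the i-th blade,
    -- which comes from a chord. Each triangle of `T₂C` lists its edges as spoke, blade, spoke.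
    kind : Fin (9 + ℓ) → Fin (6 + ℓ) ⊎ Fin 3
    kind 0F = inj₁ 0F
    kind 1F = inj₂ 0F
    kind 2F = inj₁ 1F
    kind 3F = inj₁ 2F
    kind 4F = inj₂ 1F
    kind 5F = inj₁ 3F
    kind 6F = inj₁ 4F
    kind 7F = inj₂ 2F
    kind 8F = inj₁ 5F
    kind (suc⁹ q) =
      inj₁ (suc⁶ q)

    unkind : Fin (6 + ℓ) ⊎ Fin 3 → Fin (9 + ℓ)
    unkind (inj₁ 0F) = 0F
    unkind (inj₂ 0F) = 1F
    unkind (inj₁ 1F) = 2F
    unkind (inj₁ 2F) = 3F
    unkind (inj₂ 1F) = 4F
    unkind (inj₁ 3F) = 5F
    unkind (inj₁ 4F) = 6F
    unkind (inj₂ 2F) = 7F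
    unkind (inj₁ 5F) = 8F
    unkind (inj₁ (suc⁶ q)) =
      suc⁹ q

    kinds : Fin (9 + ℓ) ↔ (Fin (6 + ℓ) ⊎ Fin 3)
    kinds = mk↔ₛ′ kind unkind kind-unkind unkind-kind
      where
      kind-unkind : ∀ κ → kind (unkind κ) ≡ κ
      kind-unkind (inj₁ 0F) = refl
      kind-unkind (inj₂ 0F) = refl
      kind-unkind (inj₁ 1F) = refl
      kind-unkind (inj₁ 2F) = refl
      kind-unkind (inj₂ 1F) = refl
      kind-unkind (inj₁ 3F) = refl
      kind-unkind (inj₁ 4F) = refl
      kind-unkind (inj₂ 2F) = refl
      kind-unkind (inj₁ 5F) = refl
      kind-unkind (inj₁ (suc⁶ q)) = refl

      unkind-kind : ∀ e → unkind (kind e) ≡ e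
      unkind-kind 0F = refl
      unkind-kind 1F = refl
      unkind-kind 2F = refl
      unkind-kind 3F = refl
      unkind-kind 4F = refl
      unkind-kind 5F = refl
      unkind-kind 6F = refl
      unkind-kind 7F = refl
      unkind-kind 8F = refl
      unkind-kind (suc⁹ q) = refl

    left right : Fin 3 → Fin (7 + ℓ)
    left  0F = 1F
    left  1F = 3F
    left  2F = 5F
    right 0F = 2F
    right 1F = 4F
    right 2F = 6F

    windmillSrc : Fin (9 + ℓ) → Fin (7 + ℓ)
    windmillSrc e = [ suc , left ]′ (kind e)

    -- With `par` as a parameter the same formula covers both graphs to be compared: the parent map
    -- gives the graph of H, the constant map `hub` gives T.
    windmillTgt : (Fin (6 + ℓ) → Fin (7 + ℓ)) → Fin (9 + ℓ) → Fin (7 + ℓ)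
    windmillTgt par e = [ par , right ]′ (kind e)

    hub : Fin (6 + ℓ) → Fin (7 + ℓ)
    hub _ = zero

    -- A left inverse of both `left` and `right`. The value `0F` at the hub and at the pendant
    -- vertices is a dummy.
    blade : Fin (7 + ℓ) → Fin 3
    blade 3F = 1F
    blade 4F = 1F
    blade 5F = 2F
    blade 6F = 2F
    blade _  = 0F

    blade-left : ∀ i → blade (left i) ≡ i
    blade-left 0F = refl
    blade-left 1F = refl
    blade-left 2F = refl

    blade-right : ∀ i → blade (right i) ≡ i
    blade-right 0F = refl
    blade-right 1F = refl
    blade-right 2F = refl

    left≢0 : ∀ i → left i ≢ zero
    left≢0 0F ()
    left≢0 1F ()
    left≢0 2F ()

    right≢0 : ∀ i → right i ≢ zero
    right≢0 0F ()
    right≢0 1F ()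
    right≢0 2F ()

    left≢right : ∀ i → left i ≢ right i
    left≢right 0F ()
    left≢right 1F ()
    left≢right 2F ()

  windmill : ∀ ℓ → Graph (7 + ℓ) (9 + ℓ)
  windmill ℓ = record
    { src      = windmillSrc
    ; tgt      = windmillTgt hub
    ; loopless = λ {e} → loopless (kind e)
    ; simple   = λ {e} {f} i j → ↔-injective kinds (simple (kind e) (kind f) i j)
    }
    where
    src tgt : Fin (6 + ℓ) ⊎ Fin 3 → Fin (7 + ℓ)
    src = [ suc , left ]′
    tgt = [ hub , right ]′

    open Ends src tgt using (Joins)

    loopless : ∀ κ {x y} → Joins κ x y → x ≢ y
    loopless (inj₁ j) (inj₁ (refl , refl)) ()
    loopless (inj₁ j) (inj₂ (refl , refl)) ()
    loopless (inj₂ i) (inj₁ (refl , refl)) = left≢right i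
    loopless (inj₂ i) (inj₂ (refl , refl)) = left≢right i ∘ sym

    blade-Joins : ∀ i {x y} → Joins (inj₂ i) x y → blade x ≡ i
    blade-Joins i (inj₁ (refl , _)) = blade-left i
    blade-Joins i (inj₂ (refl , _)) = blade-right i

    no-hub : ∀ i {x y} → Joins (inj₂ i) x y → x ≢ zero × y ≢ zero
    no-hub i (inj₁ (refl , refl)) = left≢0 i , right≢0 i
    no-hub i (inj₂ (refl , refl)) = right≢0 i , left≢0 i

    simple : ∀ κ κ′ {x y} → Joins κ x y → Joins κ′ x y → κ ≡ κ′
    simple (inj₁ j) (inj₁ j′) (inj₁ (refl , refl)) (inj₁ (refl , _)) = refl
    simple (inj₁ j) (inj₁ j′) (inj₂ (refl , refl)) (inj₂ (_ , refl)) = refl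
    simple (inj₁ j) (inj₂ i)  (inj₁ (_ , p)) k = contradiction p (proj₂ (no-hub i k))
    simple (inj₁ j) (inj₂ i)  (inj₂ (p , _)) k = contradiction p (proj₁ (no-hub i k))
    simple (inj₂ i) (inj₁ j)  k (inj₁ (_ , p)) = contradiction p (proj₂ (no-hub i k))
    simple (inj₂ i) (inj₁ j)  k (inj₂ (p , _)) = contradiction p (proj₁ (no-hub i k))
    simple (inj₂ i) (inj₂ i′) k k′ = cong inj₂ (trans (sym (blade-Joins i k)) (blade-Joins i′ k′))

  -- Presentations of powers and of `T₂C`

  ∈-++-↑ˡ : ∀ {p q} (xs : Subset p) {ys : Subset q} {i : Fin p} →
                 i ↑ˡ q ∈ xs ++ ys ⇔ i ∈ xs
  ∈-++-↑ˡ xs {ys} {i} = mk⇔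
    (λ i∈ → from ∈⇔lookup (trans (sym (Vec.lookup-++ˡ xs ys i)) (to ∈⇔lookup i∈)))
    (λ i∈ → from ∈⇔lookup (trans (Vec.lookup-++ˡ xs ys i) (to ∈⇔lookup i∈)))

  ∈-++-↑ʳ : ∀ {p q} (xs : Subset p) {ys : Subset q} {i : Fin q} →
                 p ↑ʳ i ∈ xs ++ ys ⇔ i ∈ ys
  ∈-++-↑ʳ xs {ys} {i} = mk⇔
    (λ i∈ → from ∈⇔lookup (trans (sym (Vec.lookup-++ʳ xs ys i)) (to ∈⇔lookup i∈)))
    (λ i∈ → from ∈⇔lookup (trans (Vec.lookup-++ʳ xs ys i) (to ∈⇔lookup i∈)))

  combine∈block : ∀ {k} d {e f : Fin k} {r : Fin d} → combine e r ∈ block d f ⇔ e ≡ f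
  combine∈block d {e} {f} {r} with e ≟ f in eq
  ... | yes e≡f = mk⇔ (λ _ → e≡f) λ _ → from ∈⇔lookup (trans (lookup-block d e f r) (cong does eq))
  ... | no  e≢f = mk⇔ (λ e∈ → contradiction
          (trans (sym (trans (lookup-block d e f r) (cong does eq))) (to ∈⇔lookup e∈)) λ ())
          (λ e≡f → contradiction e≡f e≢f)

  power-presentation : ∀ {M} G (Γ : Graph (order G) (size G)) →
                       (∀ x e → x ∈ edge G e ⇔ Graph.Incident Γ x e) →
                       Presentation M Γ (power (2 + M) G)
  power-presentation {M} G Γ ends = record
    { vertices  = ↔-trans (↔-refl ⊎-↔ ↔-sym Fin.*↔×) (↔-sym Fin.+↔⊎)
    ; edges     = ↔-refl
    ; incidence = λ
        { (inj₁ x)       e → mk⇔ (λ x∈ → to (ends x e) (to (∈-++-↑ˡ (edge G e)) x∈))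
                                 (λ on → from (∈-++-↑ˡ (edge G e)) (from (ends x e) on))
        ; (inj₂ (f , r)) e → mk⇔ (λ f∈ → to (combine∈block M) (to (∈-++-↑ʳ (edge G e)) f∈))
                                 (λ on → from (∈-++-↑ʳ (edge G e)) (from (combine∈block M) on))
        }
    }

  module _ {M : ℕ} (2≤m : 2 ≤ 2 + M) where

    private
      K = power (2 + M) threeTriangles

    threeTriangles-ends : ∀ x e → x ∈ edge threeTriangles e ⇔ Graph.Incident (windmill 0) x e
    threeTriangles-ends x e = mk⇔ (proj₁ (check x e)) (proj₂ (check x e))
      where
      check : ∀ x e → (x ∈ edge threeTriangles e → Graph.Incident (windmill 0) x e)
                    × (Graph.Incident (windmill 0) x e → x ∈ edge threeTriangles e)
      -- There are 7 vertices and 9 edges, so all incidences are decided by evaluation.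
      check = from-yes (all? λ x → all? λ e →
        ((x ∈? edge threeTriangles e) →-dec ((x ≟ windmillSrc e) ⊎-dec (x ≟ windmillTgt hub e)))
          ×-dec (((x ≟ windmillSrc e) ⊎-dec (x ≟ windmillTgt hub e)) →-dec (x ∈? edge threeTriangles e)))

    triangles-presentation : Presentation M (windmill 0) K
    triangles-presentation = power-presentation threeTriangles (windmill 0) threeTriangles-ends

    private module P₀ = Presentation triangles-presentation

    module _ (vs : List (Vertex K)) (at-hub : ∀ q → List.lookup vs q ≡ P₀.base zero) where

      private
        ℓ = List.length vs

      SplitPoint : Set
      SplitPoint = (Fin 7 ⊎ Fin ℓ) ⊎ ((Fin 9 ⊎ Fin ℓ) × Fin M)

      SplitOn : SplitPoint → Fin 9 ⊎ Fin ℓ → Set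
      SplitOn (inj₁ (inj₁ x))  (inj₁ e) = Graph.Incident (windmill 0) x e
      SplitOn (inj₁ (inj₁ x))  (inj₂ q) = x ≡ zero
      SplitOn (inj₁ (inj₂ q′)) (inj₁ e) = Empty.⊥
      SplitOn (inj₁ (inj₂ q′)) (inj₂ q) = q′ ≡ q
      SplitOn (inj₂ (f , r))   e        = f ≡ e

      windmill-split : ∀ (p : Point (7 + ℓ) (9 + ℓ) M) e →
        On (windmill ℓ) p e ⇔
        SplitOn (Sum.map (splitAt 7) (λ (f , r) → splitAt 9 f , r) p) (splitAt 9 e)
      windmill-split (inj₂ (f , r)) e = mk⇔ (cong (splitAt 9)) (↔-injective Fin.+↔⊎)
      windmill-split (inj₁ x) e = subst₂
        (λ x′ e′ → Graph.Incident (windmill ℓ) x′ e′ ⇔ SplitOn (inj₁ (splitAt 7 x)) (splitAt 9 e))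
        (Fin.join-splitAt 7 ℓ x) (Fin.join-splitAt 9 ℓ e) (joined (splitAt 7 x) (splitAt 9 e))
        where
        endsˡ : ∀ (e : Fin 9) → windmillSrc (e ↑ˡ ℓ) ≡ windmillSrc e ↑ˡ ℓ
                    × windmillTgt hub (e ↑ˡ ℓ) ≡ windmillTgt hub e ↑ˡ ℓ
        endsˡ 0F = refl , refl
        endsˡ 1F = refl , refl
        endsˡ 2F = refl , refl
        endsˡ 3F = refl , refl
        endsˡ 4F = refl , refl
        endsˡ 5F = refl , refl
        endsˡ 6F = refl , refl
        endsˡ 7F = refl , refl
        endsˡ 8F = refl , refl

        srcˡ : ∀ (e : Fin 9) → windmillSrc (e ↑ˡ ℓ) ≡ windmillSrc e ↑ˡ ℓ
        srcˡ = proj₁ ∘ endsˡ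

        tgtˡ : ∀ (e : Fin 9) → windmillTgt hub (e ↑ˡ ℓ) ≡ windmillTgt hub e ↑ˡ ℓ
        tgtˡ = proj₂ ∘ endsˡ

        ↑ʳ≢↑ˡ : ∀ {x : Fin 7} {q : Fin ℓ} → 7 ↑ʳ q ≢ x ↑ˡ ℓ
        ↑ʳ≢↑ˡ {x} {q} eq with trans (sym (Fin.splitAt-↑ʳ 7 ℓ q)) (trans (cong (splitAt 7) eq) (Fin.splitAt-↑ˡ 7 x ℓ))
        ... | ()

        joined : ∀ s t → Graph.Incident (windmill ℓ) (join 7 ℓ s) (join 9 ℓ t) ⇔ SplitOn (inj₁ s) t
        joined (inj₁ x) (inj₁ e) = mk⇔
          (Sum.map (λ p → Fin.↑ˡ-injective ℓ _ _ (trans p (srcˡ e)))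
                   (λ p → Fin.↑ˡ-injective ℓ _ _ (trans p (tgtˡ e))))
          (Sum.map (λ p → trans (cong (_↑ˡ ℓ) p) (sym (srcˡ e)))
                   (λ p → trans (cong (_↑ˡ ℓ) p) (sym (tgtˡ e))))
        joined (inj₂ q) (inj₁ e) = mk⇔
          [ (λ p → ↑ʳ≢↑ˡ (trans p (srcˡ e))) , (λ p → ↑ʳ≢↑ˡ (trans p (tgtˡ e))) ]′ λ ()
        joined (inj₁ x) (inj₂ q) = mk⇔
          [ (λ p → contradiction (sym p) ↑ʳ≢↑ˡ) , Fin.↑ˡ-injective ℓ x zero ]′
          (λ { refl → inj₂ refl })
        joined (inj₂ q′) (inj₂ q) = mk⇔
          [ Fin.↑ʳ-injective 7 q′ q , (λ ()) ]′ (λ { refl → inj₁ refl })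

      -- A pendant edge brings m - 1 = 1 + M new vertices. The first of them serves as the old
      -- vertex at the far end of a spoke, the other `M` as the new vertices of that spoke in the
      -- power.
      regroup : SplitPoint ↔ (Point 7 9 M ⊎ Fin ℓ × Fin (suc M))
      regroup = mk↔ₛ′
        (λ { (inj₁ (inj₁ x))     → inj₁ (inj₁ x)
           ; (inj₁ (inj₂ q))     → inj₂ (q , zero)
           ; (inj₂ (inj₁ e , r)) → inj₁ (inj₂ (e , r))
           ; (inj₂ (inj₂ q , r)) → inj₂ (q , suc r) })
        (λ { (inj₁ (inj₁ x))       → inj₁ (inj₁ x)
           ; (inj₂ (q , zero))     → inj₁ (inj₂ q)
           ; (inj₁ (inj₂ (e , r))) → inj₂ (inj₁ e , r)
           ; (inj₂ (q , suc r))    → inj₂ (inj₂ q , r) })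
        (λ { (inj₁ (inj₁ x))       → refl
           ; (inj₂ (q , zero))     → refl
           ; (inj₁ (inj₂ (e , r))) → refl
           ; (inj₂ (q , suc r))    → refl })
        (λ { (inj₁ (inj₁ x))     → refl
           ; (inj₁ (inj₂ q))     → refl
           ; (inj₂ (inj₁ e , r)) → refl
           ; (inj₂ (inj₂ q , r)) → refl })

      splitVertices : SplitPoint ↔ Vertex (attachPendants 2≤m K vs)
      splitVertices = ↔-trans regroup (↔-trans (P₀.vertices ⊎-↔ ↔-sym Fin.*↔×) (↔-sym Fin.+↔⊎))

      old∈pendant : ∀ p q → ↔.to P₀.vertices p ∈ ⁅ List.lookup vs q ⁆ ⇔ p ≡ inj₁ zero
      old∈pendant p q = mk⇔
        (λ w∈ → ↔-injective P₀.vertices (trans (Subset.x∈⁅y⁆⇒x≡y _ w∈) (at-hub q)))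
        (λ { refl → subst (λ w → P₀.base zero ∈ ⁅ w ⁆) (sym (at-hub q)) (Subset.x∈⁅x⁆ (P₀.base zero)) })

      splitIncidence : ∀ p e → ↔.to splitVertices p ∈ pendantEdge 2≤m K vs e ⇔ SplitOn p e
      splitIncidence (inj₁ (inj₁ x)) (inj₁ e) = mk⇔
        (λ w∈ → to (P₀.incidence (inj₁ x) e) (to (∈-++-↑ˡ (edge K e)) w∈))
        (λ on → from (∈-++-↑ˡ (edge K e)) (from (P₀.incidence (inj₁ x) e) on))
      splitIncidence (inj₁ (inj₁ x)) (inj₂ q) = mk⇔
        (λ w∈ → case to (old∈pendant (inj₁ x) q) (to (∈-++-↑ˡ ⁅ List.lookup vs q ⁆) w∈) of λ { refl → refl })
        (λ { refl → from (∈-++-↑ˡ ⁅ List.lookup vs q ⁆) (from (old∈pendant (inj₁ x) q) refl) })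
      splitIncidence (inj₁ (inj₂ q′)) (inj₁ e) = mk⇔
        (λ w∈ → Subset.∉⊥ (to (∈-++-↑ʳ (edge K e)) w∈)) λ ()
      splitIncidence (inj₁ (inj₂ q′)) (inj₂ q) = mk⇔
        (λ w∈ → to (combine∈block (suc M)) (to (∈-++-↑ʳ ⁅ List.lookup vs q ⁆) w∈))
        (λ on → from (∈-++-↑ʳ ⁅ List.lookup vs q ⁆) (from (combine∈block (suc M)) on))
      splitIncidence (inj₂ (inj₁ f , r)) (inj₁ e) = mk⇔
        (λ w∈ → cong inj₁ (to (P₀.incidence (inj₂ (f , r)) e) (to (∈-++-↑ˡ (edge K e)) w∈)))
        (λ { refl → from (∈-++-↑ˡ (edge K e)) (from (P₀.incidence (inj₂ (f , r)) e) refl) })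
      splitIncidence (inj₂ (inj₁ f , r)) (inj₂ q) = mk⇔
        (λ w∈ → contradiction (to (old∈pendant (inj₂ (f , r)) q) (to (∈-++-↑ˡ ⁅ List.lookup vs q ⁆) w∈)) λ ())
        λ ()
      splitIncidence (inj₂ (inj₂ q′ , r)) (inj₁ e) = mk⇔
        (λ w∈ → contradiction (to (∈-++-↑ʳ (edge K e)) w∈) Subset.∉⊥) λ ()
      splitIncidence (inj₂ (inj₂ q′ , r)) (inj₂ q) = mk⇔
        (λ w∈ → cong inj₂ (to (combine∈block (suc M) {q′} {q} {suc r}) (to (∈-++-↑ʳ ⁅ List.lookup vs q ⁆) w∈)))
        (λ { refl → from (∈-++-↑ʳ ⁅ List.lookup vs q ⁆) (from (combine∈block (suc M) {q} {q} {suc r}) refl) })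

      pendants-presentation : Presentation M (windmill ℓ) (attachPendants 2≤m K vs)
      pendants-presentation = record
        { vertices  = ↔-trans (Fin.+↔⊎ ⊎-↔ (Fin.+↔⊎ ×-↔ ↔-refl)) splitVertices
        ; edges     = ↔-refl
        ; incidence = λ
            { (inj₁ x) e → mk⇔
                (λ w∈ → from (windmill-split (inj₁ x) e) (to (splitIncidence (inj₁ (splitAt 7 x)) (splitAt 9 e)) w∈))
                (λ on → from (splitIncidence (inj₁ (splitAt 7 x)) (splitAt 9 e)) (to (windmill-split (inj₁ x) e) on))
            ; (inj₂ (f , r)) e → mk⇔
                (λ w∈ → from (windmill-split (inj₂ (f , r)) e) (to (splitIncidence (inj₂ (splitAt 9 f , r)) (splitAt 9 e)) w∈))
                (λ on → from (splitIncidence (inj₂ (splitAt 9 f , r)) (splitAt 9 e)) (to (windmill-split (inj₂ (f , r)) e) on))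
            }
        }

    T₂C-presentation : ∀ ℓ → Presentation M (windmill ℓ) (T₂C (2 + M) 2≤m (c₁= ℓ))
    T₂C-presentation ℓ = subst (λ ℓ′ → Presentation M (windmill ℓ′) (T₂C (2 + M) 2≤m (c₁= ℓ)))
      (length-vs ℓ) (pendants-presentation _ (lookup-vs ℓ))
      where
      -- The six vertices without pendant edges contribute empty lists, which reduce to the trailing
      -- `[]`.
      length-vs : ∀ ℓ → List.length (List.replicate ℓ (P₀.base zero) List.++ List.[]) ≡ ℓ
      length-vs zero    = refl
      length-vs (suc ℓ) = cong suc (length-vs ℓ)

      lookup-vs : ∀ ℓ q → List.lookup (List.replicate ℓ (P₀.base zero) List.++ List.[]) q ≡ P₀.base zero
      lookup-vs (suc ℓ) zero    = refl
      lookup-vs (suc ℓ) (suc q) = lookup-vs ℓ q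

  -- Unfolding H to a windmill

  ∣S∣≡0⇒∉ : ∀ {n} (S : Subset n) → ∣ S ∣ ≡ 0 → ∀ x → x ∉ S
  ∣S∣≡0⇒∉ (true ∷ S)  ()
  ∣S∣≡0⇒∉ (false ∷ S) eq (suc x) (Vec.there x∈) = ∣S∣≡0⇒∉ S eq x x∈

  ∣S∣≡1⇒singleton : ∀ {n} (S : Subset n) → ∣ S ∣ ≡ 1 → ∃ λ a → ∀ x → x ∈ S ⇔ x ≡ a
  ∣S∣≡1⇒singleton (true ∷ S) eq = zero , λ
    { zero    → mk⇔ (λ _ → refl) (λ _ → Vec.here)
    ; (suc x) → mk⇔ (λ { (Vec.there x∈) → contradiction x∈ (∣S∣≡0⇒∉ S (ℕ.suc-injective eq) x) }) λ () }
  ∣S∣≡1⇒singleton (false ∷ S) eq with ∣S∣≡1⇒singleton S eq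
  ... | a , spec = suc a , λ
    { zero    → mk⇔ (λ ()) λ ()
    ; (suc x) → mk⇔ (λ { (Vec.there x∈) → cong suc (to (spec x) x∈) })
                    (λ { refl → Vec.there (from (spec x) refl) }) }

  ∣S∣≡2⇒pair : ∀ {n} (S : Subset n) → ∣ S ∣ ≡ 2 →
               ∃₂ λ a b → a ≢ b × (∀ x → x ∈ S ⇔ (x ≡ a ⊎ x ≡ b))
  ∣S∣≡2⇒pair (true ∷ S) eq with ∣S∣≡1⇒singleton S (ℕ.suc-injective eq)
  ... | b , spec = zero , suc b , (λ ()) , λ
    { zero    → mk⇔ (λ _ → inj₁ refl) (λ _ → Vec.here)
    ; (suc x) → mk⇔ (λ { (Vec.there x∈) → inj₂ (cong suc (to (spec x) x∈)) })
                    (λ { (inj₂ refl) → Vec.there (from (spec x) refl) }) }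
  ∣S∣≡2⇒pair (false ∷ S) eq with ∣S∣≡2⇒pair S eq
  ... | a , b , a≢b , spec = suc a , suc b , a≢b ∘ Fin.suc-injective , λ
    { zero    → mk⇔ (λ ()) (λ { (inj₁ ()) ; (inj₂ ()) })
    ; (suc x) → mk⇔ (λ { (Vec.there x∈) → Sum.map (cong suc) (cong suc) (to (spec x) x∈) })
                    (λ { (inj₁ refl) → Vec.there (from (spec x) (inj₁ refl))
                       ; (inj₂ refl) → Vec.there (from (spec x) (inj₂ refl)) }) }

  module _ (G : Hypergraph) (2-uniform : Uniform 2 G) where

    private
      pair : ∀ e → ∃₂ λ a b → a ≢ b × (∀ x → x ∈ edge G e ⇔ (x ≡ a ⊎ x ≡ b))
      pair e = ∣S∣≡2⇒pair (edge G e) (2-uniform e)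

      src tgt : Edge G → Vertex G
      src e = proj₁ (pair e)
      tgt e = proj₁ (proj₂ (pair e))

      spec : ∀ x e → x ∈ edge G e ⇔ (x ≡ src e ⊎ x ≡ tgt e)
      spec x e = proj₂ (proj₂ (proj₂ (pair e))) x

      open Ends src tgt

      sub : ∀ {e f x y} → Joins e x y → Joins f x y → ∀ {z} → z ∈ edge G e → z ∈ edge G f
      sub {e} {f} i j {z} z∈ = from (spec z f)
        ([ (λ { refl → Joins⇒Incidentˡ j }) , (λ { refl → Joins⇒Incidentʳ j }) ]′
          (Joins-end i (to (spec z e) z∈)))

      distinct : ∀ e → src e ≢ tgt e
      distinct e = proj₁ (proj₂ (proj₂ (pair e)))

    toGraph : Graph (order G) (size G)
    toGraph = record
      { src      = src
      ; tgt      = tgt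
      ; loopless = λ
          { {e} (inj₁ (p , q)) refl → distinct e (trans (sym p) q)
          ; {e} (inj₂ (p , q)) refl → distinct e (trans (sym q) p) }
      ; simple   = λ i j → edge-injective G (Subset.⊆-antisym (sub i j) (sub j i))
      }

    toGraph-presentation : ∀ M → Presentation M toGraph (power (2 + M) G)
    toGraph-presentation M = power-presentation G toGraph spec

  module _ {n k M} {Γ : Graph n k} {H} (P : Presentation M Γ H) where

    open Graph Γ
    open Presentation P

    nearest : Point n k M → Fin n
    nearest (inj₁ x)       = x
    nearest (inj₂ (e , _)) = src e

    nearest-Incident : ∀ p e → On Γ p e → Incident (nearest p) e
    nearest-Incident (inj₁ x)       e on   = on
    nearest-Incident (inj₂ (f , r)) e refl = inj₁ refl

    -- `nearest` retracts every new vertex to an end of its edge. Two points of one hyperedge then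
    -- go to equal vertices or to the two ends of one graph edge, so a walk in H projects to a walk
    -- in the graph.
    Connected⇒connected : Connected H → ∀ x y → Star Adj x y
    Connected⇒connected conn x y = subst₂ (Star Adj)
      (cong nearest (↔.strictlyInverseʳ vertices (inj₁ x)))
      (cong nearest (↔.strictlyInverseʳ vertices (inj₁ y)))
      (project (conn (base x) (base y)))
      where
      project : ∀ {v w} → Star (Adjacent H) v w → Star Adj (nearest (point v)) (nearest (point w))
      project ε = ε
      project {v} (_◅_ {j = w} (_ , e , v∈ , w∈) s)
        with subst (λ f → v ∈ edge H f) (sym (↔.strictlyInverseˡ edges e)) v∈
           | subst (λ f → w ∈ edge H f) (sym (↔.strictlyInverseˡ edges e)) w∈
           | nearest (point v) ≟ nearest (point w)
      ... | v∈′ | w∈′ | yes eq = subst (λ x → Star Adj x _) (sym eq) (project s)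
      ... | v∈′ | w∈′ | no neq =
        (↔.from edges e , Incident²⇒Joins neq (nearest-Incident _ _ (to (incidence′ v _) v∈′))
                                              (nearest-Incident _ _ (to (incidence′ w _) w∈′)))
        ◅ project s

  -- H is presented over a windmill whose non-blade edges have been moved: the
  -- edge from j + 1 to the hub leads to par j instead.

  record WindmillForm (M : ℕ) (H : Hypergraph) {n} (origin : Fin n → Vertex H) (root : Fin n) : Set where
    field
      ℓ            : ℕ
      par          : Fin (6 + ℓ) → Fin (7 + ℓ)
      graph        : Graph (7 + ℓ) (9 + ℓ)
      src≡         : ∀ e → Graph.src graph e ≡ windmillSrc e
      tgt≡         : ∀ e → Graph.tgt graph e ≡ windmillTgt par e
      presentation : Presentation M graph H
      base-zero    : Presentation.base presentation zero ≡ origin root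
      -- Together with `base-zero` this carries the maximality of the eigenvector at `root` over to
      -- the renumbered vertices.
      base-origin  : ∀ x → ∃ λ y → Presentation.base presentation x ≡ origin y

    size≡ : size H ≡ 9 + ℓ
    size≡ = sym (↔⇒≡ (Presentation.edges presentation))

  -- One tree edge belongs to each of the `n` vertices other than the root, so exactly three of the
  -- n + 3 edges are chords.
  module Unfold {n M} (Γ : Graph (suc n) (n + 3)) {H} (P : Presentation M Γ H)
    (conn : Connected H) (three : ThreeCyclic H) where

    open Graph Γ
    open SearchTree Γ (Connected⇒connected P conn)

    -- Abstract, since conversion checking would unfold it when n is 6 + ℓ.

    abstract
      ε⁺ : Σ[ ε ∈ Permutation′ (n + 3) ] (∀ i → ε ⟨$⟩ʳ (i ↑ˡ 3) ≡ treeEdge i)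
      ε⁺ = extend-injection treeEdge treeEdge-injective

    ε′ = proj₁ ε⁺

    chord : Fin 3 → Fin (n + 3)
    chord i = ε′ ⟨$⟩ʳ (n ↑ʳ i)

    chord-injective : Injective _≡_ _≡_ chord
    chord-injective eq = Fin.↑ʳ-injective n _ _ (↔-injective ε′ eq)

    chord-nontree : ∀ i → ¬ IsTree (chord i)
    chord-nontree i (j , eq) with trans (sym (Fin.splitAt-↑ˡ n j 3)) (trans
      (cong (splitAt n) (↔-injective ε′ (trans (proj₂ ε⁺ j) eq))) (Fin.splitAt-↑ʳ n 3 i))
    ... | ()

    chordEnd : Fin 3 → Fin 2 → Fin (suc n)
    chordEnd i zero    = src (chord i)
    chordEnd i (suc _) = tgt (chord i)

    chordEnd-Incident : ∀ i s → Incident (chordEnd i s) (chord i)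
    chordEnd-Incident i zero    = inj₁ refl
    chordEnd-Incident i (suc _) = inj₂ refl

    chordEnd-injective : ∀ i j s t → chordEnd i s ≡ chordEnd j t → (i , s) ≡ (j , t)
    chordEnd-injective i j s t eq with i ≟ j
    ... | no i≢j = contradiction (subst (λ x → Incident x (chord j)) (sym eq) (chordEnd-Incident j t))
                     (nontree-disjoint P three chord chord-injective chord-nontree i≢j (chordEnd-Incident i s))
    chordEnd-injective i .i 0F 0F eq | yes refl = refl
    chordEnd-injective i .i 0F 1F eq | yes refl = contradiction eq (loopless (inj₁ (refl , refl)))
    chordEnd-injective i .i 1F 0F eq | yes refl = contradiction eq (loopless (inj₂ (refl , refl)))
    chordEnd-injective i .i 1F 1F eq | yes refl = refl

    -- The root followed by the ends of the chords. The division by 2 in `remQuot` pairs the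
    -- vertices as `left` and `right` do. Injectivity says that the chords are pairwise disjoint and
    -- miss the root.
    core : Fin 7 → Fin (suc n)
    core zero    = zero
    core (suc z) = chordEnd (proj₁ (remQuot {3} 2 z)) (proj₂ (remQuot {3} 2 z))

    core-suc≢0 : ∀ z → core (suc z) ≢ zero
    core-suc≢0 z eq = nontree-misses-root (chord-nontree _)
      (subst (λ x → Incident x (chord (proj₁ (remQuot {3} 2 z)))) eq
        (chordEnd-Incident (proj₁ (remQuot {3} 2 z)) (proj₂ (remQuot {3} 2 z))))

    core-injective : Injective _≡_ _≡_ core
    core-injective {zero}  {zero}  eq = refl
    core-injective {zero}  {suc z} eq = contradiction (sym eq) (core-suc≢0 z)
    core-injective {suc z} {zero}  eq = contradiction eq (core-suc≢0 z)
    core-injective {suc z} {suc w} eq = cong suc (↔-injective (Fin.*↔× {3} {2})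
      (chordEnd-injective (proj₁ (remQuot {3} 2 z)) (proj₁ (remQuot {3} 2 w)) _ _ eq))

    7≤ : 7 ≤ suc n
    7≤ = injective⇒≤ core-injective

  module Assemble {ℓ M} (Γ : Graph (7 + ℓ) (6 + ℓ + 3)) {H} (P : Presentation M Γ H)
    (conn : Connected H) (three : ThreeCyclic H) where

    open Graph Γ
    open SearchTree Γ (Connected⇒connected P conn)
    open Unfold Γ P conn three

    abstract
      φ⁺ : Σ[ φ ∈ Permutation′ (7 + ℓ) ] (∀ i → φ ⟨$⟩ʳ (i ↑ˡ ℓ) ≡ core i)
      φ⁺ = extend-injection core core-injective

    φ : Permutation′ (7 + ℓ)
    φ = proj₁ φ⁺

    φ-core : ∀ i → φ ⟨$⟩ʳ (i ↑ˡ ℓ) ≡ core i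
    φ-core = proj₂ φ⁺

    -- `φ` extends `core` and therefore fixes the root; `σ` is what it does to the other vertices.
    σ : Permutation′ (6 + ℓ)
    σ = Perm.remove zero φ

    φ-suc : ∀ j → φ ⟨$⟩ʳ suc j ≡ suc (σ ⟨$⟩ʳ j)
    φ-suc j = sym (Perm.lift₀-remove φ (φ-core zero) (suc j))

    -- The j-th spoke goes to the tree edge of vertex `suc (σ j)`, and the blades go to the three
    -- chords, which `ε′` numbers last.
    ψ : Fin (9 + ℓ) ↔ Fin (6 + ℓ + 3)
    ψ = ↔-trans kinds (↔-trans (σ ⊎-↔ ↔-refl) (↔-trans (↔-sym Fin.+↔⊎) ε′))

    par : Fin (6 + ℓ) → Fin (7 + ℓ)
    par j = φ ⟨$⟩ˡ parent (σ ⟨$⟩ʳ j)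

    φ-left : ∀ i → φ ⟨$⟩ʳ left i ≡ src (chord i)
    φ-left 0F = φ-core 1F
    φ-left 1F = φ-core 3F
    φ-left 2F = φ-core 5F

    φ-right : ∀ i → φ ⟨$⟩ʳ right i ≡ tgt (chord i)
    φ-right 0F = φ-core 2F
    φ-right 1F = φ-core 4F
    φ-right 2F = φ-core 6F

    ends : ∀ e → Joins (↔.to ψ e) (φ ⟨$⟩ʳ windmillSrc e) (φ ⟨$⟩ʳ windmillTgt par e)
    ends e = ends′ (kind e)
      where
      ends′ : ∀ κ → Joins (ε′ ⟨$⟩ʳ join (6 + ℓ) 3 (Sum.map (σ ⟨$⟩ʳ_) id κ))
                          (φ ⟨$⟩ʳ [ suc , left ]′ κ) (φ ⟨$⟩ʳ [ par , right ]′ κ)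
      ends′ (inj₁ j) = subst₂ (Joins _) (sym (φ-suc j)) (sym (↔.strictlyInverseˡ φ (parent (σ ⟨$⟩ʳ j))))
        (subst (λ e → Joins e (suc (σ ⟨$⟩ʳ j)) (parent (σ ⟨$⟩ʳ j)))
          (sym (proj₂ ε⁺ (σ ⟨$⟩ʳ j))) (treeEdge-Joins (σ ⟨$⟩ʳ j)))
      ends′ (inj₂ i) = inj₁ (φ-left i , φ-right i)

    module Pulled = Pullback Γ φ ψ windmillSrc (windmillTgt par) ends

    windmillForm : WindmillForm M H (Presentation.base P) zero
    windmillForm = record
      { ℓ            = ℓ
      ; par          = par
      ; graph        = Pulled.graph
      ; src≡         = λ _ → refl
      ; tgt≡         = λ _ → refl
      ; presentation = Pulled.presentation P
      ; base-zero    = cong (Presentation.base P) (φ-core zero)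
      ; base-origin  = λ x → φ ⟨$⟩ʳ x , refl
      }

  rootedForm : ∀ {n M} (Γ : Graph (suc n) (n + 3)) {H} (P : Presentation M Γ H) →
               Connected H → ThreeCyclic H → WindmillForm M H (Presentation.base P) zero
  rootedForm {n} {M} Γ {H} P conn three =
    assemble Γ P (sym (ℕ.m+[n∸m]≡n (ℕ.s≤s⁻¹ (Unfold.7≤ Γ P conn three))))
    where
    -- Generalising over `n` and the graph lets the equation be matched with `refl`.
    assemble : ∀ {n ℓ} (Γ : Graph (suc n) (n + 3)) (P : Presentation M Γ H) →
               n ≡ 6 + ℓ → WindmillForm M H (Presentation.base P) zero
    assemble Γ P refl = Assemble.windmillForm Γ P conn three

  module _ {M H} (power : IsPower (2 + M) H) (conn : Connected H) (three : ThreeCyclic H)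
    (type-II : TypeII (2 + M) H) where

    private
      G : Hypergraph
      G = proj₁ power

      H≅ = proj₂ (proj₂ power)

      Γ : Graph (order G) (size G)
      Γ = toGraph G (proj₁ (proj₂ power))

      P : Presentation M Γ H
      P = ≅-presentation H≅ (toGraph-presentation G (proj₁ (proj₂ power)) M)

    -- The |E| M new vertices occur on both sides of the Type II equation and cancel.
    order+2≡size : order G + 2 ≡ size G
    order+2≡size = ℕ.+-cancelʳ-≡ (size G * M) _ _ (begin
      order G + 2 + size G * M     ≡⟨ ℕ.+-assoc (order G) 2 _ ⟩
      order G + (2 + size G * M)   ≡⟨ cong (order G ℕ.+_) (ℕ.+-comm 2 _) ⟩
      order G + (size G * M + 2)   ≡⟨ ℕ.+-assoc (order G) _ 2 ⟨
      order G + size G * M + 2     ≡⟨ cong (ℕ._+ 2) (↔⇒≡ (_≅_.vertices H≅)) ⟨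
      order H + 2                      ≡⟨ type-II ⟩
      size H * suc M                   ≡⟨ cong (ℕ._* suc M) (↔⇒≡ (_≅_.edges H≅)) ⟩
      size G * suc M                   ≡⟨ ℕ.*-suc (size G) M ⟩
      size G + size G * M            ∎)
      where open ≡-Reasoning

    private
      rooted : ∀ {n k} (Γ : Graph n k) (P : Presentation M Γ H) → n + 2 ≡ k → (u : Fin n) →
               WindmillForm M H (Presentation.base P) u
      -- The search tree is always rooted at `zero`, so the chosen vertex `u` is first transposed
      -- there.
      rooted {suc n} Γ P eq u rewrite trans (sym eq) (sym (ℕ.+-suc n 2)) = record
        { WindmillForm form
        ; base-zero   = trans form.base-zero (cong (Presentation.base P) (transpose-fst zero u))
        ; base-origin = λ x → let (y , eq) = form.base-origin x in π ⟨$⟩ʳ y , eq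
        }
        where
        open Graph Γ
        π = transpose zero u
        module Δ = Pullback Γ π ↔-refl ((π ⟨$⟩ˡ_) ∘ src) ((π ⟨$⟩ˡ_) ∘ tgt)
          (λ e → inj₁ (↔.strictlyInverseˡ π _ , ↔.strictlyInverseˡ π _))
        form = rootedForm Δ.graph (Δ.presentation P) conn three
        module form = WindmillForm form

    baseCount : ℕ
    baseCount = order G

    baseVertex : Fin baseCount → Vertex H
    baseVertex = Presentation.base P

    baseVertex-exists : Fin baseCount
    baseVertex-exists = exists Γ order+2≡size
      where
      exists : ∀ {n k} (Γ : Graph n k) → n + 2 ≡ k → Fin n
      -- A graph without vertices would still have two edges, and the source of an edge is a vertex.
      exists {zero}  Γ refl = Graph.src Γ zero
      exists {suc n} Γ eq   = zero

    windmillForm : (u : Fin baseCount) → WindmillForm M H baseVertex u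
    windmillForm = rooted Γ P order+2≡size

open Combinatorics

-- Polynomial identities with integer coefficients in any commutative ring

module IntegerRingSolver (R : CommutativeRing 0ℓ 0ℓ) where

  open import Algebra.Solver.Ring.AlmostCommutativeRing
    using (AlmostCommutativeRing; fromCommutativeRing; _-Raw-AlmostCommutative⟶_)
  open import Data.Integer.Base as ℤ using (ℤ; +_; -[1+_]; _⊖_)
  import Data.Integer.Properties as ℤ
  open import Data.Maybe.Base using (Maybe; just; nothing)
  open import Data.Nat.Base as ℕ using (ℕ; zero; suc)
  import Data.Nat.Properties as ℕ
  open import Relation.Binary.PropositionalEquality as ≡ using (_≡_)
  open import Relation.Nullary using (yes; no)

  open CommutativeRing R
  open import Algebra.Properties.Ring ring
    using (-0#≈0#; -‿distribˡ-*; -‿distribʳ-*; -‿involutive)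
  open import Algebra.Properties.AbelianGroup +-abelianGroup using (⁻¹-∙-comm)
  open import Algebra.Properties.Semiring.Mult semiring using (×-homo-+; ×1-homo-*) renaming (_×_ to _·_)
  open import Relation.Binary.Reasoning.Setoid setoid

  fromℤ : ℤ → Carrier
  fromℤ (+ n)    = n · 1#
  fromℤ -[1+ n ] = - (suc n · 1#)

  fromℤ-⊖ : ∀ m n → fromℤ (m ⊖ n) ≈ m · 1# - n · 1#
  fromℤ-⊖ m zero = begin
    fromℤ (m ⊖ 0)     ≡⟨ ≡.cong fromℤ (ℤ.⊖-≥ {m} ℕ.z≤n) ⟩
    m · 1#            ≈⟨ +-identityʳ _ ⟨
    m · 1# + 0#       ≈⟨ +-congˡ -0#≈0# ⟨
    m · 1# - 0#       ∎
  fromℤ-⊖ zero    (suc n) = sym (+-identityˡ _)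
  fromℤ-⊖ (suc m) (suc n) = begin
    fromℤ (suc m ⊖ suc n)                   ≡⟨ ≡.cong fromℤ (ℤ.[1+m]⊖[1+n]≡m⊖n m n) ⟩
    fromℤ (m ⊖ n)                           ≈⟨ fromℤ-⊖ m n ⟩
    m · 1# - n · 1#                         ≈⟨ +-congˡ (+-identityˡ _) ⟨
    m · 1# + (0# - n · 1#)                  ≈⟨ +-congˡ (+-congʳ (-‿inverseʳ 1#)) ⟨
    m · 1# + ((1# - 1#) - n · 1#)           ≈⟨ +-congˡ (+-assoc _ _ _) ⟩
    m · 1# + (1# + (- 1# - n · 1#))         ≈⟨ +-assoc _ _ _ ⟨
    (m · 1# + 1#) + (- 1# - n · 1#)         ≈⟨ +-cong (+-comm _ _) (⁻¹-∙-comm _ _) ⟩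
    (1# + m · 1#) - (1# + n · 1#)           ∎

  fromℤ-+ : ∀ i j → fromℤ (i ℤ.+ j) ≈ fromℤ i + fromℤ j
  fromℤ-+ (+ m)    (+ n)    = ×-homo-+ 1# m n
  fromℤ-+ (+ m)    -[1+ n ] = fromℤ-⊖ m (suc n)
  fromℤ-+ -[1+ m ] (+ n)    = trans (fromℤ-⊖ n (suc m)) (+-comm _ _)
  fromℤ-+ -[1+ m ] -[1+ n ] = begin
    - (suc (suc (m ℕ.+ n)) · 1#)            ≡⟨ ≡.cong (λ l → - (suc l · 1#)) (ℕ.+-suc m n) ⟨
    - ((suc m ℕ.+ suc n) · 1#)              ≈⟨ -‿cong (×-homo-+ 1# (suc m) (suc n)) ⟩
    - (suc m · 1# + suc n · 1#)             ≈⟨ ⁻¹-∙-comm _ _ ⟨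
    - (suc m · 1#) - suc n · 1#             ∎

  fromℤ-neg : ∀ i → fromℤ (ℤ.- i) ≈ - fromℤ i
  fromℤ-neg (+ zero)  = sym -0#≈0#
  fromℤ-neg (+ suc n) = refl
  fromℤ-neg -[1+ n ]  = sym (-‿involutive _)

  fromℤ-* : ∀ i j → fromℤ (i ℤ.* j) ≈ fromℤ i * fromℤ j
  fromℤ-* (+ m) (+ n) = begin
    fromℤ (+ m ℤ.* + n)     ≡⟨ ≡.cong fromℤ (ℤ.pos-* m n) ⟨
    (m ℕ.* n) · 1#          ≈⟨ ×1-homo-* m n ⟩
    m · 1# * n · 1#         ∎
  fromℤ-* (+ m) -[1+ n ] = begin
    fromℤ (+ m ℤ.* ℤ.- (+ suc n))   ≡⟨ ≡.cong fromℤ (ℤ.neg-distribʳ-* (+ m) (+ suc n)) ⟨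
    fromℤ (ℤ.- (+ m ℤ.* + suc n))   ≈⟨ fromℤ-neg (+ m ℤ.* + suc n) ⟩
    - fromℤ (+ m ℤ.* + suc n)       ≈⟨ -‿cong (fromℤ-* (+ m) (+ suc n)) ⟩
    - (m · 1# * suc n · 1#)         ≈⟨ -‿distribʳ-* _ _ ⟩
    m · 1# * - (suc n · 1#)         ∎
  fromℤ-* -[1+ m ] (+ n) = begin
    fromℤ (ℤ.- (+ suc m) ℤ.* + n)   ≡⟨ ≡.cong fromℤ (ℤ.neg-distribˡ-* (+ suc m) (+ n)) ⟨
    fromℤ (ℤ.- (+ suc m ℤ.* + n))   ≈⟨ fromℤ-neg (+ suc m ℤ.* + n) ⟩
    - fromℤ (+ suc m ℤ.* + n)       ≈⟨ -‿cong (fromℤ-* (+ suc m) (+ n)) ⟩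
    - (suc m · 1# * n · 1#)         ≈⟨ -‿distribˡ-* _ _ ⟩
    - (suc m · 1#) * n · 1#         ∎
  fromℤ-* -[1+ m ] -[1+ n ] = begin
    (suc m ℕ.* suc n) · 1#                ≈⟨ ×1-homo-* (suc m) (suc n) ⟩
    suc m · 1# * suc n · 1#               ≈⟨ -‿involutive _ ⟨
    - - (suc m · 1# * suc n · 1#)         ≈⟨ -‿cong (-‿distribˡ-* _ _) ⟩
    - (- (suc m · 1#) * suc n · 1#)       ≈⟨ -‿distribʳ-* _ _ ⟩
    - (suc m · 1#) * - (suc n · 1#)       ∎

  -- Agrees with fromℤ, but sends + 1 to 1# itself rather than to 1# + 0#.

  coefficient : ℤ → Carrier
  coefficient (+ 1) = 1#
  coefficient i     = fromℤ i

  coefficient≈fromℤ : ∀ i → coefficient i ≈ fromℤ i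
  coefficient≈fromℤ (+ 0)           = refl
  coefficient≈fromℤ (+ 1)           = sym (+-identityʳ 1#)
  coefficient≈fromℤ (+ suc (suc n)) = refl
  coefficient≈fromℤ -[1+ n ]        = refl

  almostCommutativeRing : AlmostCommutativeRing 0ℓ 0ℓ
  almostCommutativeRing = fromCommutativeRing R

  coefficient-morphism : ℤ.+-*-rawRing -Raw-AlmostCommutative⟶ almostCommutativeRing
  coefficient-morphism = record
    { ⟦_⟧    = coefficient
    ; +-homo = λ i j → trans (coefficient≈fromℤ (i ℤ.+ j)) (trans (fromℤ-+ i j)
                 (sym (+-cong (coefficient≈fromℤ i) (coefficient≈fromℤ j))))
    ; *-homo = λ i j → trans (coefficient≈fromℤ (i ℤ.* j)) (trans (fromℤ-* i j)
                 (sym (*-cong (coefficient≈fromℤ i) (coefficient≈fromℤ j))))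
    ; -‿homo = λ i → trans (coefficient≈fromℤ (ℤ.- i)) (trans (fromℤ-neg i)
                 (sym (-‿cong (coefficient≈fromℤ i))))
    ; 0-homo = refl
    ; 1-homo = refl
    }

  coefficient-≟ : ∀ i j → Maybe (coefficient i ≈ coefficient j)
  coefficient-≟ i j with i ℤ.≟ j
  ... | yes ≡.refl = just refl
  ... | no  _      = nothing

  open import Algebra.Solver.Ring ℤ.+-*-rawRing almostCommutativeRing
    coefficient-morphism coefficient-≟
    public using (Polynomial; solve; _:=_; con; _:+_; _:*_; _:-_; :-_; _:^_)

  # : ∀ {n} → ℕ → Polynomial n
  # k = con (+ k)

-- Adjacency and incidence

Incident? : ∀ {n k} (Γ : Graph n k) x e → Dec (Graph.Incident Γ x e)
Incident? Γ x e = (x ≟ Graph.src Γ e) ⊎-dec (x ≟ Graph.tgt Γ e)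

On? : ∀ {n k} (Γ : Graph n k) {M} (p : Point n k M) e → Dec (On Γ p e)
On? Γ (inj₁ x)       e = Incident? Γ x e
On? Γ (inj₂ (f , r)) e = f ≟ e

module Sums (R : CommutativeRing 0ℓ 0ℓ) where

  open CommutativeRing R hiding (zero)
  open import Algebra.Properties.Semiring.Sum semiring public
    using (sum; ∑-distrib-+; ∑-comm; sum-permute; sum-replicate; sum-replicate-zero;
           *-distribˡ-sum; *-distribʳ-sum)
  open import Algebra.Properties.Monoid.Sum +-monoid public using (sum-cong-≋)
  open import Algebra.Properties.Semiring.Mult semiring using (×-assoc-*) renaming (_×_ to _·_)
  open IntegerRingSolver R
  open import Relation.Binary.Reasoning.Setoid setoid

  sum-cong : ∀ {n} {f g : Fin n → Carrier} → (∀ i → f i ≈ g i) → sum f ≈ sum g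
  sum-cong = sum-cong-≋

  sum-0 : ∀ {n} {f : Fin n → Carrier} → (∀ i → f i ≈ 0#) → sum f ≈ 0#
  sum-0 {n} f≈0 = trans (sum-cong f≈0) (sum-replicate-zero n)

  sum-const : ∀ n x → sum {n} (λ _ → x) ≈ (n · 1#) * x
  sum-const n x = trans (sum-replicate n) (sym (trans (×-assoc-* n 1# x) (·-congʳ n)))
    where
    ·-congʳ : ∀ n → n · (1# * x) ≈ n · x
    ·-congʳ zero    = refl
    ·-congʳ (suc n) = +-cong (*-identityˡ x) (·-congʳ n)

  sum-neg : ∀ {n} (f : Fin n → Carrier) → sum (λ i → - f i) ≈ - sum f
  sum-neg {zero}  f = solve 0 (# 0 := :- # 0) refl
  sum-neg {suc n} f = trans (+-congˡ (sum-neg (f ∘ suc)))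
    (solve 2 (λ a b → :- a :+ :- b := :- (a :+ b)) refl (f zero) (sum (f ∘ suc)))

  sum-+ : ∀ p {q} (f : Fin (p ℕ.+ q) → Carrier) →
          sum f ≈ sum (λ i → f (i ↑ˡ q)) + sum (λ j → f (p ↑ʳ j))
  sum-+ zero    f = sym (+-identityˡ _)
  sum-+ (suc p) f = trans (+-congˡ (sum-+ p (f ∘ suc))) (sym (+-assoc _ _ _))

  sum-* : ∀ p {q} (f : Fin (p ℕ.* q) → Carrier) →
          sum f ≈ sum (λ i → sum λ j → f (combine {p} i j))
  sum-* zero    f = refl
  sum-* (suc p) {q} f = trans (sum-+ q f) (+-congˡ (sum-* p (f ∘ (q ↑ʳ_))))

  -- An Iverson bracket used as a factor. It takes a Boolean and expands to `if_then_else_`, so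
  -- entries of the adjacency matrices are brackets by definition.
  [_]_ : Bool → Carrier → Carrier
  [ b ] x = if b then x else 0#

  []-cong : ∀ b {x y} → x ≈ y → [ b ] x ≈ [ b ] y
  []-cong true  x≈y = x≈y
  []-cong false x≈y = refl

  []-* : ∀ b x y → ([ b ] x) * y ≈ [ b ] (x * y)
  []-* true  x y = refl
  []-* false x y = zeroˡ y

  sum-[] : ∀ {n} b (f : Fin n → Carrier) → sum (λ i → [ b ] f i) ≈ [ b ] sum f
  sum-[] true  f = refl
  sum-[] {n} false f = sum-replicate-zero n

  sum-δ : ∀ {n} (a : Fin n) (f : Fin n → Carrier) → sum (λ i → [ does (a ≟ i) ] f i) ≈ f a
  sum-δ {suc n} zero    f = trans (+-congˡ (sum-replicate-zero n)) (+-identityʳ _)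
  sum-δ {suc n} (suc a) f = trans (+-identityˡ _) (sum-δ a (f ∘ suc))

  sum-δ′ : ∀ {n} (a : Fin n) (f : Fin n → Carrier) → sum (λ i → [ does (i ≟ a) ] f i) ≈ f a
  sum-δ′ a f = trans (sum-cong λ i → reflexive (≡.cong (λ b → [ b ] f i)
    (does-⇔ (mk⇔ ≡.sym ≡.sym) (i ≟ a) (a ≟ i)))) (sum-δ a f)

  sum-↔ : ∀ {m n} (f : Fin n → Carrier) (π : Fin m ↔ Fin n) → sum f ≈ sum (f ∘ ↔.to π)
  sum-↔ = sum-permute

  sumPoints : ∀ {n k M} → (Point n k M → Carrier) → Carrier
  sumPoints f = sum (λ x → f (inj₁ x)) + sum λ e → sum λ r → f (inj₂ (e , r))

  sum-vertices : ∀ {n k M N} (π : Point n k M ↔ Fin N) (f : Fin N → Carrier) →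
                 sum f ≈ sumPoints (f ∘ ↔.to π)
  sum-vertices {n} {k} {M} π f = begin
    sum f
      ≈⟨ sum-↔ f π′ ⟩
    sum (f ∘ ↔.to π′)
      ≈⟨ sum-+ n (f ∘ ↔.to π′) ⟩
    sum (λ x → f (↔.to π′ (x ↑ˡ k ℕ.* M))) + sum (λ j → f (↔.to π′ (n ↑ʳ j)))
      ≈⟨ +-cong (sum-cong λ x → reflexive (≡.cong (f ∘ ↔.to (↔-trans (↔-refl ⊎-↔ Fin.*↔×) π))
                                  (Fin.splitAt-↑ˡ n x (k ℕ.* M))))
                (trans (sum-* k (λ j → f (↔.to π′ (n ↑ʳ j)))) (sum-cong λ e → sum-cong λ r → reflexive (≡.trans
                  (≡.cong (f ∘ ↔.to (↔-trans (↔-refl ⊎-↔ Fin.*↔×) π))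
                    (Fin.splitAt-↑ʳ n (k ℕ.* M) (combine e r)))
                  (≡.cong (λ er → f (↔.to π (inj₂ er))) (Fin.remQuot-combine e r))))) ⟩
    sumPoints (f ∘ ↔.to π) ∎
    where
    π′ : Fin (n ℕ.+ k ℕ.* M) ↔ Fin _
    π′ = ↔-trans Fin.+↔⊎ (↔-trans (↔-refl ⊎-↔ Fin.*↔×) π)

  edgeSum : ∀ {n k M} → Graph n k → (Point n k M → Carrier) → Fin k → Carrier
  edgeSum Γ f e = f (inj₁ (src e)) + f (inj₁ (tgt e)) + sum λ r → f (inj₂ (e , r))
    where open Graph Γ

  edgeSum-cong : ∀ {n k M} (Γ : Graph n k) {f g : Point n k M → Carrier} → (∀ p → f p ≈ g p) →
                 ∀ e → edgeSum Γ f e ≈ edgeSum Γ g e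
  edgeSum-cong Γ f≈g e = +-cong (+-cong (f≈g _) (f≈g _)) (sum-cong λ r → f≈g (inj₂ (e , r)))

  -- The sum of f p f q over ordered pairs of distinct points p, q of the edge, written as the
  -- square of the edge sum minus the diagonal.
  pairSum : ∀ {n k M} → Graph n k → (Point n k M → Carrier) → Fin k → Carrier
  pairSum Γ f e = edgeSum Γ f e * edgeSum Γ f e - edgeSum Γ (λ p → f p * f p) e

  module _ {n k M} {Γ : Graph n k} {H} (P : Presentation M Γ H) where

    open Graph Γ
    open Presentation P

    -- A new point determines its edge, and two old points determine theirs because the graph is
    -- simple.
    at-most-one-edge : ∀ {i j e f} → i ≢ j →
      i ∈ edge H e → j ∈ edge H e → i ∈ edge H f → j ∈ edge H f → e ≡ f
    at-most-one-edge {i} {j} {e} {f} i≢j i∈e j∈e i∈f j∈f = ↔-from-injective edges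
      (unique (point i) (point j) (i≢j ∘ ↔-from-injective vertices)
        (on i∈e) (on j∈e) (on i∈f) (on j∈f))
      where
      on : ∀ {v e} → v ∈ edge H e → On Γ (point v) (↔.from edges e)
      on {v} {e} v∈e = to (incidence′ v _)
        (≡.subst (λ f → v ∈ edge H f) (≡.sym (↔.strictlyInverseˡ edges e)) v∈e)
      unique : ∀ p q {e f} → p ≢ q → On Γ p e → On Γ q e → On Γ p f → On Γ q f → e ≡ f
      unique (inj₁ x) (inj₁ y) p≢q xe ye xf yf = simple
        (Incident²⇒Joins (p≢q ∘ ≡.cong inj₁) xe ye) (Incident²⇒Joins (p≢q ∘ ≡.cong inj₁) xf yf)
      unique (inj₂ _) q        p≢q pe qe pf qf = ≡.trans (≡.sym pe) pf
      unique (inj₁ _) (inj₂ _) p≢q pe qe pf qf = ≡.trans (≡.sym qe) qf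

    sum-edge : ∀ (f : Vertex H → Carrier) e →
      sum (λ v → [ does (v ∈? edge H (↔.to edges e)) ] f v) ≈ edgeSum Γ (f ∘ ↔.to vertices) e
    sum-edge f e = begin
      sum (λ v → [ does (v ∈? edge H (↔.to edges e)) ] f v)
        ≈⟨ sum-vertices vertices (λ v → [ does (v ∈? edge H (↔.to edges e)) ] f v) ⟩
      sumPoints (λ p → [ does (↔.to vertices p ∈? edge H (↔.to edges e)) ] f (↔.to vertices p))
        ≈⟨ +-cong (sum-cong λ x → on (inj₁ x)) (sum-cong λ e → sum-cong λ r → on (inj₂ (e , r))) ⟩
      sum (λ x → [ does (x ≟ src e) ∨ does (x ≟ tgt e) ] g (inj₁ x)) +
      sum (λ f → sum λ r → [ does (f ≟ e) ] g (inj₂ (f , r)))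
        ≈⟨ +-cong (trans (sum-cong ends) (trans (∑-distrib-+ (λ x → [ does (x ≟ src e) ] g (inj₁ x)) (λ x → [ does (x ≟ tgt e) ] g (inj₁ x)))
                    (+-cong (sum-δ′ (src e) (g ∘ inj₁)) (sum-δ′ (tgt e) (g ∘ inj₁)))))
                  (trans (sum-cong λ f → sum-[] (does (f ≟ e)) (λ r → g (inj₂ (f , r))))
                    (sum-δ′ e (λ f → sum λ r → g (inj₂ (f , r))))) ⟩
      edgeSum Γ g e ∎
      where
      g = f ∘ ↔.to vertices
      on : ∀ p → [ does (↔.to vertices p ∈? edge H (↔.to edges e)) ] g p ≈ [ does (On? Γ p e) ] g p
      on p = reflexive (≡.cong (λ b → [ b ] g p)
        (does-⇔ (incidence p e) (↔.to vertices p ∈? edge H (↔.to edges e)) (On? Γ p e)))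
      ends : ∀ x → [ does (x ≟ src e) ∨ does (x ≟ tgt e) ] g (inj₁ x) ≈
                   [ does (x ≟ src e) ] g (inj₁ x) + [ does (x ≟ tgt e) ] g (inj₁ x)
      ends x with x ≟ src e | x ≟ tgt e
      ... | yes p | yes q = contradiction (≡.trans (≡.sym p) q) (loopless (inj₁ (≡.refl , ≡.refl)))
      ... | yes p | no  q = sym (+-identityʳ _)
      ... | no  p | yes q = sym (+-identityˡ _)
      ... | no  p | no  q = sym (+-identityˡ _)

    -- Entrywise form of A + D = B Bᵀ: on the diagonal the right side counts the edges at `i`; off
    -- it, at most one edge contains both vertices, so the right side is `x` or 0.
    adjacency-incidence : ∀ i j x →
      [ does (adjacent? H i j) ] x + [ does (i ≟ j) ] sum (λ e → [ does (i ∈? edge H e) ] x) ≈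
      sum λ e → [ does (i ∈? edge H e) ] [ does (j ∈? edge H e) ] x
    adjacency-incidence i j x with i ≟ j
    ... | yes ≡.refl = begin
      0# + sum (λ e → [ does (i ∈? edge H e) ] x)
        ≈⟨ +-identityˡ _ ⟩
      sum (λ e → [ does (i ∈? edge H e) ] x)
        ≈⟨ sum-cong (λ e → idem (does (i ∈? edge H e))) ⟩
      sum (λ e → [ does (i ∈? edge H e) ] [ does (i ∈? edge H e) ] x) ∎
      where
      idem : ∀ b → [ b ] x ≈ [ b ] [ b ] x
      idem true  = refl
      idem false = refl
    ... | no i≢j = trans (+-identityʳ _) (common (Fin.any? λ e → (i ∈? edge H e) ×-dec (j ∈? edge H e)))
      where
      common : (edge? : Dec (∃ λ e → i ∈ edge H e × j ∈ edge H e)) →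
               [ does edge? ] x ≈ sum λ e → [ does (i ∈? edge H e) ] [ does (j ∈? edge H e) ] x
      common (yes (e , i∈e , j∈e)) = sym (trans (sum-cong only) (sum-δ e (λ _ → x)))
        where
        only : ∀ f → [ does (i ∈? edge H f) ] [ does (j ∈? edge H f) ] x ≈ [ does (e ≟ f) ] x
        only f with e ≟ f
        ... | yes ≡.refl rewrite dec-true (i ∈? edge H e) i∈e | dec-true (j ∈? edge H e) j∈e = refl
        ... | no  e≢f with i ∈? edge H f | j ∈? edge H f
        ...   | yes i∈f | yes j∈f = contradiction (at-most-one-edge i≢j i∈e j∈e i∈f j∈f) e≢f
        ...   | yes i∈f | no  j∉f = refl
        ...   | no  i∉f | _       = refl
      common (no ¬edge) = sym (sum-0 none)
        where
        none : ∀ f → [ does (i ∈? edge H f) ] [ does (j ∈? edge H f) ] x ≈ 0#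
        none f with i ∈? edge H f | j ∈? edge H f
        ... | yes i∈f | yes j∈f = contradiction (f , i∈f , j∈f) ¬edge
        ... | yes i∈f | no  j∉f = refl
        ... | no  i∉f | _       = refl

    -- The adjacency matrix is the incidence matrix times its transpose, less
    -- the diagonal of degrees.

    row : ∀ (f : Vertex H → Carrier) i →
      sum (λ j → [ does (adjacent? H i j) ] f j) ≈
      sum λ e → [ does (i ∈? edge H (↔.to edges e)) ] (edgeSum Γ (f ∘ ↔.to vertices) e - f i)
    row f i = begin
      A                                       ≈⟨ solve 2 (λ a d → a := (a :+ d) :- d) refl A D ⟩
      (A + D) - D                             ≈⟨ +-congʳ A+D ⟩
      B - D                                   ≈⟨ +-congˡ (sum-neg (λ e → [ ∈E e ] f i)) ⟨
      B + sum (λ e → - ([ ∈E e ] f i))        ≈⟨ ∑-distrib-+ (λ e → [ ∈E e ] S e) (λ e → - ([ ∈E e ] f i)) ⟨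
      sum (λ e → [ ∈E e ] sum (λ j → [ does (j ∈? edge H e) ] f j) - [ ∈E e ] f i)
                                              ≈⟨ sum-cong (λ e → factor (∈E e)) ⟩
      sum (λ e → [ ∈E e ] (sum (λ j → [ does (j ∈? edge H e) ] f j) - f i))
                                              ≈⟨ sum-↔ (λ e → [ ∈E e ] (S e - f i)) edges ⟩
      sum (λ e → [ ∈E (↔.to edges e) ]
                 (sum (λ j → [ does (j ∈? edge H (↔.to edges e)) ] f j) - f i))
                                              ≈⟨ sum-cong (λ e → []-cong (∈E (↔.to edges e)) (+-congʳ (sum-edge f e))) ⟩
      sum (λ e → [ ∈E (↔.to edges e) ] (edgeSum Γ (f ∘ ↔.to vertices) e - f i)) ∎
      where
      ∈E : Edge H → Bool
      ∈E e = does (i ∈? edge H e)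

      S : Edge H → Carrier
      S e = sum λ j → [ does (j ∈? edge H e) ] f j

      A D B : Carrier
      A = sum λ j → [ does (adjacent? H i j) ] f j
      D = sum λ e → [ ∈E e ] f i
      B = sum λ e → [ ∈E e ] sum (λ j → [ does (j ∈? edge H e) ] f j)

      factor : ∀ b {x y} → [ b ] x - [ b ] y ≈ [ b ] (x - y)
      factor true  = refl
      factor false = solve 0 (# 0 :- # 0 := # 0) refl

      A+D : A + D ≈ B
      A+D = begin
        A + D
          ≈⟨ +-congˡ (sum-δ i (λ j → sum λ e → [ ∈E e ] f j)) ⟨
        A + sum (λ j → [ does (i ≟ j) ] sum (λ e → [ ∈E e ] f j))
          ≈⟨ ∑-distrib-+ (λ j → [ does (adjacent? H i j) ] f j)
                         (λ j → [ does (i ≟ j) ] sum (λ e → [ ∈E e ] f j)) ⟨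
        sum (λ j → [ does (adjacent? H i j) ] f j + [ does (i ≟ j) ] sum (λ e → [ ∈E e ] f j))
          ≈⟨ sum-cong (λ j → adjacency-incidence i j (f j)) ⟩
        sum (λ j → sum λ e → [ ∈E e ] [ does (j ∈? edge H e) ] f j)
          ≈⟨ ∑-comm (λ j e → [ ∈E e ] [ does (j ∈? edge H e) ] f j) ⟩
        sum (λ e → sum λ j → [ ∈E e ] [ does (j ∈? edge H e) ] f j)
          ≈⟨ sum-cong (λ e → sum-[] (∈E e) (λ j → [ does (j ∈? edge H e) ] f j)) ⟩
        B ∎

    row-point : ∀ (f : Vertex H → Carrier) p →
      sum (λ j → [ does (adjacent? H (↔.to vertices p) j) ] f j) ≈
      sum λ e → [ does (On? Γ p e) ] (edgeSum Γ (f ∘ ↔.to vertices) e - f (↔.to vertices p))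
    row-point f p = trans (row f (↔.to vertices p)) (sum-cong λ e → reflexive
      (≡.cong (λ b → [ b ] (edgeSum Γ (f ∘ ↔.to vertices) e - f (↔.to vertices p)))
        (does-⇔ (incidence p e) (↔.to vertices p ∈? edge H (↔.to edges e)) (On? Γ p e))))

    -- This additivity over edges allows two hypergraphs on the same points to be compared edge by
    -- edge.
    quadraticForm : ∀ (f : Vertex H → Carrier) →
      sum (λ i → f i * sum λ j → [ does (adjacent? H i j) ] f j) ≈ sum (pairSum Γ (f ∘ ↔.to vertices))
    quadraticForm f = begin
      sum (λ i → f i * sum λ j → [ does (adjacent? H i j) ] f j)
        ≈⟨ sum-cong (λ i → *-congˡ (row f i)) ⟩
      sum (λ i → f i * sum λ e → [ ∈E i e ] (S e - f i))
        ≈⟨ sum-cong (λ i → trans (*-distribˡ-sum (f i) (λ e → [ ∈E i e ] (S e - f i))) (sum-cong λ e → term (∈E i e) (f i) (S e))) ⟩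
      sum (λ i → sum λ e → [ ∈E i e ] f i * S e - [ ∈E i e ] (f i * f i))
        ≈⟨ ∑-comm (λ i e → [ ∈E i e ] f i * S e - [ ∈E i e ] (f i * f i)) ⟩
      sum (λ e → sum λ i → [ ∈E i e ] f i * S e - [ ∈E i e ] (f i * f i))
        ≈⟨ sum-cong (λ e → trans
             (∑-distrib-+ (λ i → [ ∈E i e ] f i * S e) (λ i → - ([ ∈E i e ] (f i * f i))))
             (+-cong
               (trans (sym (*-distribʳ-sum (S e) (λ i → [ ∈E i e ] f i))) (*-congʳ (sum-edge f e)))
               (trans (sum-neg (λ i → [ ∈E i e ] (f i * f i)))
                      (-‿cong (sum-edge (λ i → f i * f i) e))))) ⟩
      sum (pairSum Γ (f ∘ ↔.to vertices)) ∎
      where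
      ∈E : Vertex H → Fin k → Bool
      ∈E i e = does (i ∈? edge H (↔.to edges e))

      S : Fin k → Carrier
      S = edgeSum Γ (f ∘ ↔.to vertices)

      term : ∀ b x s → x * [ b ] (s - x) ≈ [ b ] x * s - [ b ] (x * x)
      term true  = solve 2 (λ x s → x :* (s :- x) := x :* s :- x :* x) refl
      term false = solve 2 (λ x s → x :* # 0 := # 0 :* s :- # 0) refl

-- An eigenvector of the windmill which is constant on the hub (x), the other
-- vertices of the blades (y), the new vertices on the spokes (a) and on the
-- blades (b), and the vertices of the pendant edges (p).

module WindmillVector (R : CommutativeRing 0ℓ 0ℓ) (ℓ M : ℕ) where

  open CommutativeRing R hiding (zero; _-_)
  open RingExpressions rawRing hiding (sum)
  open Sums R
  open IntegerRingSolver R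
  open import Relation.Binary.Reasoning.Setoid setoid

  module Classes (x y a b p : Carrier) where

    spokewise : Carrier → Carrier → Fin (6 ℕ.+ ℓ) → Carrier
    spokewise c d (suc⁶ _) = d
    spokewise c d _        = c

    spokewise-elim : ∀ (P : Carrier → Set) {c d} → P c → P d → ∀ j → P (spokewise c d j)
    spokewise-elim P c d 0F       = c
    spokewise-elim P c d 1F       = c
    spokewise-elim P c d 2F       = c
    spokewise-elim P c d 3F       = c
    spokewise-elim P c d 4F       = c
    spokewise-elim P c d 5F       = c
    spokewise-elim P c d (suc⁶ _) = d

    baseValue : Fin (7 ℕ.+ ℓ) → Carrier
    baseValue zero    = x
    baseValue (suc j) = spokewise y p j

    newValue : Fin (9 ℕ.+ ℓ) → Carrier
    newValue e = [ spokewise a p , (λ _ → b) ]′ (kind e)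

    value : Point (7 ℕ.+ ℓ) (9 ℕ.+ ℓ) M → Carrier
    value (inj₁ v)       = baseValue v
    value (inj₂ (e , _)) = newValue e

    value-elim : ∀ (P : Carrier → Set) → P x → P y → P a → P b → P p → ∀ u → P (value u)
    value-elim P x y a b p (inj₁ zero)    = x
    value-elim P x y a b p (inj₁ (suc j)) = spokewise-elim P y p j
    value-elim P x y a b p (inj₂ (e , _)) with kind e
    ... | inj₁ j = spokewise-elim P a p j
    ... | inj₂ _ = b

    spokeSum bladeSum pendantSum : Carrier
    spokeSum   = y + x + ι M * a
    bladeSum   = y + y + ι M * b
    pendantSum = p + x + ι M * p

    total : Fin (9 ℕ.+ ℓ) → Carrier
    total e = baseValue (windmillSrc e) + baseValue (windmillTgt hub e) + ι M * newValue e

    edgeSum≈total : ∀ e → edgeSum (windmill ℓ) value e ≈ total e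
    edgeSum≈total e = +-congˡ (sum-const M (newValue e))

    -- The five equations form the eigenvalue problem of the quotient matrix of the partition into
    -- classes. The hub lies on six spokes and `ℓ` pendant edges, a corner on one spoke and one
    -- blade.
    module _ (w : Carrier)
      (hub-eq     : ι 6 * (y + ι M * a) + ι ℓ * (1# + ι M) * p ≈ w * x)
      (corner-eq  : x + ι M * a + y + ι M * b ≈ w * y)
      (spoke-eq   : x + y + (ι M - 1#) * a ≈ w * a)
      (blade-eq   : ι 2 * y + (ι M - 1#) * b ≈ w * b)
      (pendant-eq : x + ι M * p ≈ w * p) where

      private
        Σ₀ : Point (7 ℕ.+ ℓ) (9 ℕ.+ ℓ) M → Carrier
        Σ₀ u = sum λ e → [ does (On? (windmill ℓ) u e) ] (total e - value u)

        -- The shape to which a sum over the nine concrete edges computes: a corner lies on two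
        -- consecutive edges, with `i` zeros before them and `j` zeros after.
        0s+ : ℕ → Carrier → Carrier
        0s+ zero    c = c
        0s+ (suc n) c = 0# + 0s+ n c

        0s+≈ : ∀ n {c} → 0s+ n c ≈ c
        0s+≈ zero    = refl
        0s+≈ (suc n) = trans (+-identityˡ _) (0s+≈ n)

        corner : ∀ i {c d} j → c + d ≈ (spokeSum - y) + (bladeSum - y) →
          0s+ i (c + (d + 0s+ j (sum {ℓ} λ _ → 0#))) ≈ w * y
        corner i {c} {d} j c+d≈ = begin
          0s+ i (c + (d + 0s+ j (sum {ℓ} λ _ → 0#)))  ≈⟨ trans (0s+≈ i) (sym (+-assoc c d _)) ⟩
          (c + d) + 0s+ j (sum {ℓ} λ _ → 0#)          ≈⟨ +-cong c+d≈ (trans (0s+≈ j) (sum-replicate-zero ℓ)) ⟩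
          (spokeSum - y) + (bladeSum - y) + 0#        ≈⟨ solve 5 (λ x y a b M →
            (y :+ x :+ M :* a :- y) :+ (y :+ y :+ M :* b :- y) :+ # 0 :=
            x :+ M :* a :+ y :+ M :* b) refl x y a b (ι M) ⟩
          x + ι M * a + y + ι M * b                   ≈⟨ corner-eq ⟩
          w * y                                       ∎

      total-equation : ∀ u → Σ₀ u ≈ w * value u
      total-equation (inj₁ 0F) = begin
        Σ₀ (inj₁ 0F)
          -- The nine terms in edge order: six spokes contribute `s`, and the three blades, which
          -- miss the hub, contribute `z`.
          ≈⟨ solve 3 (λ s z t → s :+ (z :+ (s :+ (s :+ (z :+ (s :+ (s :+ (z :+ (s :+ t)))))))) :=
               # 6 :* s :+ # 3 :* z :+ t) refl (spokeSum - x) 0# (sum {ℓ} (λ _ → pendantSum - x)) ⟩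
        ι 6 * (spokeSum - x) + ι 3 * 0# + sum {ℓ} (λ _ → pendantSum - x)
          ≈⟨ +-congˡ (sum-const ℓ (pendantSum - x)) ⟩
        ι 6 * (spokeSum - x) + ι 3 * 0# + ι ℓ * (pendantSum - x)
          ≈⟨ solve 6 (λ x y a p M N →
               # 6 :* (y :+ x :+ M :* a :- x) :+ # 3 :* # 0 :+ N :* (p :+ x :+ M :* p :- x) :=
               # 6 :* (y :+ M :* a) :+ N :* (# 1 :+ M) :* p) refl x y a p (ι M) (ι ℓ) ⟩
        ι 6 * (y + ι M * a) + ι ℓ * (1# + ι M) * p
          ≈⟨ hub-eq ⟩
        w * x ∎
      total-equation (inj₁ 1F) = corner 0 7 refl
      total-equation (inj₁ 2F) = corner 1 6 (+-comm _ _)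
      total-equation (inj₁ 3F) = corner 3 4 refl
      total-equation (inj₁ 4F) = corner 4 3 (+-comm _ _)
      total-equation (inj₁ 5F) = corner 6 1 refl
      total-equation (inj₁ 6F) = corner 7 0 (+-comm _ _)
      total-equation (inj₁ (suc⁷ q)) = begin
        Σ₀ (inj₁ (suc⁷ q))
          ≈⟨ 0s+≈ 9 ⟩
        sum (λ r → [ does (q ≟ r) ∨ false ] (pendantSum - p))
          ≈⟨ sum-cong (λ r → reflexive (≡.cong (λ b → [ b ] (pendantSum - p)) (∨-identityʳ (does (q ≟ r))))) ⟩
        sum (λ r → [ does (q ≟ r) ] (pendantSum - p))
          ≈⟨ sum-δ q (λ _ → pendantSum - p) ⟩
        pendantSum - p
          ≈⟨ solve 3 (λ x p M → p :+ x :+ M :* p :- p := x :+ M :* p) refl x p (ι M) ⟩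
        x + ι M * p
          ≈⟨ pendant-eq ⟩
        w * p ∎
      total-equation (inj₂ (f , r)) = trans (sum-δ f (λ e → total e - newValue f)) (new f)
        where
        spoke : spokeSum - a ≈ w * a
        spoke = trans (solve 4 (λ x y a M → y :+ x :+ M :* a :- a := x :+ y :+ (M :- # 1) :* a)
                  refl x y a (ι M)) spoke-eq

        blade′ : bladeSum - b ≈ w * b
        blade′ = trans (solve 3 (λ y b M → y :+ y :+ M :* b :- b := # 2 :* y :+ (M :- # 1) :* b)
                  refl y b (ι M)) blade-eq

        new : ∀ f → total f - newValue f ≈ w * newValue f
        new 0F = spoke
        new 1F = blade′
        new 2F = spoke
        new 3F = spoke
        new 4F = blade′
        new 5F = spoke
        new 6F = spoke
        new 7F = blade′
        new 8F = spoke
        new (suc⁹ q) = trans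
          (solve 3 (λ x p M → p :+ x :+ M :* p :- p := x :+ M :* p) refl x p (ι M)) pendant-eq

      eigenvector : ∀ {H} (P : Presentation M (windmill ℓ) H) i →
        sum (λ j → [ does (adjacent? H i j) ] value (Presentation.point P j)) ≈
        w * value (Presentation.point P i)
      eigenvector {H} P i = begin
        sum (λ j → [ does (adjacent? H i j) ] f j)
          ≡⟨ ≡.cong (λ i → sum (λ j → [ does (adjacent? H i j) ] f j)) (↔.strictlyInverseˡ vertices i) ⟨
        sum (λ j → [ does (adjacent? H (↔.to vertices u) j) ] f j)
          ≈⟨ row-point P f u ⟩
        sum (λ e → [ does (On? (windmill ℓ) u e) ] (edgeSum (windmill ℓ) (f ∘ ↔.to vertices) e - f (↔.to vertices u)))
          ≈⟨ sum-cong (λ e → []-cong (does (On? (windmill ℓ) u e)) (+-cong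
               (trans (edgeSum-cong (windmill ℓ) at e) (edgeSum≈total e)) (-‿cong (at u)))) ⟩
        Σ₀ u
          ≈⟨ total-equation u ⟩
        w * value u ∎
        where
        open Presentation P
        f = value ∘ point
        u = point i
        at : ∀ u → f (↔.to vertices u) ≈ value u
        at u = reflexive (≡.cong value (↔.strictlyInverseʳ vertices u))

  -- In the notation s = w − m + 2, t = w − m + 3, q = w² − (m − 2) w − 2 m + 3
  -- with m = 2 + M, clearing denominators in the equations of the classes
  -- leaves T₂C-polynomial as the only condition on w.

  module Solution (w : Carrier) where

    s t q x y a b p : Carrier
    -- The equations of the new vertices say t a = x + y and t b = 2 y, and those of the pendant
    -- edges say s p = x. Substituted into the corner equation they give q y = (w + 1) x. Scaling to
    -- x = q t s removes every denominator.
    s = w - ι M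
    t = s + 1#
    q = (w - 1#) * t - ι 3 * ι M
    x = q * t * s
    y = (w + 1#) * t * s
    a = (q + w + 1#) * s
    b = ι 2 * (w + 1#) * s
    p = q * t

    sE tE qE xE yE aE bE pE : ∀ {n} → Polynomial n → Polynomial n → Polynomial n
    sE M w = w :- M
    tE M w = sE M w :+ # 1
    qE M w = (w :- # 1) :* tE M w :- # 3 :* M
    xE M w = qE M w :* tE M w :* sE M w
    yE M w = (w :+ # 1) :* tE M w :* sE M w
    aE M w = (qE M w :+ w :+ # 1) :* sE M w
    bE M w = # 2 :* (w :+ # 1) :* sE M w
    pE M w = qE M w :* tE M w

    -- It must evaluate to the term `T₂C-polynomial` itself: `ι 1` unfolds to `1# + 0#`, whence the
    -- summand `# 0`, and `2+E` and `9+E` copy the unfolding of `ι` on successors.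
    polynomialE : ∀ {n} → Polynomial n → Polynomial n → Polynomial n → Polynomial n
    polynomialE m k w =
        (w :^ 2 :- (m :- # 2) :* w :- # 2 :* m :+ # 3)
          :* ( (w :- m :+ # 3) :* (w :* (w :- m :+ # 2) :- (k :- # 3) :* (m :- (# 1 :+ # 0)) :+ # 6)
             :+ # 6 :* (m :- # 2))
        :- # 6 :* (w :+ # 1) :^ 2 :* (w :- m :+ # 2)

    2+E 9+E : ∀ {n} → Polynomial n → Polynomial n
    2+E u = # 1 :+ (# 1 :+ u)
    9+E u = # 1 :+ 2+E (2+E (2+E (2+E u)))

    module _ (root : T₂C-polynomial (2 ℕ.+ M) (9 ℕ.+ ℓ) w ≈ 0#) where

      -- With this scaling, the two sides of the hub equation differ by exactly the polynomial,
      -- without a further factor.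
      hub-eq : ι 6 * (y + ι M * a) + ι ℓ * (1# + ι M) * p ≈ w * x
      hub-eq = begin
        ι 6 * (y + ι M * a) + ι ℓ * (1# + ι M) * p
          ≈⟨ solve 3 (λ M N w → # 6 :* (yE M w :+ M :* aE M w) :+ N :* (# 1 :+ M) :* pE M w :=
               w :* xE M w :- polynomialE (2+E M) (9+E N) w) refl (ι M) (ι ℓ) w ⟩
        w * x - T₂C-polynomial (2 ℕ.+ M) (9 ℕ.+ ℓ) w
          ≈⟨ +-congˡ (-‿cong root) ⟩
        w * x - 0#
          ≈⟨ solve 1 (λ u → u :- # 0 := u) refl (w * x) ⟩
        w * x ∎

      open Classes x y a b p public using (value; value-elim; spokewise-elim)

      solution : ∀ {H} (P : Presentation M (windmill ℓ) H) i →
        sum (λ j → [ does (adjacent? H i j) ] value (Presentation.point P j)) ≈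
        w * value (Presentation.point P i)
      solution = Classes.eigenvector x y a b p w hub-eq
        (solve 2 (λ M w → xE M w :+ M :* aE M w :+ yE M w :+ M :* bE M w := w :* yE M w) refl (ι M) w)
        (solve 2 (λ M w → xE M w :+ yE M w :+ (M :- # 1) :* aE M w := w :* aE M w) refl (ι M) w)
        (solve 2 (λ M w → # 2 :* yE M w :+ (M :- # 1) :* bE M w := w :* bE M w) refl (ι M) w)
        (solve 2 (λ M w → xE M w :+ M :* pE M w := w :* pE M w) refl (ι M) w)

-- Ordered fields

module Reals (ℝ : RealNumbers) where

  open RealNumbers ℝ hiding (zero; _-_)
  open RingExpressions rawRing using (ι; _-_) public
  open IntegerRingSolver commutativeRing
  open Sums commutativeRing
  module ≤ = IsDecTotalOrder isDecTotalOrder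
  open import Relation.Binary.Reasoning.Setoid setoid

  ≤-respˡ : ∀ {x y z} → x ≈ y → x ≤ z → y ≤ z
  ≤-respˡ x≈y = ≤.trans (≤.reflexive (sym x≈y))

  ≤-respʳ : ∀ {x y z} → y ≈ z → x ≤ y → x ≤ z
  ≤-respʳ y≈z x≤y = ≤.trans x≤y (≤.reflexive y≈z)

  <-resp : ∀ {x x′ y y′} → x ≈ x′ → y ≈ y′ → x < y → x′ < y′
  <-resp p q (x≤y , x≉y) = ≤-respˡ p (≤-respʳ q x≤y) , λ e → x≉y (trans p (trans e (sym q)))

  ≰⇒> : ∀ {x y} → ¬ x ≤ y → y < x
  ≰⇒> {x} {y} x≰y = [ (λ x≤y → contradiction x≤y x≰y) , (λ y≤x → y≤x) ]′ (≤.total x y) ,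
    λ y≈x → x≰y (≤.reflexive (sym y≈x))

  <⇒≱ : ∀ {x y} → x < y → ¬ y ≤ x
  <⇒≱ (x≤y , x≉y) y≤x = x≉y (≤.antisym x≤y y≤x)

  <-≤-trans : ∀ {x y z} → x < y → y ≤ z → x < z
  <-≤-trans (x≤y , x≉y) y≤z = ≤.trans x≤y y≤z , λ x≈z → x≉y (≤.antisym x≤y (≤-respʳ (sym x≈z) y≤z))

  0≤-⇒≤ : ∀ {x y} → 0# ≤ y - x → x ≤ y
  0≤-⇒≤ {x} {y} h = ≤-respˡ (+-identityˡ x) (≤-respʳ
    (solve 2 (λ x y → y :- x :+ x := y) refl x y) (+-monoˡ-≤ x h))

  ≤⇒0≤- : ∀ {x y} → x ≤ y → 0# ≤ y - x
  ≤⇒0≤- {x} {y} h = ≤-respˡ (-‿inverseʳ x) (+-monoˡ-≤ (- x) h)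

  0<-⇒< : ∀ {x y} → 0# < y - x → x < y
  0<-⇒< {x} {y} (h , h≉) = 0≤-⇒≤ h , λ x≈y → h≉ (sym (trans (+-congˡ (-‿cong x≈y)) (-‿inverseʳ y)))

  <⇒0<- : ∀ {x y} → x < y → 0# < y - x
  <⇒0<- {x} {y} (h , h≉) = ≤⇒0≤- h , λ e → h≉ (begin
    x           ≈⟨ +-identityˡ x ⟨
    0# + x      ≈⟨ +-congʳ e ⟩
    y - x + x   ≈⟨ solve 2 (λ x y → y :- x :+ x := y) refl x y ⟩
    y           ∎)

  ≤-from : ∀ {x y d} → y - x ≈ d → 0# ≤ d → x ≤ y
  ≤-from e h = 0≤-⇒≤ (≤-respʳ (sym e) h)

  <-from : ∀ {x y d} → y - x ≈ d → 0# < d → x < y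
  <-from e h = 0<-⇒< (<-resp refl (sym e) h)

  +-nonneg : ∀ {x y} → 0# ≤ x → 0# ≤ y → 0# ≤ x + y
  +-nonneg {x} {y} p q = ≤.trans q (≤-respˡ (+-identityˡ y) (+-monoˡ-≤ y p))

  +-mono-≤ : ∀ {x y u v} → x ≤ y → u ≤ v → x + u ≤ y + v
  +-mono-≤ {x} {y} {u} {v} p q = ≤-from
    (solve 4 (λ x y u v → y :+ v :- (x :+ u) := (y :- x) :+ (v :- u)) refl x y u v)
    (+-nonneg (≤⇒0≤- p) (≤⇒0≤- q))

  +-pos : ∀ {x y} → 0# < x → 0# ≤ y → 0# < x + y
  +-pos {x} {y} p q = <-≤-trans p (≤-from (solve 2 (λ x y → x :+ y :- x := y) refl x y) q)

  neg-nonneg : ∀ {x} → x ≤ 0# → 0# ≤ - x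
  neg-nonneg {x} p = ≤-respʳ (+-identityˡ (- x)) (≤⇒0≤- p)

  neg-mono : ∀ {x y} → x ≤ y → - y ≤ - x
  neg-mono {x} {y} p = ≤-from (solve 2 (λ x y → :- x :- :- y := y :- x) refl x y) (≤⇒0≤- p)

  square-nonneg : ∀ x → 0# ≤ x * x
  square-nonneg x = [ (λ p → *-nonneg p p) , (λ p → ≤-respʳ
    (solve 1 (λ x → :- x :* :- x := x :* x) refl x) (*-nonneg (neg-nonneg p) (neg-nonneg p))) ]′
    (≤.total 0# x)

  0<1 : 0# < 1#
  0<1 = ≤-respʳ (*-identityˡ 1#) (square-nonneg 1#) , 0≉1

  ι-nonneg : ∀ n → 0# ≤ ι n
  ι-nonneg zero    = ≤.refl
  ι-nonneg (suc n) = +-nonneg (proj₁ 0<1) (ι-nonneg n)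

  ι-pos : ∀ n → 0# < ι (suc n)
  ι-pos n = +-pos 0<1 (ι-nonneg n)

  *-zero : ∀ {x y} → x * y ≈ 0# → ¬ x ≈ 0# → y ≈ 0#
  *-zero {x} {y} xy≈0 x≉0 = begin
    y                ≈⟨ *-identityˡ y ⟨
    1# * y           ≈⟨ *-congʳ (⁻¹-inverseʳ x≉0) ⟨
    x * x ⁻¹ * y     ≈⟨ solve 3 (λ x i y → x :* i :* y := i :* (x :* y)) refl x (x ⁻¹) y ⟩
    x ⁻¹ * (x * y)   ≈⟨ *-congˡ xy≈0 ⟩
    x ⁻¹ * 0#        ≈⟨ zeroʳ _ ⟩
    0#               ∎

  pos⇒≉0 : ∀ {x} → 0# < x → ¬ x ≈ 0#
  pos⇒≉0 (_ , 0≉x) x≈0 = 0≉x (sym x≈0)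

  nonneg∧≉0⇒pos : ∀ {x} → 0# ≤ x → ¬ x ≈ 0# → 0# < x
  nonneg∧≉0⇒pos 0≤x x≉0 = 0≤x , x≉0 ∘ sym

  *-pos : ∀ {x y} → 0# < x → 0# < y → 0# < x * y
  *-pos p q = *-nonneg (proj₁ p) (proj₁ q) , λ e → pos⇒≉0 q (*-zero (sym e) (pos⇒≉0 p))

  *-cancelˡ : ∀ {x y z} → ¬ x ≈ 0# → x * y ≈ x * z → y ≈ z
  *-cancelˡ {x} {y} {z} x≉0 e = begin
    y            ≈⟨ solve 2 (λ y z → y := (y :- z) :+ z) refl y z ⟩
    (y - z) + z  ≈⟨ +-congʳ (*-zero (trans (solve 3 (λ x y z → x :* (y :- z) := x :* y :- x :* z) refl x y z)
                      (trans (+-congʳ e) (-‿inverseʳ _))) x≉0) ⟩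
    0# + z       ≈⟨ +-identityˡ z ⟩
    z            ∎

  *-cancelˡ-≤ : ∀ {x y z} → 0# < x → x * y ≤ x * z → y ≤ z
  *-cancelˡ-≤ {x} {y} {z} p h with y ≤.≤? z
  ... | yes y≤z = y≤z
  ... | no  y≰z = contradiction h (<⇒≱ (<-from
    (solve 3 (λ x y z → x :* y :- x :* z := x :* (y :- z)) refl x y z)
    (*-pos p (<⇒0<- (≰⇒> y≰z)))))

  *-monoˡ-≤ : ∀ {x y z} → 0# ≤ x → y ≤ z → x * y ≤ x * z
  *-monoˡ-≤ {x} {y} {z} p h = ≤-from
    (solve 3 (λ x y z → x :* z :- x :* y := x :* (z :- y)) refl x y z) (*-nonneg p (≤⇒0≤- h))

  *-mono-≤ : ∀ {x y u v} → 0# ≤ x → 0# ≤ v → x ≤ y → u ≤ v → x * u ≤ y * v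
  *-mono-≤ {x} {y} {u} {v} 0≤x 0≤v x≤y u≤v = ≤-from
    (solve 4 (λ x y u v → y :* v :- x :* u := (y :- x) :* v :+ x :* (v :- u)) refl x y u v)
    (+-nonneg (*-nonneg (≤⇒0≤- x≤y) 0≤v) (*-nonneg 0≤x (≤⇒0≤- u≤v)))

  ⁻¹-pos : ∀ {x} → 0# < x → 0# < x ⁻¹
  ⁻¹-pos {x} p with 0# ≤.≤? x ⁻¹
  ... | yes 0≤i = 0≤i , λ e → 0≉1 (begin
    0#        ≈⟨ zeroʳ x ⟨
    x * 0#    ≈⟨ *-congˡ e ⟩
    x * x ⁻¹  ≈⟨ ⁻¹-inverseʳ (pos⇒≉0 p) ⟩
    1#        ∎)
  ... | no  0≰i = contradiction (≤-respˡ (⁻¹-inverseʳ (pos⇒≉0 p)) (≤-respʳ (zeroʳ x)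
    (*-monoˡ-≤ (proj₁ p) (proj₁ (≰⇒> 0≰i))))) (<⇒≱ 0<1)

  square-≈0 : ∀ {x} → x * x ≈ 0# → x ≈ 0#
  square-≈0 {x} e with x ≤.≟ 0#
  ... | yes x≈0 = x≈0
  ... | no  x≉0 = *-zero e x≉0

  square-pos : ∀ {x} → ¬ x ≈ 0# → 0# < x * x
  square-pos {x} x≉0 = nonneg∧≉0⇒pos (square-nonneg x) (x≉0 ∘ square-≈0)

  -- Most laws of the absolute value and of the modulus are proved through this lemma, by comparing
  -- squares.
  sqrt-unique : ∀ {x y} → 0# ≤ x → 0# ≤ y → x * x ≈ y * y → x ≈ y
  sqrt-unique {x} {y} 0≤x 0≤y e with (x + y) ≤.≟ 0#
  ... | yes s≈0 = trans x≈0 (sym y≈0)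
    where
    x≈0 = ≤.antisym (≤-respʳ s≈0 (≤-from (solve 2 (λ x y → x :+ y :- x := y) refl x y) 0≤y)) 0≤x
    y≈0 = ≤.antisym (≤-respʳ s≈0 (≤-from (solve 2 (λ x y → x :+ y :- y := x) refl x y) 0≤x)) 0≤y
  ... | no  s≉0 = begin
    x            ≈⟨ solve 2 (λ x y → x := (x :- y) :+ y) refl x y ⟩
    (x - y) + y  ≈⟨ +-congʳ (*-zero (trans (solve 2 (λ x y → (x :+ y) :* (x :- y) := x :* x :- y :* y) refl x y)
                      (trans (+-congʳ e) (-‿inverseʳ _))) s≉0) ⟩
    0# + y       ≈⟨ +-identityˡ y ⟩
    y            ∎

  ∣_∣ : Carrier → Carrier
  ∣ x ∣ with 0# ≤.≤? x
  ... | yes _ = x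
  ... | no  _ = - x

  ∣∣-nonneg : ∀ x → 0# ≤ ∣ x ∣
  ∣∣-nonneg x with 0# ≤.≤? x
  ... | yes p = p
  ... | no  p = neg-nonneg (proj₁ (≰⇒> p))

  ∣∣-square : ∀ x → ∣ x ∣ * ∣ x ∣ ≈ x * x
  ∣∣-square x with 0# ≤.≤? x
  ... | yes p = refl
  ... | no  p = solve 1 (λ x → :- x :* :- x := x :* x) refl x

  ∣∣-sign : ∀ x → ∣ x ∣ ≈ x ⊎ ∣ x ∣ ≈ - x
  ∣∣-sign x with 0# ≤.≤? x
  ... | yes p = inj₁ refl
  ... | no  p = inj₂ refl

  ≤∣∣ : ∀ x → x ≤ ∣ x ∣
  ≤∣∣ x with 0# ≤.≤? x
  ... | yes p = ≤.refl
  ... | no  p = ≤.trans (proj₁ (≰⇒> p)) (neg-nonneg (proj₁ (≰⇒> p)))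

  -≤∣∣ : ∀ x → - x ≤ ∣ x ∣
  -≤∣∣ x with 0# ≤.≤? x
  ... | yes p = ≤.trans (≤-respʳ (solve 0 (:- # 0 := # 0) refl) (neg-mono p)) p
  ... | no  p = ≤.refl

  ∣∣-least : ∀ {x b} → x ≤ b → - x ≤ b → ∣ x ∣ ≤ b
  ∣∣-least {x} p q with 0# ≤.≤? x
  ... | yes _ = p
  ... | no  _ = q

  nonneg⇒∣∣ : ∀ {x} → 0# ≤ x → ∣ x ∣ ≈ x
  nonneg⇒∣∣ {x} p = sqrt-unique (∣∣-nonneg x) p (∣∣-square x)

  nonpos⇒∣∣ : ∀ {x} → x ≤ 0# → ∣ x ∣ ≈ - x
  nonpos⇒∣∣ {x} p = sqrt-unique (∣∣-nonneg x) (neg-nonneg p)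
    (trans (∣∣-square x) (solve 1 (λ x → x :* x := :- x :* :- x) refl x))

  ∣∣-cong : ∀ {x y} → x ≈ y → ∣ x ∣ ≈ ∣ y ∣
  ∣∣-cong {x} {y} e = sqrt-unique (∣∣-nonneg x) (∣∣-nonneg y)
    (trans (∣∣-square x) (trans (*-cong e e) (sym (∣∣-square y))))

  ∣∣-* : ∀ x y → ∣ x * y ∣ ≈ ∣ x ∣ * ∣ y ∣
  ∣∣-* x y = sqrt-unique (∣∣-nonneg _) (*-nonneg (∣∣-nonneg x) (∣∣-nonneg y)) (begin
    ∣ x * y ∣ * ∣ x * y ∣              ≈⟨ ∣∣-square (x * y) ⟩
    (x * y) * (x * y)                  ≈⟨ solve 2 (λ x y → (x :* y) :* (x :* y) := (x :* x) :* (y :* y)) refl x y ⟩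
    (x * x) * (y * y)                  ≈⟨ *-cong (∣∣-square x) (∣∣-square y) ⟨
    (∣ x ∣ * ∣ x ∣) * (∣ y ∣ * ∣ y ∣)  ≈⟨ solve 2 (λ x y → (x :* x) :* (y :* y) := (x :* y) :* (x :* y)) refl ∣ x ∣ ∣ y ∣ ⟩
    (∣ x ∣ * ∣ y ∣) * (∣ x ∣ * ∣ y ∣)  ∎)

  ∣∣-+ : ∀ x y → ∣ x + y ∣ ≤ ∣ x ∣ + ∣ y ∣
  ∣∣-+ x y = ∣∣-least (+-mono-≤ (≤∣∣ x) (≤∣∣ y))
    (≤-respˡ (solve 2 (λ x y → :- x :+ :- y := :- (x :+ y)) refl x y) (+-mono-≤ (-≤∣∣ x) (-≤∣∣ y)))

  ∣∣-neg : ∀ x → ∣ - x ∣ ≈ ∣ x ∣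
  ∣∣-neg x = sqrt-unique (∣∣-nonneg _) (∣∣-nonneg _) (trans (∣∣-square (- x))
    (trans (solve 1 (λ x → :- x :* :- x := x :* x) refl x) (sym (∣∣-square x))))

  sum-nonneg : ∀ {n} (f : Fin n → Carrier) → (∀ i → 0# ≤ f i) → 0# ≤ sum f
  sum-nonneg {zero}  f h = ≤.refl
  sum-nonneg {suc n} f h = +-nonneg (h zero) (sum-nonneg (f ∘ suc) (h ∘ suc))

  sum-mono : ∀ {n} (f g : Fin n → Carrier) → (∀ i → f i ≤ g i) → sum f ≤ sum g
  sum-mono {zero}  f g h = ≤.refl
  sum-mono {suc n} f g h = +-mono-≤ (h zero) (sum-mono (f ∘ suc) (g ∘ suc) (h ∘ suc))

  sum-pos : ∀ {n} (f : Fin n → Carrier) → (∀ i → 0# ≤ f i) → ∀ i → 0# < f i → 0# < sum f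
  sum-pos f h zero    p = +-pos p (sum-nonneg (f ∘ suc) (h ∘ suc))
  sum-pos f h (suc i) p = <-resp refl (+-comm _ _) (+-pos (sum-pos (f ∘ suc) (h ∘ suc) i p) (h zero))

  sum≈0⇒≈0 : ∀ {n} (f : Fin n → Carrier) → (∀ i → 0# ≤ f i) → sum f ≈ 0# → ∀ i → f i ≈ 0#
  sum≈0⇒≈0 f h e i with f i ≤.≟ 0#
  ... | yes p = p
  ... | no  p = contradiction e (pos⇒≉0 (sum-pos f h i (nonneg∧≉0⇒pos (h i) p)))

  sum-≈⇒≈ : ∀ {n} (f g : Fin n → Carrier) → (∀ i → f i ≤ g i) → sum g ≤ sum f → ∀ i → f i ≈ g i
  sum-≈⇒≈ f g h e i = begin
    f i                ≈⟨ +-identityˡ (f i) ⟨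
    0# + f i           ≈⟨ +-congʳ (sum≈0⇒≈0 (λ i → g i - f i) (λ i → ≤⇒0≤- (h i)) diff i) ⟨
    g i - f i + f i    ≈⟨ solve 2 (λ x y → y :- x :+ x := y) refl (f i) (g i) ⟩
    g i                ∎
    where
    diff : sum (λ i → g i - f i) ≈ 0#
    diff = begin
      sum (λ i → g i - f i)          ≈⟨ ∑-distrib-+ g (λ i → - f i) ⟩
      sum g + sum (λ i → - f i)      ≈⟨ +-congˡ (sum-neg f) ⟩
      sum g - sum f                  ≈⟨ +-congʳ (≤.antisym e (sum-mono f g h)) ⟩
      sum f - sum f                  ≈⟨ -‿inverseʳ _ ⟩
      0#                             ∎

  argmax : ∀ {n} (f : Fin n → Carrier) → Fin n → ∃ λ i → ∀ j → f j ≤ f i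
  argmax {suc zero}    f _ = zero , λ { zero → ≤.refl }
  argmax {suc (suc n)} f _ with argmax (f ∘ suc) zero
  ... | i , max with f zero ≤.≤? f (suc i)
  ...   | yes p = suc i , λ { zero → p ; (suc j) → max j }
  ...   | no  p = zero , λ { zero → ≤.refl ; (suc j) → ≤.trans (max j) (proj₁ (≰⇒> p)) }

-- Intermediate values

module Lipschitz (ℝ : RealNumbers) where

  open RealNumbers ℝ hiding (zero; _-_)
  open IntegerRingSolver commutativeRing
  open Reals ℝ

  -- A form of continuity which is closed under the ring operations and has an explicit step size.
  -- The bound on |f| is carried along because the Lipschitz constant of a product depends on it.
  record IsLipschitz (l u : Carrier) (f : Carrier → Carrier) : Set where
    field
      bound constant    : Carrier
      bound-nonneg      : 0# ≤ bound
      constant-nonneg   : 0# ≤ constant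
      bounded           : ∀ {x} → l ≤ x → x ≤ u → ∣ f x ∣ ≤ bound
      lipschitz         : ∀ {x y} → l ≤ x → x ≤ u → l ≤ y → y ≤ u →
                          ∣ f x - f y ∣ ≤ constant * ∣ x - y ∣

  module _ {l u : Carrier} where

    open IsLipschitz

    lip-const : ∀ c → IsLipschitz l u (λ _ → c)
    lip-const c = record
      { bound           = ∣ c ∣
      ; constant        = 0#
      ; bound-nonneg    = ∣∣-nonneg c
      ; constant-nonneg = ≤.refl
      ; bounded         = λ _ _ → ≤.refl
      ; lipschitz       = λ {x} {y} _ _ _ _ → ≤.reflexive (trans (∣∣-cong (-‿inverseʳ c))
                            (trans (nonneg⇒∣∣ ≤.refl) (sym (zeroˡ ∣ x - y ∣))))
      }

    lip-id : IsLipschitz l u (λ x → x)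
    lip-id = record
      { bound           = ∣ l ∣ + ∣ u ∣
      ; constant        = 1#
      ; bound-nonneg    = +-nonneg (∣∣-nonneg l) (∣∣-nonneg u)
      ; constant-nonneg = proj₁ 0<1
      ; bounded         = λ l≤x x≤u → ∣∣-least
          (≤.trans x≤u (≤.trans (≤∣∣ u) (≤-from (solve 2 (λ a b → a :+ b :- b := a) refl ∣ l ∣ ∣ u ∣) (∣∣-nonneg l))))
          (≤.trans (neg-mono l≤x) (≤.trans (-≤∣∣ l) (≤-from (solve 2 (λ a b → a :+ b :- a := b) refl ∣ l ∣ ∣ u ∣) (∣∣-nonneg u))))
      ; lipschitz       = λ {x} {y} _ _ _ _ → ≤.reflexive (sym (*-identityˡ ∣ x - y ∣))
      }

    lip-+ : ∀ {f g} → IsLipschitz l u f → IsLipschitz l u g → IsLipschitz l u (λ x → f x + g x)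
    lip-+ {f} {g} F G = record
      { bound           = bound F + bound G
      ; constant        = constant F + constant G
      ; bound-nonneg    = +-nonneg (bound-nonneg F) (bound-nonneg G)
      ; constant-nonneg = +-nonneg (constant-nonneg F) (constant-nonneg G)
      ; bounded         = λ {x} p q → ≤.trans (∣∣-+ (f x) (g x)) (+-mono-≤ (bounded F p q) (bounded G p q))
      ; lipschitz       = λ {x} {y} p q r s → ≤-respˡ
          (∣∣-cong (solve 4 (λ a b c d → (a :- b) :+ (c :- d) := (a :+ c) :- (b :+ d)) refl (f x) (f y) (g x) (g y)))
          (≤.trans (∣∣-+ (f x - f y) (g x - g y)) (≤-respʳ
            (sym (distribʳ ∣ x - y ∣ (constant F) (constant G)))
            (+-mono-≤ (lipschitz F p q r s) (lipschitz G p q r s))))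
      }

    lip-neg : ∀ {f} → IsLipschitz l u f → IsLipschitz l u (λ x → - f x)
    lip-neg {f} F = record
      { bound           = bound F
      ; constant        = constant F
      ; bound-nonneg    = bound-nonneg F
      ; constant-nonneg = constant-nonneg F
      ; bounded         = λ {x} p q → ≤-respˡ (sym (∣∣-neg (f x))) (bounded F p q)
      ; lipschitz       = λ {x} {y} p q r s → ≤-respˡ
          (trans (sym (∣∣-neg (f x - f y))) (∣∣-cong (solve 2 (λ a b → :- (a :- b) := :- a :- :- b) refl (f x) (f y))))
          (lipschitz F p q r s)
      }

    lip-* : ∀ {f g} → IsLipschitz l u f → IsLipschitz l u g → IsLipschitz l u (λ x → f x * g x)
    lip-* {f} {g} F G = record
      { bound           = bound F * bound G
      ; constant        = bound F * constant G + constant F * bound G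
      ; bound-nonneg    = *-nonneg (bound-nonneg F) (bound-nonneg G)
      ; constant-nonneg = +-nonneg (*-nonneg (bound-nonneg F) (constant-nonneg G))
                                   (*-nonneg (constant-nonneg F) (bound-nonneg G))
      ; bounded         = λ {x} p q → ≤-respˡ (sym (∣∣-* (f x) (g x)))
          (*-mono-≤ (∣∣-nonneg (f x)) (bound-nonneg G) (bounded F p q) (bounded G p q))
      ; lipschitz       = λ {x} {y} p q r s → ≤-respˡ
          (∣∣-cong (solve 4 (λ a b c d → a :* (c :- d) :+ (a :- b) :* d := a :* c :- b :* d) refl (f x) (f y) (g x) (g y)))
          (≤.trans (∣∣-+ (f x * (g x - g y)) ((f x - f y) * g y)) (≤-respʳ
            (solve 5 (λ B C D E z → B :* (C :* z) :+ (D :* z) :* E := (B :* C :+ D :* E) :* z) refl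
              (bound F) (constant G) (constant F) (bound G) ∣ x - y ∣)
            (+-mono-≤
              (≤-respˡ (sym (∣∣-* (f x) (g x - g y)))
                (*-mono-≤ (∣∣-nonneg (f x)) (*-nonneg (constant-nonneg G) (∣∣-nonneg (x - y))) (bounded F p q) (lipschitz G p q r s)))
              (≤-respˡ (sym (∣∣-* (f x - f y) (g y)))
                (*-mono-≤ (∣∣-nonneg (f x - f y)) (bound-nonneg G) (lipschitz F p q r s) (bounded G r s))))))
      }

  intermediateValue : ∀ {l u f} → IsLipschitz l u f → l ≤ u → f l ≤ 0# → 0# ≤ f u →
                      ∃ λ x → l ≤ x × x ≤ u × f x ≈ 0#
  intermediateValue {l} {u} {f} F l≤u fl≤0 0≤fu = c , l≤c , c≤u , ≤.antisym fc≤0 0≤fc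
    where
    open IsLipschitz F

    L : Carrier
    -- Adding 1 makes `L` positive, so that it can be inverted even if the constant is 0.
    L = constant + 1#

    0<L : 0# < L
    0<L = <-resp refl (+-comm 1# constant) (+-pos 0<1 constant-nonneg)

    1/L : Carrier
    1/L = L ⁻¹

    steep : ∀ {x y} → l ≤ x → x ≤ y → y ≤ u → f x - f y ≤ L * (y - x) × f y - f x ≤ L * (y - x)
    steep {x} {y} l≤x x≤y y≤u =
      ≤.trans (≤∣∣ (f x - f y)) ∣fx-fy∣≤ ,
      ≤.trans (≤-respˡ (solve 2 (λ a b → :- (a :- b) := b :- a) refl (f x) (f y)) (-≤∣∣ (f x - f y))) ∣fx-fy∣≤
      where
      ∣fx-fy∣≤ : ∣ f x - f y ∣ ≤ L * (y - x)
      ∣fx-fy∣≤ = ≤.trans (lipschitz l≤x (≤.trans x≤y y≤u) (≤.trans l≤x x≤y) y≤u)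
        (≤.trans (≤.reflexive (*-congˡ (trans (nonpos⇒∣∣
            (≤-respˡ (solve 2 (λ x y → :- (y :- x) := x :- y) refl x y)
              (≤-respʳ (solve 0 (:- # 0 := # 0) refl) (neg-mono (≤⇒0≤- x≤y)))))
          (solve 2 (λ x y → :- (x :- y) := y :- x) refl x y))))
        (≤-from (solve 2 (λ k z → (k :+ # 1) :* z :- k :* z := z) refl constant (y - x)) (≤⇒0≤- x≤y)))

    S : Carrier → Set
    S x = l ≤ x × x ≤ u × f x ≤ 0#

    supremum = complete S (l , ≤.refl , l≤u , fl≤0) (u , λ _ x∈S → proj₁ (proj₂ x∈S))

    c : Carrier
    c = proj₁ supremum

    upper : IsUpperBound S c
    upper = proj₁ (proj₂ supremum)

    supremum-least : ∀ b → IsUpperBound S b → c ≤ b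
    supremum-least = proj₂ (proj₂ supremum)

    l≤c : l ≤ c
    l≤c = upper l (≤.refl , l≤u , fl≤0)

    c≤u : c ≤ u
    c≤u = supremum-least u λ _ x∈S → proj₁ (proj₂ x∈S)

    -- If f c were positive, f would be positive on [c − f c / L, c].

    fc≤0 : f c ≤ 0#
    fc≤0 with f c ≤.≤? 0#
    ... | yes p = p
    ... | no  p = contradiction (supremum-least (c - f c * 1/L) below) (<⇒≱ (<-from
      (solve 2 (λ c d → c :- (c :- d) := d) refl c (f c * 1/L)) (*-pos (≰⇒> p) (⁻¹-pos 0<L))))
      where
      below : IsUpperBound S (c - f c * 1/L)
      below x x∈S@(l≤x , x≤u , fx≤0) = *-cancelˡ-≤ 0<L (≤-from
        (begin
          L * (c - f c * 1/L) - L * x        ≈⟨ solve 5 (λ L c d i x → L :* (c :- d :* i) :- L :* x :=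
                                                  L :* (c :- x) :- d :* (L :* i)) refl L c (f c) 1/L x ⟩
          L * (c - x) - f c * (L * 1/L)      ≈⟨ +-congˡ (-‿cong (*-congˡ (⁻¹-inverseʳ (pos⇒≉0 0<L)))) ⟩
          L * (c - x) - f c * 1#             ≈⟨ solve 3 (λ z d e → z :- d :* # 1 := (z :- (d :- e)) :+ :- e)
                                                  refl (L * (c - x)) (f c) (f x) ⟩
          (L * (c - x) - (f c - f x)) - f x  ∎)
        (+-nonneg (≤⇒0≤- (proj₂ (steep l≤x (upper x x∈S) c≤u))) (neg-nonneg fx≤0)))
        where open import Relation.Binary.Reasoning.Setoid setoid

    -- If f c were negative, f would be negative on [c, c − f c / L].

    0≤fc : 0# ≤ f c
    0≤fc with 0# ≤.≤? f c
    ... | yes p = p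
    ... | no  p with (c - f c * 1/L) ≤.≤? u
    ...   | yes x≤u = contradiction (upper x (≤.trans l≤c (proj₁ c<x) , x≤u , fx≤0)) (<⇒≱ c<x)
      where
      open import Relation.Binary.Reasoning.Setoid setoid
      x = c - f c * 1/L
      0<-fc : 0# < - f c
      0<-fc = <-resp refl (+-identityˡ (- f c)) (<⇒0<- (≰⇒> p))
      c<x : c < x
      c<x = <-from (solve 3 (λ c d i → (c :- d :* i) :- c := (:- d) :* i) refl c (f c) 1/L)
              (*-pos 0<-fc (⁻¹-pos 0<L))
      fx≤0 : f x ≤ 0#
      fx≤0 = ≤-from (begin
        0# - f x                              ≈⟨ solve 2 (λ d e → # 0 :- e := :- d :- (e :- d)) refl (f c) (f x) ⟩
        - f c - (f x - f c)                   ≈⟨ +-congʳ (solve 1 (λ d → :- d := :- d :* # 1) refl (f c)) ⟩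
        - f c * 1# - (f x - f c)              ≈⟨ +-congʳ (*-congˡ (⁻¹-inverseʳ (pos⇒≉0 0<L))) ⟨
        - f c * (L * 1/L) - (f x - f c)       ≈⟨ solve 5 (λ d L i c e → :- d :* (L :* i) :- e := L :* ((c :- d :* i) :- c) :- e)
                                                   refl (f c) L 1/L c (f x - f c) ⟩
        L * (x - c) - (f x - f c)             ∎)
        (≤⇒0≤- (proj₂ (steep l≤c (proj₁ c<x) x≤u)))
    -- If the step of length |f c| / L passes beyond `u`, then f is still negative at `u`.
    ...   | no  x≰u = contradiction 0≤fu (<⇒≱ (<-from (begin
        0# - f u
          ≈⟨ solve 5 (λ d e L i c → # 0 :- e := (:- d :* (# 1 :- L :* i) :+ L :* (c :- d :* i :- c)) :- (e :- d))
               refl (f c) (f u) L 1/L c ⟩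
        - f c * (1# - L * 1/L) + L * (x - c) - (f u - f c)
          ≈⟨ +-congʳ (+-congʳ (*-congˡ (+-congˡ (-‿cong (⁻¹-inverseʳ (pos⇒≉0 0<L)))))) ⟩
        - f c * (1# - 1#) + L * (x - c) - (f u - f c)
          ≈⟨ solve 6 (λ d e L c x u → :- d :* (# 1 :- # 1) :+ L :* (x :- c) :- (e :- d) :=
               L :* (x :- u) :+ (L :* (u :- c) :- (e :- d))) refl (f c) (f u) L c x u ⟩
        L * (x - u) + (L * (u - c) - (f u - f c)) ∎)
        (+-pos (*-pos 0<L (<⇒0<- (≰⇒> x≰u))) (≤⇒0≤- (proj₂ (steep l≤c c≤u ≤.refl))))))
      where
      open import Relation.Binary.Reasoning.Setoid setoid
      x = c - f c * 1/L

-- The largest root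

module PolynomialHomomorphism (R S : CommutativeRing 0ℓ 0ℓ)
  (h : CommutativeRing.Carrier R → CommutativeRing.Carrier S) where

  private
    module R = CommutativeRing R
    module S = CommutativeRing S
    module RE = RingExpressions R.rawRing
    module SE = RingExpressions S.rawRing
  open S using (_≈_)

  module _ (+-homo : ∀ x y → h (x R.+ y) ≈ h x S.+ h y) (*-homo : ∀ x y → h (x R.* y) ≈ h x S.* h y)
           (neg-homo : ∀ x → h (R.- x) ≈ S.- h x) (0-homo : h R.0# ≈ S.0#) (1-homo : h R.1# ≈ S.1#) where

    private
      infixl 6 _+ʰ_ _-ʰ_
      infixl 7 _*ʰ_

      _+ʰ_ : ∀ {x y x′ y′} → h x ≈ x′ → h y ≈ y′ → h (x R.+ y) ≈ x′ S.+ y′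
      p +ʰ q = S.trans (+-homo _ _) (S.+-cong p q)

      _*ʰ_ : ∀ {x y x′ y′} → h x ≈ x′ → h y ≈ y′ → h (x R.* y) ≈ x′ S.* y′
      p *ʰ q = S.trans (*-homo _ _) (S.*-cong p q)

      _-ʰ_ : ∀ {x y x′ y′} → h x ≈ x′ → h y ≈ y′ → h (x RE.- y) ≈ x′ SE.- y′
      p -ʰ q = p +ʰ S.trans (neg-homo _) (S.-‿cong q)

      squareʰ : ∀ {x x′} → h x ≈ x′ → h (x RE.^ 2) ≈ x′ SE.^ 2
      squareʰ p = p *ʰ (p *ʰ 1-homo)

    ι-homo : ∀ n → h (RE.ι n) ≈ SE.ι n
    ι-homo zero    = 0-homo
    ι-homo (suc n) = 1-homo +ʰ ι-homo n

    -- For the identity map this is congruence of the polynomial; for `fromℝ` it relates the real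
    -- polynomial to the complex one.
    polynomial-homo : ∀ m k {x x′} → h x ≈ x′ → h (RE.T₂C-polynomial m k x) ≈ SE.T₂C-polynomial m k x′
    polynomial-homo m k w =
      (squareʰ w -ʰ (M -ʰ ι-homo 2) *ʰ w -ʰ ι-homo 2 *ʰ M +ʰ ι-homo 3)
        *ʰ ((w -ʰ M +ʰ ι-homo 3) *ʰ (w *ʰ (w -ʰ M +ʰ ι-homo 2) -ʰ (ι-homo k -ʰ ι-homo 3) *ʰ (M -ʰ ι-homo 1) +ʰ ι-homo 6)
          +ʰ ι-homo 6 *ʰ (M -ʰ ι-homo 2))
        -ʰ ι-homo 6 *ʰ squareʰ (w +ʰ 1-homo) *ʰ (w -ʰ M +ʰ ι-homo 2)
      where M = ι-homo m

module LargestEigenvalue (ℝ : RealNumbers) (ℓ M : ℕ) where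

  open Spectral ℝ hiding (zero)
  open RingExpressions rawRing using (T₂C-polynomial; _^_)
  open Reals ℝ hiding (ι; _-_)
  open Lipschitz ℝ
  open IntegerRingSolver commutativeRing
  open WindmillVector commutativeRing ℓ M
  open import Relation.Binary.Reasoning.Setoid setoid

  private
    μ N : Carrier
    μ = ι M
    N = ι ℓ

    0≤μ : 0# ≤ μ
    0≤μ = ι-nonneg M

    0≤N : 0# ≤ N
    0≤N = ι-nonneg ℓ

    0≤ι = ι-nonneg

  polynomial : Carrier → Carrier
  polynomial = T₂C-polynomial (2 ℕ.+ M) (9 ℕ.+ ℓ)

  polynomial-cong : ∀ {x y} → x ≈ y → polynomial x ≈ polynomial y
  polynomial-cong = PolynomialHomomorphism.polynomial-homo commutativeRing commutativeRing (λ x → x)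
    (λ _ _ → refl) (λ _ _ → refl) (λ _ → refl) refl refl (2 ℕ.+ M) (9 ℕ.+ ℓ)

  polynomial-lipschitz : ∀ {l u} → IsLipschitz l u polynomial
  polynomial-lipschitz =
    ((((sq lip-id ─ (m ─ c 2) ⊠ lip-id) ─ c 2 ⊠ m) ⊞ c 3)
      ⊠ (((lip-id ─ m) ⊞ c 3) ⊠ (((lip-id ⊠ ((lip-id ─ m) ⊞ c 2)) ─ (k ─ c 3) ⊠ (m ─ c 1)) ⊞ c 6)
        ⊞ c 6 ⊠ (m ─ c 2)))
    ─ c 6 ⊠ sq (lip-id ⊞ lip-const 1#) ⊠ ((lip-id ─ m) ⊞ c 2)
    where
    infixl 6 _⊞_ _─_
    infixl 7 _⊠_
    _⊞_ = lip-+
    _⊠_ = lip-*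
    _─_ : ∀ {l u f g} → IsLipschitz l u f → IsLipschitz l u g → IsLipschitz l u (λ x → f x - g x)
    F ─ G = lip-+ F (lip-neg G)
    sq : ∀ {l u f} → IsLipschitz l u f → IsLipschitz l u (λ x → f x ^ 2)
    sq F = lip-* F (lip-* F (lip-const 1#))
    c : ∀ {l u} n → IsLipschitz l u (λ _ → ι n)
    c n = lip-const (ι n)
    m = λ {l} {u} → lip-const {l} {u} (ι (2 ℕ.+ M))
    k = λ {l} {u} → lip-const {l} {u} (ι (9 ℕ.+ ℓ))

  -- lower = m + 1 is the root itself when m = 2 and k = 9.

  lower : Carrier
  lower = μ + ι 3

  polynomial-lower : polynomial lower ≤ 0#
  polynomial-lower = ≤-from
    (solve 2 (λ M N → # 0 :- Solution.polynomialE 0# (Solution.2+E 0# M) (Solution.9+E 0# N) (M :+ # 3) :=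
      # 24 :* (M :* M) :+ # 156 :* M :+ # 4 :* N :* (M :+ # 1) :* (M :+ # 8)) refl μ N)
    (+-nonneg (+-nonneg (*-nonneg (0≤ι 24) (*-nonneg 0≤μ 0≤μ)) (*-nonneg (0≤ι 156) 0≤μ))
      (*-nonneg (*-nonneg (*-nonneg (0≤ι 4) 0≤N) (+-nonneg 0≤μ (proj₁ 0<1))) (+-nonneg 0≤μ (0≤ι 8))))

  square-≤⇒≤ : ∀ {x y} → 0# ≤ y → x * x ≤ y * y → x ≤ y
  square-≤⇒≤ {x} {y} 0≤y h with x ≤.≤? y
  ... | yes p = p
  ... | no  p = contradiction h (<⇒≱ (<-from
    (solve 2 (λ x y → x :* x :- y :* y := (x :- y) :* (x :- y) :+ # 2 :* y :* (x :- y)) refl x y)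
    (+-pos (*-pos 0<x-y 0<x-y) (*-nonneg (*-nonneg (0≤ι 2) 0≤y) (proj₁ 0<x-y)))))
    where 0<x-y = <⇒0<- (≰⇒> p)

  module Bound where

    -- The bound is A + d with A = m + 4 and B = (k - 3)(m - 1), where `d` is the nonnegative
    -- solution of d² + A d = B. Calculating with `d` turns inequalities about the square root into
    -- sums of nonnegative terms.
    A B discriminant r half d : Carrier
    A = ι (2 ℕ.+ M) + ι 4
    B = (N + ι 6) * (μ + 1#)
    discriminant = A * A + ι 4 * (ι (9 ℕ.+ ℓ) - ι 3) * (ι (2 ℕ.+ M) - ι 1)
    r = √ discriminant
    half = ι 2 ⁻¹
    d = (r - A) * half

    0≤B : 0# ≤ B
    0≤B = *-nonneg (+-nonneg 0≤N (0≤ι 6)) (+-nonneg 0≤μ (proj₁ 0<1))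

    discriminant≈ : discriminant ≈ A * A + ι 4 * B
    discriminant≈ = solve 2 (λ M N → let A = Solution.2+E 0# M :+ # 4 in
      A :* A :+ # 4 :* (Solution.9+E 0# N :- # 3) :* (Solution.2+E 0# M :- (# 1 :+ # 0)) :=
      A :* A :+ # 4 :* ((N :+ # 6) :* (M :+ # 1))) refl μ N

    0≤discriminant : 0# ≤ discriminant
    0≤discriminant = ≤-respʳ (sym discriminant≈) (+-nonneg (square-nonneg A) (*-nonneg (0≤ι 4) 0≤B))

    2*half : ι 2 * half ≈ 1#
    2*half = ⁻¹-inverseʳ (pos⇒≉0 (ι-pos 1))

    0≤d : 0# ≤ d
    0≤d = *-nonneg (≤⇒0≤- (square-≤⇒≤ (√-nonneg 0≤discriminant) (≤-from
      (trans (+-congʳ (trans (√-square 0≤discriminant) discriminant≈))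
        (solve 2 (λ a b → a :+ b :- a := b) refl (A * A) (ι 4 * B)))
      (*-nonneg (0≤ι 4) 0≤B)))) (proj₁ (⁻¹-pos (ι-pos 1)))

    r≈ : r ≈ A + ι 2 * d
    r≈ = begin
      r                               ≈⟨ solve 2 (λ r A → r := A :+ (r :- A) :* # 1) refl r A ⟩
      A + (r - A) * 1#                ≈⟨ +-congˡ (*-congˡ 2*half) ⟨
      A + (r - A) * (ι 2 * half)      ≈⟨ solve 3 (λ r A h → A :+ (r :- A) :* (# 2 :* h) := A :+ # 2 :* ((r :- A) :* h)) refl r A half ⟩
      A + ι 2 * d                     ∎

    bound≈ : A + d ≈ γ-bound (2 ℕ.+ M) (9 ℕ.+ ℓ)
    bound≈ = begin
      A + (r - A) * half              ≈⟨ solve 3 (λ A r h → A :+ (r :- A) :* h := A :* # 1 :+ (r :- A) :* h) refl A r half ⟩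
      A * 1# + (r - A) * half         ≈⟨ +-congʳ (*-congˡ 2*half) ⟨
      A * (ι 2 * half) + (r - A) * half ≈⟨ solve 3 (λ A r h → A :* (# 2 :* h) :+ (r :- A) :* h := (A :+ r) :* h) refl A r half ⟩
      (A + r) * half                  ∎

    quadratic : A * d + d * d - B ≈ 0#
    quadratic = *-zero (begin
      ι 4 * (A * d + d * d - B)                        ≈⟨ solve 3 (λ A d B → # 4 :* (A :* d :+ d :* d :- B) :=
                                                            (A :+ # 2 :* d) :* (A :+ # 2 :* d) :- (A :* A :+ # 4 :* B)) refl A d B ⟩
      (A + ι 2 * d) * (A + ι 2 * d) - (A * A + ι 4 * B) ≈⟨ +-congˡ (-‿cong discriminant≈) ⟨
      (A + ι 2 * d) * (A + ι 2 * d) - discriminant     ≈⟨ +-congʳ (*-cong r≈ r≈) ⟨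
      r * r - discriminant                             ≈⟨ +-congʳ (√-square 0≤discriminant) ⟩
      discriminant - discriminant                      ≈⟨ -‿inverseʳ _ ⟩
      0#                                               ∎) (pos⇒≉0 (ι-pos 3))

    t q D : Carrier
    t = d + ι 7
    q = (μ + ι 5 + d) * (d + ι 7) - ι 3 * μ
    -- At w = A + d one has s = d + 6 and w + 1 = d + M + 7. The inner factor becomes 6 (w + 1) t +
    -- 6 M, and the polynomial becomes 6 (w + 1)(q t - (w + 1) s) + 6 M q. `D` is q t - (w + 1) s,
    -- expanded to display nonnegative coefficients.
    D = μ * (d * d + ι 10 * d + ι 22) + (d * d * d + ι 18 * (d * d) + ι 106 * d + ι 203)

    0≤d² : 0# ≤ d * d
    0≤d² = *-nonneg 0≤d 0≤d

    0≤q : 0# ≤ q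
    0≤q = ≤-respʳ (solve 2 (λ M d → M :* (d :+ # 4) :+ (d :+ # 5) :* (d :+ # 7) :=
                     (M :+ # 5 :+ d) :* (d :+ # 7) :- # 3 :* M) refl μ d)
      (+-nonneg (*-nonneg 0≤μ (+-nonneg 0≤d (0≤ι 4))) (*-nonneg (+-nonneg 0≤d (0≤ι 5)) (+-nonneg 0≤d (0≤ι 7))))

    0<D : 0# < D
    0<D = <-resp refl (+-comm _ _) (+-pos
      (<-resp refl (+-comm _ _) (+-pos (ι-pos 202)
        (+-nonneg (+-nonneg (*-nonneg 0≤d² 0≤d) (*-nonneg (0≤ι 18) 0≤d²)) (*-nonneg (0≤ι 106) 0≤d))))
      (*-nonneg 0≤μ (+-nonneg (+-nonneg 0≤d² (*-nonneg (0≤ι 10) 0≤d)) (0≤ι 22))))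

    -- At A + d the inner factor of the polynomial collapses, because A + d
    -- is a root of x² − A x − B.

    polynomial-bound : 0# < polynomial (A + d)
    polynomial-bound = <-resp refl (begin
      ι 6 * (ι 7 + (μ + d)) * D + ι 6 * μ * q
        ≈⟨ solve 1 (λ z → z := z :+ # 0) refl _ ⟩
      ι 6 * (ι 7 + (μ + d)) * D + ι 6 * μ * q + 0#
        ≈⟨ +-congˡ (trans (*-congˡ quadratic) (zeroʳ (q * t))) ⟨
      ι 6 * (ι 7 + (μ + d)) * D + ι 6 * μ * q + q * t * (A * d + d * d - B)
        ≈⟨ solve 3 (λ M N d → let
             A = Solution.2+E 0# M :+ # 4
             B = (N :+ # 6) :* (M :+ # 1)
             t = d :+ # 7
             q = (M :+ # 5 :+ d) :* (d :+ # 7) :- # 3 :* M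
             D = M :* (d :* d :+ # 10 :* d :+ # 22) :+ (d :* d :* d :+ # 18 :* (d :* d) :+ # 106 :* d :+ # 203)
           in # 6 :* (# 7 :+ (M :+ d)) :* D :+ # 6 :* M :* q :+ q :* t :* (A :* d :+ d :* d :- B) :=
              Solution.polynomialE 0# (Solution.2+E 0# M) (Solution.9+E 0# N) (A :+ d)) refl μ N d ⟩
      polynomial (A + d) ∎)
      (+-pos (*-pos (*-pos (ι-pos 5) (+-pos (ι-pos 6) (+-nonneg 0≤μ 0≤d))) 0<D)
        (*-nonneg (*-nonneg (0≤ι 6) 0≤μ) 0≤q))

    lower≤ : lower ≤ A + d
    lower≤ = ≤-from (solve 2 (λ M d → (Solution.2+E 0# M :+ # 4 :+ d) :- (M :+ # 3) := # 3 :+ d) refl μ d)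
      (+-nonneg (0≤ι 3) 0≤d)

  γ-root : ∃ λ γ → lower ≤ γ × polynomial γ ≈ 0# × γ < γ-bound (2 ℕ.+ M) (9 ℕ.+ ℓ)
  γ-root =
    let (γ , l≤γ , γ≤ , root) = intermediateValue polynomial-lipschitz lower≤ polynomial-lower (proj₁ polynomial-bound)
    in γ , l≤γ , root , <-resp refl bound≈
         (γ≤ , λ e → pos⇒≉0 polynomial-bound (trans (sym (polynomial-cong e)) root))
    where open Bound

  -- After the substitution w = M + 3 + e, the quantities s, w + 1 and q - (w + 1) are polynomials
  -- in M and e with nonnegative coefficients and positive constant term. The strict order of the
  -- hub over the other old vertices is w + 1 < q for the corners and s > 1 for the pendant
  -- vertices.
  module Positivity {w : Carrier} (lower≤w : lower ≤ w) where

    open Solution w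

    private
      e : Carrier
      e = w - lower

      0≤e : 0# ≤ e
      0≤e = ≤⇒0≤- lower≤w

      eE : ∀ {n} → Polynomial n → Polynomial n → Polynomial n
      eE M w = w :- (M :+ # 3)

    0<s : 0# < s
    0<s = <-resp refl (solve 2 (λ M w → # 3 :+ eE M w := sE M w) refl μ w) (+-pos (ι-pos 2) 0≤e)

    0<t : 0# < t
    0<t = +-pos 0<s (proj₁ 0<1)

    0<w+1 : 0# < w + 1#
    0<w+1 = <-resp refl (solve 2 (λ M w → # 4 :+ (M :+ eE M w) := w :+ # 1) refl μ w)
      (+-pos (ι-pos 3) (+-nonneg 0≤μ 0≤e))

    w+1<q : w + 1# < q
    w+1<q = <-from (solve 2 (λ M w → qE M w :- (w :+ # 1) := # 4 :+ (M :* eE M w :+ eE M w :* eE M w :+ # 5 :* eE M w)) refl μ w)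
      (+-pos (ι-pos 3) (+-nonneg (+-nonneg (*-nonneg 0≤μ 0≤e) (*-nonneg 0≤e 0≤e)) (*-nonneg (0≤ι 5) 0≤e)))

    0<q : 0# < q
    0<q = <-≤-trans 0<w+1 (proj₁ w+1<q)

    0<w : 0# < w
    0<w = <-resp refl (solve 2 (λ M w → # 3 :+ (M :+ eE M w) := w) refl μ w) (+-pos (ι-pos 2) (+-nonneg 0≤μ 0≤e))

    0<x : 0# < x
    0<x = *-pos (*-pos 0<q 0<t) 0<s

    0<y : 0# < y
    0<y = *-pos (*-pos 0<w+1 0<t) 0<s

    0<a : 0# < a
    0<a = *-pos (<-resp refl (sym (+-assoc q w 1#)) (+-pos 0<q (proj₁ 0<w+1))) 0<s

    0<b : 0# < b
    0<b = *-pos (*-pos (ι-pos 1) 0<w+1) 0<s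

    0<p : 0# < p
    0<p = *-pos 0<q 0<t

    y<x : y < x
    y<x = <-from (solve 4 (λ q v t s → q :* t :* s :- v :* t :* s := (q :- v) :* t :* s) refl q (w + 1#) t s)
      (*-pos (*-pos (<⇒0<- w+1<q) 0<t) 0<s)

    p<x : p < x
    p<x = <-from (solve 4 (λ q t M w → q :* t :* sE M w :- q :* t := q :* t :* (# 2 :+ eE M w)) refl q t μ w)
      (*-pos 0<p (+-pos (ι-pos 1) 0≤e))

-- Symmetric matrices

module SymmetricMatrices (ℝ : RealNumbers) where

  open Spectral ℝ hiding (zero)
  open Reals ℝ hiding (ι; _-_)
  open Sums commutativeRing
  open IntegerRingSolver commutativeRing
  open import Relation.Binary.Reasoning.Setoid setoid

  form : ∀ {n} → Matrix n → (Fin n → Carrier) → Carrier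
  form A y = sum λ i → y i * sum λ j → A i j * y j

  norm² : ∀ {n} → (Fin n → Carrier) → Carrier
  norm² y = sum λ i → y i * y i

  norm²-pos : ∀ {n} (y : Fin n → Carrier) i → ¬ y i ≈ 0# → 0# < norm² y
  norm²-pos y i yi≉0 = sum-pos (λ i → y i * y i) (λ i → square-nonneg (y i)) i (square-pos yi≉0)

  form-symmetric : ∀ {n} (A : Matrix n) → (∀ i j → A i j ≈ A j i) → ∀ (x y : Fin n → Carrier) →
    sum (λ i → y i * sum λ j → A i j * x j) ≈ sum (λ i → x i * sum λ j → A i j * y j)
  form-symmetric A A-sym x y = begin
    sum (λ i → y i * sum λ j → A i j * x j)    ≈⟨ sum-cong (λ i → *-distribˡ-sum (y i) (λ j → A i j * x j)) ⟩
    sum (λ i → sum λ j → y i * (A i j * x j))  ≈⟨ ∑-comm (λ i j → y i * (A i j * x j)) ⟩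
    sum (λ j → sum λ i → y i * (A i j * x j))  ≈⟨ sum-cong (λ j → sum-cong λ i → trans
                                                    (solve 3 (λ a x y → y :* (a :* x) := x :* (a :* y)) refl (A i j) (x j) (y i))
                                                    (*-congˡ (*-congʳ (A-sym i j)))) ⟩
    sum (λ j → sum λ i → x j * (A j i * y i))  ≈⟨ sum-cong (λ j → *-distribˡ-sum (x j) (λ i → A j i * y i)) ⟨
    sum (λ i → x i * sum λ j → A i j * y j)    ∎

  -- With y = x u, the defect of the Rayleigh quotient of y is half of
  -- ∑ A i j x i x j (u i − u j)².

  module Rayleigh {n} (A : Matrix n) (A-sym : ∀ i j → A i j ≈ A j i) (A-nonneg : ∀ i j → 0# ≤ A i j)
    (x : Fin n → Carrier) (x-pos : ∀ i → 0# < x i) (w : Carrier)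
    (eigen : ∀ i → sum (λ j → A i j * x j) ≈ w * x i) (y : Fin n → Carrier) where

    u : Fin n → Carrier
    u i = y i * x i ⁻¹

    xu≈y : ∀ i → x i * u i ≈ y i
    xu≈y i = begin
      x i * (y i * x i ⁻¹)  ≈⟨ solve 3 (λ x y z → x :* (y :* z) := y :* (x :* z)) refl (x i) (y i) (x i ⁻¹) ⟩
      y i * (x i * x i ⁻¹)  ≈⟨ *-congˡ (⁻¹-inverseʳ (pos⇒≉0 (x-pos i))) ⟩
      y i * 1#              ≈⟨ *-identityʳ (y i) ⟩
      y i                   ∎

    term : Fin n → Fin n → Carrier
    term i j = A i j * (x i * x j) * ((u i - u j) * (u i - u j))

    term-nonneg : ∀ i j → 0# ≤ term i j
    term-nonneg i j = *-nonneg (*-nonneg (A-nonneg i j) (*-nonneg (proj₁ (x-pos i)) (proj₁ (x-pos j))))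
      (square-nonneg (u i - u j))

    diagonal : Carrier
    diagonal = sum λ i → sum λ j → x i * u i * u i * (A i j * x j)

    diagonal≈ : diagonal ≈ w * norm² y
    diagonal≈ = begin
      diagonal
        ≈⟨ sum-cong (λ i → *-distribˡ-sum (x i * u i * u i) (λ j → A i j * x j)) ⟨
      sum (λ i → x i * u i * u i * sum (λ j → A i j * x j))
        ≈⟨ sum-cong (λ i → trans (*-congˡ (eigen i)) (solve 3 (λ w x u → x :* u :* u :* (w :* x) :=
             w :* ((x :* u) :* (x :* u))) refl w (x i) (u i))) ⟩
      sum (λ i → w * ((x i * u i) * (x i * u i)))
        ≈⟨ sum-cong (λ i → *-congˡ (*-cong (xu≈y i) (xu≈y i))) ⟩
      sum (λ i → w * (y i * y i))
        ≈⟨ *-distribˡ-sum w (λ i → y i * y i) ⟨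
      w * norm² y ∎

    codiagonal≈ : sum (λ i → sum λ j → x j * u j * u j * (A i j * x i)) ≈ diagonal
    codiagonal≈ = trans (∑-comm (λ i j → x j * u j * u j * (A i j * x i)))
      (sum-cong λ j → sum-cong λ i → *-congˡ (*-congʳ (A-sym i j)))

    form≈ : form A y ≈ sum (λ i → sum λ j → y i * (A i j * y j))
    form≈ = sum-cong λ i → *-distribˡ-sum (y i) (λ j → A i j * y j)

    defect : Carrier
    defect = w * norm² y - form A y

    sum-term : sum (λ i → sum λ j → term i j) ≈ defect + defect
    sum-term = begin
      sum (λ i → sum λ j → term i j)
        ≈⟨ sum-cong (λ i → sum-cong λ j → expand i j) ⟩
      sum (λ i → sum λ j → (F i j + G i j) + - (Y i j + Y i j))
        ≈⟨ ∑∑-+ (λ i j → F i j + G i j) (λ i j → - (Y i j + Y i j)) ⟩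
      sum (λ i → sum λ j → F i j + G i j) + sum (λ i → sum λ j → - (Y i j + Y i j))
        ≈⟨ +-cong (trans (∑∑-+ F G) (+-cong diagonal≈ (trans codiagonal≈ diagonal≈)))
                  (trans (trans (sum-cong (λ i → sum-neg (λ j → Y i j + Y i j))) (sum-neg (λ i → sum λ j → Y i j + Y i j)))
                    (-‿cong (trans (∑∑-+ Y Y) (+-cong (sym form≈) (sym form≈))))) ⟩
      (w * norm² y + w * norm² y) - (form A y + form A y)
        ≈⟨ solve 2 (λ a b → (a :+ a) :- (b :+ b) := (a :- b) :+ (a :- b)) refl (w * norm² y) (form A y) ⟩
      defect + defect ∎
      where
      F G Y : Fin n → Fin n → Carrier
      F i j = x i * u i * u i * (A i j * x j)
      G i j = x j * u j * u j * (A i j * x i)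
      Y i j = y i * (A i j * y j)

      ∑∑-+ : ∀ (f g : Fin n → Fin n → Carrier) →
        sum (λ i → sum λ j → f i j + g i j) ≈ sum (λ i → sum λ j → f i j) + sum (λ i → sum λ j → g i j)
      ∑∑-+ f g = trans (sum-cong λ i → ∑-distrib-+ (f i) (g i)) (∑-distrib-+ (λ i → sum (f i)) (λ i → sum (g i)))

      expand : ∀ i j → term i j ≈ (F i j + G i j) + - (Y i j + Y i j)
      expand i j = begin
        term i j
          ≈⟨ solve 5 (λ a x z u v → a :* (x :* z) :* ((u :- v) :* (u :- v)) :=
               (x :* u :* u :* (a :* z) :+ z :* v :* v :* (a :* x)) :+
               :- ((x :* u) :* (a :* (z :* v)) :+ (x :* u) :* (a :* (z :* v))))
               refl (A i j) (x i) (x j) (u i) (u j) ⟩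
        (F i j + G i j) + - ((x i * u i) * (A i j * (x j * u j)) + (x i * u i) * (A i j * (x j * u j)))
          ≈⟨ +-congˡ (-‿cong (+-cong xuxu xuxu)) ⟩
        (F i j + G i j) + - (Y i j + Y i j) ∎
        where xuxu = *-cong (xu≈y i) (*-congˡ (xu≈y j))

    half-nonneg : ∀ {z} → 0# ≤ z + z → 0# ≤ z
    half-nonneg {z} h = *-cancelˡ-≤ (ι-pos 1) (≤-respˡ (solve 0 (# 0 := # 2 :* # 0) refl)
      (≤-respʳ (solve 1 (λ z → z :+ z := # 2 :* z) refl z) h))

    rayleigh : form A y ≤ w * norm² y
    rayleigh = 0≤-⇒≤ (half-nonneg (≤-respʳ sum-term
      (sum-nonneg (λ i → sum (term i)) λ i → sum-nonneg (term i) (term-nonneg i))))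

    -- Equality makes each term of a sum of nonnegative terms vanish, so the ratio u of y to x
    -- agrees at any two indices with a positive entry.
    proportional : form A y ≈ w * norm² y → ∀ i j → 0# < A i j → y i * x j ≈ y j * x i
    proportional e i j 0<a = begin
      y i * x j           ≈⟨ *-congʳ (xu≈y i) ⟨
      x i * u i * x j     ≈⟨ *-congʳ (*-congˡ ui≈uj) ⟩
      x i * u j * x j     ≈⟨ solve 3 (λ x u z → x :* u :* z := z :* u :* x) refl (x i) (u j) (x j) ⟩
      x j * u j * x i     ≈⟨ *-congʳ (xu≈y j) ⟩
      y j * x i           ∎
      where
      defect≈0 : defect ≈ 0#
      defect≈0 = trans (+-congˡ (-‿cong e)) (-‿inverseʳ _)

      term≈0 : term i j ≈ 0#
      term≈0 = sum≈0⇒≈0 (term i) (term-nonneg i)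
        (sum≈0⇒≈0 (λ i → sum (term i)) (λ i → sum-nonneg (term i) (term-nonneg i))
          (trans sum-term (trans (+-cong defect≈0 defect≈0) (+-identityˡ 0#))) i) j

      ui≈uj : u i ≈ u j
      ui≈uj = begin
        u i              ≈⟨ solve 2 (λ a b → a := (a :- b) :+ b) refl (u i) (u j) ⟩
        u i - u j + u j  ≈⟨ +-congʳ (square-≈0 (*-zero term≈0
                              (pos⇒≉0 (*-pos 0<a (*-pos (x-pos i) (x-pos j)))))) ⟩
        0# + u j         ≈⟨ +-identityˡ (u j) ⟩
        u j              ∎

  -- The triangle inequality applied to the form at `v`, whose value is w times the squared norm.
  -- The sign of `w` decides whether `v i * (A i j * v j)` or its negative is bounded by the
  -- absolute value.
  abs-form : ∀ {n} (A : Matrix n) → (∀ i j → 0# ≤ A i j) → ∀ w v →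
    (∀ i → sum (λ j → A i j * v j) ≈ w * v i) → ∣ w ∣ * norm² (∣_∣ ∘ v) ≤ form A (∣_∣ ∘ v)
  abs-form {n} A A-nonneg w v eigen = ≤-respˡ (*-congˡ (sum-cong λ i → sym (∣∣-square (v i)))) (bound (∣∣-sign w))
    where
    w-form : w * norm² v ≈ form A v
    w-form = sym (trans (sum-cong λ i → trans (*-congˡ (eigen i))
        (solve 2 (λ w v → v :* (w :* v) := w :* (v :* v)) refl w (v i))) (sym (*-distribˡ-sum w (λ i → v i * v i))))

    pointwise : ∀ (f : Carrier → Carrier) → (∀ z → f z ≤ ∣ z ∣) →
      sum (λ i → sum λ j → f (v i * (A i j * v j))) ≤ form A (∣_∣ ∘ v)
    pointwise f f≤ = ≤-respʳ (sym (sum-cong λ i → *-distribˡ-sum ∣ v i ∣ (λ j → A i j * ∣ v j ∣)))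
      (sum-mono (λ i → sum λ j → f (v i * (A i j * v j))) (λ i → sum λ j → ∣ v i ∣ * (A i j * ∣ v j ∣)) λ i →
        sum-mono (λ j → f (v i * (A i j * v j))) (λ j → ∣ v i ∣ * (A i j * ∣ v j ∣)) λ j →
          ≤-respʳ (trans (∣∣-* (v i) (A i j * v j)) (*-congˡ (trans (∣∣-* (A i j) (v j))
            (*-congʳ (nonneg⇒∣∣ (A-nonneg i j)))))) (f≤ _))

    form≈ : form A v ≈ sum (λ i → sum λ j → v i * (A i j * v j))
    form≈ = sum-cong λ i → *-distribˡ-sum (v i) (λ j → A i j * v j)

    bound : ∣ w ∣ ≈ w ⊎ ∣ w ∣ ≈ - w → ∣ w ∣ * norm² v ≤ form A (∣_∣ ∘ v)
    bound (inj₁ e) = ≤-respˡ (trans (sym form≈) (trans (sym w-form) (*-congʳ (sym e)))) (pointwise (λ z → z) ≤∣∣)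
    bound (inj₂ e) = ≤-respˡ (begin
      sum (λ i → sum λ j → - (v i * (A i j * v j)))
        ≈⟨ trans (sum-cong λ i → sum-neg (λ j → v i * (A i j * v j))) (sum-neg (λ i → sum λ j → v i * (A i j * v j))) ⟩
      - sum (λ i → sum λ j → v i * (A i j * v j))
        ≈⟨ -‿cong (trans (sym form≈) (sym w-form)) ⟩
      - (w * norm² v)
        ≈⟨ solve 2 (λ w z → :- (w :* z) := :- w :* z) refl w (norm² v) ⟩
      - w * norm² v
        ≈⟨ *-congʳ e ⟨
      ∣ w ∣ * norm² v ∎) (pointwise (λ z → - z) -≤∣∣)

  re-sum : ∀ {n} (f : Fin n → ℂ) → re (ℂ-Ops.sum f) ≈ sum (re ∘ f)
  re-sum {zero}  f = refl
  re-sum {suc n} f = +-congˡ (re-sum (f ∘ suc))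

  im-sum : ∀ {n} (f : Fin n → ℂ) → im (ℂ-Ops.sum f) ≈ sum (im ∘ f)
  im-sum {zero}  f = refl
  im-sum {suc n} f = +-congˡ (im-sum (f ∘ suc))

  re-row : ∀ {n} (A : Fin n → Carrier) (x : Fin n → ℂ) →
    re (ℂ-Ops.sum λ j → fromℝ (A j) ℂ-Ops.* x j) ≈ sum λ j → A j * re (x j)
  re-row A x = trans (re-sum (λ j → fromℝ (A j) ℂ-Ops.* x j)) (sum-cong λ j →
    solve 3 (λ a u v → a :* u :- # 0 :* v := a :* u) refl (A j) (re (x j)) (im (x j)))

  im-row : ∀ {n} (A : Fin n → Carrier) (x : Fin n → ℂ) →
    im (ℂ-Ops.sum λ j → fromℝ (A j) ℂ-Ops.* x j) ≈ sum λ j → A j * im (x j)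
  im-row A x = trans (im-sum (λ j → fromℝ (A j) ℂ-Ops.* x j)) (sum-cong λ j →
    solve 3 (λ a u v → a :* v :+ # 0 :* u := a :* v) refl (A j) (re (x j)) (im (x j)))

  -- With z = X + iY and eigenvalue α + iβ, symmetry gives 0 = X·AY - Y·AX = β (|X|² + |Y|²). Once β
  -- = 0, both X and Y satisfy the real equation, and one of them is nonzero.
  eigenvalue-real : ∀ {n} (A : Matrix n) → (∀ i j → A i j ≈ A j i) → ∀ {μ} → IsEigenvalue A μ →
    im μ ≈ 0# × ∃ λ v → (∃ λ i → ¬ v i ≈ 0#) × (∀ i → sum (λ j → A i j * v j) ≈ re μ * v i)
  eigenvalue-real A A-sym {μ} (z , (i , zi≉0) , eigen) = β≈0 , vector
    where
    X Y : _ → Carrier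
    X = re ∘ z
    Y = im ∘ z
    α = re μ
    β = im μ

    AX : ∀ i → sum (λ j → A i j * X j) ≈ α * X i - β * Y i
    AX i = trans (sym (re-row (A i) z)) (proj₁ (eigen i))

    AY : ∀ i → sum (λ j → A i j * Y j) ≈ α * Y i + β * X i
    AY i = trans (sym (im-row (A i) z)) (proj₂ (eigen i))

    S : Carrier
    S = sum λ i → X i * X i + Y i * Y i

    0<S : 0# < S
    0<S with X i ≤.≟ 0#
    ... | no  Xi≉0 = sum-pos (λ i → X i * X i + Y i * Y i) (λ i → +-nonneg (square-nonneg (X i)) (square-nonneg (Y i))) i
          (+-pos (square-pos Xi≉0) (square-nonneg (Y i)))
    ... | yes Xi≈0 with Y i ≤.≟ 0#
    ...   | no  Yi≉0 = sum-pos (λ i → X i * X i + Y i * Y i) (λ i → +-nonneg (square-nonneg (X i)) (square-nonneg (Y i))) i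
            (<-resp refl (+-comm _ _) (+-pos (square-pos Yi≉0) (square-nonneg (X i))))
    ...   | yes Yi≈0 = contradiction (Xi≈0 , Yi≈0) zi≉0

    βS≈0 : S * β ≈ 0#
    βS≈0 = begin
      S * β
        ≈⟨ *-distribʳ-sum β (λ i → X i * X i + Y i * Y i) ⟩
      sum (λ i → (X i * X i + Y i * Y i) * β)
        ≈⟨ sum-cong (λ i → solve 4 (λ a b x y → (x :* x :+ y :* y) :* b :=
             x :* (a :* y :+ b :* x) :+ :- (y :* (a :* x :- b :* y))) refl α β (X i) (Y i)) ⟩
      sum (λ i → X i * (α * Y i + β * X i) + - (Y i * (α * X i - β * Y i)))
        ≈⟨ ∑-distrib-+ (λ i → X i * (α * Y i + β * X i)) (λ i → - (Y i * (α * X i - β * Y i))) ⟩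
      sum (λ i → X i * (α * Y i + β * X i)) + sum (λ i → - (Y i * (α * X i - β * Y i)))
        ≈⟨ +-cong (sum-cong λ i → *-congˡ (sym (AY i)))
             (trans (sum-neg (λ i → Y i * (α * X i - β * Y i))) (-‿cong (sum-cong λ i → *-congˡ (sym (AX i))))) ⟩
      sum (λ i → X i * sum λ j → A i j * Y j) - sum (λ i → Y i * sum λ j → A i j * X j)
        ≈⟨ +-congˡ (-‿cong (form-symmetric A A-sym X Y)) ⟩
      sum (λ i → X i * sum λ j → A i j * Y j) - sum (λ i → X i * sum λ j → A i j * Y j)
        ≈⟨ -‿inverseʳ _ ⟩
      0# ∎

    β≈0 : β ≈ 0#
    β≈0 = *-zero βS≈0 (pos⇒≉0 0<S)

    vector : ∃ λ v → (∃ λ i → ¬ v i ≈ 0#) × (∀ i → sum (λ j → A i j * v j) ≈ α * v i)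
    vector with X i ≤.≟ 0#
    ... | no  Xi≉0 = X , (i , Xi≉0) , λ i → trans (AX i) (trans
          (+-congˡ (-‿cong (trans (*-congʳ β≈0) (zeroˡ (Y i))))) (solve 1 (λ x → x :- # 0 := x) refl (α * X i)))
    ... | yes Xi≈0 with Y i ≤.≟ 0#
    ...   | no  Yi≉0 = Y , (i , Yi≉0) , λ i → trans (AY i) (trans
            (+-congˡ (trans (*-congʳ β≈0) (zeroˡ (X i)))) (+-identityʳ (α * Y i)))
    ...   | yes Yi≈0 = contradiction (Xi≈0 , Yi≈0) zi≉0

  modulus-real : ∀ {z} → im z ≈ 0# → modulus z ≈ ∣ re z ∣
  modulus-real {z} im≈0 = sqrt-unique (√-nonneg 0≤) (∣∣-nonneg (re z)) (begin
    modulus z * modulus z            ≈⟨ √-square 0≤ ⟩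
    re z * re z + im z * im z        ≈⟨ +-congˡ (trans (*-congʳ im≈0) (zeroˡ (im z))) ⟩
    re z * re z + 0#                 ≈⟨ +-identityʳ _ ⟩
    re z * re z                      ≈⟨ ∣∣-square (re z) ⟨
    ∣ re z ∣ * ∣ re z ∣              ∎)
    where
    0≤ : 0# ≤ re z * re z + im z * im z
    0≤ = +-nonneg (square-nonneg (re z)) (square-nonneg (im z))

  -- The complex numbers as an integral domain

  ℂ-commutativeRing : CommutativeRing 0ℓ 0ℓ
  ℂ-commutativeRing = record
    { isCommutativeRing = ℂ-isCommutativeRing }
    where
    open import Algebra.Bundles using (RawRing)
    module ℂR = RawRing ℂ-rawRing
    ℂ-isCommutativeRing : IsCommutativeRing ℂR._≈_ ℂR._+_ ℂR._*_ ℂR.-_ ℂR.0# ℂR.1#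
    ℂ-isCommutativeRing = record
      { isRing = record
        { +-isAbelianGroup = record
          { isGroup = record
            { isMonoid = record
              { isSemigroup = record
                { isMagma = record
                  { isEquivalence = record
                    { refl  = refl , refl
                    ; sym   = λ (p , q) → sym p , sym q
                    ; trans = λ (p , q) (r , s) → trans p r , trans q s
                    }
                  ; ∙-cong = λ (p , q) (r , s) → +-cong p r , +-cong q s
                  }
                ; assoc = λ x y z → +-assoc _ _ _ , +-assoc _ _ _
                }
              ; identity = (λ x → +-identityˡ _ , +-identityˡ _) , (λ x → +-identityʳ _ , +-identityʳ _)
              }
            ; inverse = (λ x → -‿inverseˡ _ , -‿inverseˡ _) , (λ x → -‿inverseʳ _ , -‿inverseʳ _)
            ; ⁻¹-cong = λ (p , q) → -‿cong p , -‿cong q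
            }
          ; comm = λ x y → +-comm _ _ , +-comm _ _
          }
        ; *-cong = λ (p , q) (r , s) →
            +-cong (*-cong p r) (-‿cong (*-cong q s)) , +-cong (*-cong p s) (*-cong q r)
        ; *-assoc = λ (a +i b) (c +i d) (e +i f) →
            solve 6 (λ a b c d e f → (a :* c :- b :* d) :* e :- (a :* d :+ b :* c) :* f :=
              a :* (c :* e :- d :* f) :- b :* (c :* f :+ d :* e)) refl a b c d e f ,
            solve 6 (λ a b c d e f → (a :* c :- b :* d) :* f :+ (a :* d :+ b :* c) :* e :=
              a :* (c :* f :+ d :* e) :+ b :* (c :* e :- d :* f)) refl a b c d e f
        ; *-identity =
            (λ (a +i b) → solve 2 (λ a b → # 1 :* a :- # 0 :* b := a) refl a b ,
                          solve 2 (λ a b → # 1 :* b :+ # 0 :* a := b) refl a b) ,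
            (λ (a +i b) → solve 2 (λ a b → a :* # 1 :- b :* # 0 := a) refl a b ,
                          solve 2 (λ a b → a :* # 0 :+ b :* # 1 := b) refl a b)
        ; distrib =
            (λ (a +i b) (c +i d) (e +i f) →
              solve 6 (λ a b c d e f → a :* (c :+ e) :- b :* (d :+ f) := (a :* c :- b :* d) :+ (a :* e :- b :* f)) refl a b c d e f ,
              solve 6 (λ a b c d e f → a :* (d :+ f) :+ b :* (c :+ e) := (a :* d :+ b :* c) :+ (a :* f :+ b :* e)) refl a b c d e f) ,
            (λ (a +i b) (c +i d) (e +i f) →
              solve 6 (λ a b c d e f → (c :+ e) :* a :- (d :+ f) :* b := (c :* a :- d :* b) :+ (e :* a :- f :* b)) refl a b c d e f ,
              solve 6 (λ a b c d e f → (c :+ e) :* b :+ (d :+ f) :* a := (c :* b :+ d :* a) :+ (e :* b :+ f :* a)) refl a b c d e f)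
        }
      ; *-comm = λ (a +i b) (c +i d) →
          solve 4 (λ a b c d → a :* c :- b :* d := c :* a :- d :* b) refl a b c d ,
          solve 4 (λ a b c d → a :* d :+ b :* c := c :* b :+ d :* a) refl a b c d
      }

  -- Multiplication by the conjugate of the nonzero factor leaves its squared modulus times the
  -- coordinates of the other.
  ℂ-no-zero-divisors : ∀ {z w : ℂ} → (z ℂ-Ops.* w) ℂ-Ops.≈ ℂ-Ops.0# → ¬ z ℂ-Ops.≈ ℂ-Ops.0# → w ℂ-Ops.≈ ℂ-Ops.0#
  ℂ-no-zero-divisors {a +i b} {c +i d} (p , q) z≉0 =
    *-zero (trans (solve 4 (λ a b c d → (a :* a :+ b :* b) :* c :=
        a :* (a :* c :- b :* d) :+ b :* (a :* d :+ b :* c)) refl a b c d) (vanish p q)) N≉0 ,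
    *-zero (trans (solve 4 (λ a b c d → (a :* a :+ b :* b) :* d :=
        a :* (a :* d :+ b :* c) :+ :- b :* (a :* c :- b :* d)) refl a b c d) (vanish q p)) N≉0
    where
    vanish : ∀ {e f x y} → x ≈ 0# → y ≈ 0# → e * x + f * y ≈ 0#
    vanish {e} {f} x≈0 y≈0 = trans (+-cong (trans (*-congˡ x≈0) (zeroʳ e)) (trans (*-congˡ y≈0) (zeroʳ f))) (+-identityʳ 0#)

    N≉0 : ¬ a * a + b * b ≈ 0#
    N≉0 e with a ≤.≟ 0# | b ≤.≟ 0#
    ... | yes a≈0 | yes b≈0 = z≉0 (a≈0 , b≈0)
    ... | no  a≉0 | _       = pos⇒≉0 (+-pos (square-pos a≉0) (square-nonneg b)) e
    ... | yes _   | no  b≉0 = pos⇒≉0 (<-resp refl (+-comm _ _) (+-pos (square-pos b≉0) (square-nonneg a))) e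

-- Comparison with the windmill

module Adjacency (ℝ : RealNumbers) where

  open Spectral ℝ hiding (zero)
  open Reals ℝ hiding (ι; _-_)
  open Sums commutativeRing
  open SymmetricMatrices ℝ
  open IntegerRingSolver commutativeRing
  open import Relation.Binary.Reasoning.Setoid setoid

  -- The 0/1 matrix. Its eigenvalues are m - 1 times those of `adjacencyMatrix`, and `γ` is its
  -- spectral radius for T.
  adjacency : (H : Hypergraph) → Matrix (order H)
  adjacency H i j = [ does (adjacent? H i j) ] 1#

  adjacency-* : ∀ H i j x → adjacency H i j * x ≈ [ does (adjacent? H i j) ] x
  adjacency-* H i j x = trans ([]-* (does (adjacent? H i j)) 1# x)
    ([]-cong (does (adjacent? H i j)) (*-identityˡ x))

  Adjacent-sym : ∀ {H i j} → Adjacent H i j → Adjacent H j i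
  Adjacent-sym (i≢j , e , i∈e , j∈e) = i≢j ∘ ≡.sym , e , j∈e , i∈e

  adjacent?-sym : ∀ H i j → does (adjacent? H i j) ≡ does (adjacent? H j i)
  adjacent?-sym H i j = does-⇔ (mk⇔ (Adjacent-sym {H}) (Adjacent-sym {H})) (adjacent? H i j) (adjacent? H j i)

  adjacency-sym : ∀ H i j → adjacency H i j ≈ adjacency H j i
  adjacency-sym H i j = reflexive (≡.cong (λ b → [ b ] 1#) (adjacent?-sym H i j))

  adjacency-nonneg : ∀ H i j → 0# ≤ adjacency H i j
  adjacency-nonneg H i j with does (adjacent? H i j)
  ... | true  = proj₁ 0<1
  ... | false = ≤.refl

  adjacency-pos : ∀ H {i j} → Adjacent H i j → 0# < adjacency H i j
  adjacency-pos H {i} {j} adj rewrite dec-true (adjacent? H i j) adj = 0<1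

  form-pairSum : ∀ {n k M} {Γ : Graph n k} {H} (P : Presentation M Γ H) (y : Vertex H → Carrier) →
    form (adjacency H) y ≈ sum (pairSum Γ (y ∘ ↔.to (Presentation.vertices P)))
  form-pairSum {H = H} P y = trans
    (sum-cong λ i → *-congˡ (sum-cong λ j → adjacency-* H i j (y j))) (quadraticForm P y)

  module _ {d : ℕ} (H : Hypergraph) where

    private
      A : Matrix (order H)
      A = adjacencyMatrix (2 ℕ.+ d) H

      c : Carrier
      c = ι (suc d)

      c*c⁻¹ : c * c ⁻¹ ≈ 1#
      c*c⁻¹ = ⁻¹-inverseʳ (pos⇒≉0 (ι-pos d))

    adjacencyMatrix-sym : ∀ i j → A i j ≈ A j i
    adjacencyMatrix-sym i j = reflexive (≡.cong (λ b → [ b ] (c ⁻¹)) (adjacent?-sym H i j))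

    adjacencyMatrix-row : ∀ (v : Vertex H → Carrier) i → sum (λ j → A i j * v j) ≈ c ⁻¹ * sum (λ j → adjacency H i j * v j)
    adjacencyMatrix-row v i = trans
      (sum-cong λ j → trans (*-congʳ (scale (does (adjacent? H i j)))) (*-assoc (c ⁻¹) _ (v j)))
      (sym (*-distribˡ-sum (c ⁻¹) (λ j → adjacency H i j * v j)))
      where
      scale : ∀ b → [ b ] (c ⁻¹) ≈ c ⁻¹ * ([ b ] 1#)
      scale true  = sym (*-identityʳ (c ⁻¹))
      scale false = sym (zeroʳ (c ⁻¹))

    eigenvector⇒A : ∀ {w} {v : Vertex H → Carrier} → (∀ i → sum (λ j → adjacency H i j * v j) ≈ w * v i) →
                    ∀ i → sum (λ j → A i j * v j) ≈ w / c * v i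
    eigenvector⇒A {w} {v} eigen i = trans (adjacencyMatrix-row v i) (trans (*-congˡ (eigen i))
      (solve 3 (λ k w v → k :* (w :* v) := w :* k :* v) refl (c ⁻¹) w (v i)))

    A⇒eigenvector : ∀ {w} {v : Vertex H → Carrier} → (∀ i → sum (λ j → A i j * v j) ≈ w * v i) →
                    ∀ i → sum (λ j → adjacency H i j * v j) ≈ c * w * v i
    A⇒eigenvector {w} {v} eigen i = begin
      s                    ≈⟨ *-identityˡ s ⟨
      1# * s               ≈⟨ *-congʳ c*c⁻¹ ⟨
      c * c ⁻¹ * s         ≈⟨ *-assoc c (c ⁻¹) s ⟩
      c * (c ⁻¹ * s)       ≈⟨ *-congˡ (adjacencyMatrix-row v i) ⟨
      c * sum (λ j → A i j * v j) ≈⟨ *-congˡ (eigen i) ⟩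
      c * (w * v i)        ≈⟨ *-assoc c w (v i) ⟨
      c * w * v i          ∎
      where s = sum (λ j → adjacency H i j * v j)

module Extremal (ℝ : RealNumbers) (ℓ M : ℕ) (T : Hypergraph) (Q : Presentation M (windmill ℓ) T) where

  open Spectral ℝ hiding (zero)
  open LargestEigenvalue ℝ ℓ M
  open Reals ℝ hiding (ι; _-_)
  open Sums commutativeRing
  open SymmetricMatrices ℝ
  open Adjacency ℝ
  open IntegerRingSolver commutativeRing
  open WindmillVector commutativeRing ℓ M using (module Solution)
  open import Relation.Binary.Reasoning.Setoid setoid

  private
    W = windmill ℓ
    module Q = Presentation Q
    Points = Point (7 ℕ.+ ℓ) (9 ℕ.+ ℓ) M

  γ : Carrier
  γ = proj₁ γ-root

  lower≤γ : lower ≤ γ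
  lower≤γ = proj₁ (proj₂ γ-root)

  γ-isRoot : polynomial γ ≈ 0#
  γ-isRoot = proj₁ (proj₂ (proj₂ γ-root))

  γ<bound : γ < γ-bound (2 ℕ.+ M) (9 ℕ.+ ℓ)
  γ<bound = proj₂ (proj₂ (proj₂ γ-root))

  module Pγ = Positivity lower≤γ
  module Sγ = Solution γ

  value : Points → Carrier
  value = Sγ.value γ-isRoot

  value-pos : ∀ u → 0# < value u
  value-pos = Sγ.value-elim γ-isRoot (0# <_) Pγ.0<x Pγ.0<y Pγ.0<a Pγ.0<b Pγ.0<p

  value<hub : ∀ j → value (inj₁ (suc j)) < value (inj₁ zero)
  value<hub = Sγ.spokewise-elim γ-isRoot (_< Sγ.x) Pγ.y<x Pγ.p<x

  perron : Vertex T → Carrier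
  perron = value ∘ Q.point

  solution-eigenvector : ∀ {w} (root : polynomial w ≈ 0#) i →
    sum (λ j → adjacency T i j * Solution.value w root (Q.point j)) ≈ w * Solution.value w root (Q.point i)
  solution-eigenvector {w} root i = trans (sum-cong λ j → adjacency-* T i j (Solution.value w root (Q.point j)))
    (Solution.solution w root Q i)

  module T-Rayleigh (y : Vertex T → Carrier) = Rayleigh (adjacency T) (adjacency-sym T) (adjacency-nonneg T)
    perron (value-pos ∘ Q.point) γ (solution-eigenvector γ-isRoot) y

  proportional : ∀ {y} → form (adjacency T) y ≈ γ * norm² y →
    ∀ p q e → p ≢ q → On W p e → On W q e → y (↔.to Q.vertices p) * value q ≈ y (↔.to Q.vertices q) * value p
  proportional {y} eq p q e p≢q pe qe = begin
    y (↔.to Q.vertices p) * value q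
      ≡⟨ ≡.cong (λ q → y (↔.to Q.vertices p) * value q) (↔.strictlyInverseʳ Q.vertices q) ⟨
    y (↔.to Q.vertices p) * perron (↔.to Q.vertices q)
      ≈⟨ T-Rayleigh.proportional y eq (↔.to Q.vertices p) (↔.to Q.vertices q) (adjacency-pos T
           (p≢q ∘ ↔-injective Q.vertices , ↔.to Q.edges e , from (Q.incidence p e) pe , from (Q.incidence q e) qe)) ⟩
    y (↔.to Q.vertices q) * perron (↔.to Q.vertices p)
      ≡⟨ ≡.cong (λ p → y (↔.to Q.vertices q) * value p) (↔.strictlyInverseʳ Q.vertices p) ⟩
    y (↔.to Q.vertices q) * value p ∎

  Eigen : (H : Hypergraph) → Carrier → (Vertex H → Carrier) → Set
  Eigen H w v = ∀ i → sum (λ j → adjacency H i j * v j) ≈ w * v i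

  ∣∣≉0 : ∀ {x} → ¬ x ≈ 0# → ¬ ∣ x ∣ ≈ 0#
  ∣∣≉0 {x} x≉0 e = x≉0 (square-≈0 (trans (sym (∣∣-square x)) (trans (*-congʳ e) (zeroˡ ∣ x ∣))))

  -- Comparison of H with T, where the graph of H arises from the windmill by
  -- moving edges away from the hub, at which the eigenvector is largest.

  module Comparison {H : Hypergraph} {Δ : Graph (7 ℕ.+ ℓ) (9 ℕ.+ ℓ)} {par : Fin (6 ℕ.+ ℓ) → Fin (7 ℕ.+ ℓ)}
    (P : Presentation M Δ H) (src≡ : ∀ e → Graph.src Δ e ≡ windmillSrc e)
    (tgt≡ : ∀ e → Graph.tgt Δ e ≡ windmillTgt par e)
    {w : Carrier} {v : Vertex H → Carrier} (eigen : Eigen H w v) (v≉0 : ∃ λ i → ¬ v i ≈ 0#)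
    (largest : ∀ x → ∣ v (Presentation.base P x) ∣ ≤ ∣ v (Presentation.base P zero) ∣) where

    private module P = Presentation P

    g : Points → Carrier
    g u = ∣ v (↔.to P.vertices u) ∣

    -- H and T have the same points, so |v| transfers to T with its norm unchanged, and the two
    -- forms differ only in the ends of edges.
    y : Vertex T → Carrier
    y = g ∘ Q.point

    y∘to : ∀ u → y (↔.to Q.vertices u) ≈ g u
    y∘to u = reflexive (≡.cong g (↔.strictlyInverseʳ Q.vertices u))

    norm≈ : norm² (∣_∣ ∘ v) ≈ norm² y
    norm≈ = begin
      norm² (∣_∣ ∘ v)             ≈⟨ sum-vertices P.vertices (λ i → ∣ v i ∣ * ∣ v i ∣) ⟩
      sumPoints (λ u → g u * g u) ≈⟨ +-cong (sum-cong λ x → sq (inj₁ x)) (sum-cong λ e → sum-cong λ r → sq (inj₂ (e , r))) ⟩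
      sumPoints (λ u → y (↔.to Q.vertices u) * y (↔.to Q.vertices u))
                                  ≈⟨ sum-vertices Q.vertices (λ i → y i * y i) ⟨
      norm² y                     ∎
      where
      sq : ∀ u → g u * g u ≈ y (↔.to Q.vertices u) * y (↔.to Q.vertices u)
      sq u = sym (*-cong (y∘to u) (y∘to u))

    new : Fin (9 ℕ.+ ℓ) → Carrier
    new e = sum λ r → g (inj₂ (e , r))

    -- Half the change of the edge term when the target moves to the hub. The square of the target's
    -- value cancels in `pairSum`, which leaves the change of that value times the sum over the
    -- other points of the edge. On a blade nothing moves and the gain is 0.
    gain : Fin (9 ℕ.+ ℓ) → Carrier
    gain e = (g (inj₁ (windmillSrc e)) + new e) *
             (g (inj₁ (windmillTgt hub e)) - g (inj₁ (windmillTgt par e)))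

    pairSum-gain : ∀ e → pairSum W g e - pairSum Δ g e ≈ ι 2 * gain e
    pairSum-gain e rewrite src≡ e | tgt≡ e = solve 5 (λ a b b′ C S →
      ((a :+ b′ :+ C) :* (a :+ b′ :+ C) :- (a :* a :+ b′ :* b′ :+ S)) :-
      ((a :+ b :+ C) :* (a :+ b :+ C) :- (a :* a :+ b :* b :+ S)) := # 2 :* ((a :+ C) :* (b′ :- b))) refl
      (g (inj₁ (windmillSrc e))) (g (inj₁ (windmillTgt par e))) (g (inj₁ (windmillTgt hub e))) (new e)
      (sum λ r → g (inj₂ (e , r)) * g (inj₂ (e , r)))

    towards-hub : ∀ e → g (inj₁ (windmillTgt par e)) ≤ g (inj₁ (windmillTgt hub e))
    towards-hub e with kind e
    ... | inj₁ j = largest (par j)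
    ... | inj₂ i = ≤.refl

    gain-nonneg : ∀ e → 0# ≤ gain e
    gain-nonneg e = *-nonneg (+-nonneg (∣∣-nonneg _) (sum-nonneg (λ r → g (inj₂ (e , r))) λ r → ∣∣-nonneg _))
      (≤⇒0≤- (towards-hub e))

    pairSum-mono : ∀ e → pairSum Δ g e ≤ pairSum W g e
    pairSum-mono e = ≤-from (pairSum-gain e) (*-nonneg (ι-nonneg 2) (gain-nonneg e))

    formH : form (adjacency H) (∣_∣ ∘ v) ≈ sum (pairSum Δ g)
    formH = form-pairSum P (∣_∣ ∘ v)

    formT : form (adjacency T) y ≈ sum (pairSum W g)
    formT = trans (form-pairSum Q y) (sum-cong λ e → +-cong (*-cong (at y∘to e) (at y∘to e))
      (-‿cong (at (λ u → *-cong (y∘to u) (y∘to u)) e)))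
      where
      at : ∀ {f h : Points → Carrier} → (∀ u → f u ≈ h u) → ∀ e → edgeSum W f e ≈ edgeSum W h e
      at = edgeSum-cong W

    H≤sum : ∣ w ∣ * norm² y ≤ sum (pairSum Δ g)
    H≤sum = ≤-respˡ (*-congˡ norm≈) (≤-respʳ formH (abs-form (adjacency H) (adjacency-nonneg H) w v eigen))

    sum≤T : sum (pairSum W g) ≤ γ * norm² y
    sum≤T = ≤-respˡ formT (T-Rayleigh.rayleigh y)

    sum≤sum : sum (pairSum Δ g) ≤ sum (pairSum W g)
    sum≤sum = sum-mono (pairSum Δ g) (pairSum W g) pairSum-mono

    0<norm : 0# < norm² y
    0<norm = <-resp refl norm≈ (norm²-pos (∣_∣ ∘ v) (proj₁ v≉0) (∣∣≉0 (proj₂ v≉0)))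

    ∣w∣≤γ : ∣ w ∣ ≤ γ
    ∣w∣≤γ = *-cancelˡ-≤ 0<norm (≤-respˡ (*-comm _ _) (≤-respʳ (*-comm _ _)
      (≤.trans H≤sum (≤.trans sum≤sum sum≤T))))

    module Equality (∣w∣≈γ : ∣ w ∣ ≈ γ) where

      T≤H : γ * norm² y ≤ sum (pairSum Δ g)
      T≤H = ≤-respˡ (*-congʳ ∣w∣≈γ) H≤sum

      tight : ∀ p q e → p ≢ q → On W p e → On W q e → g p * value q ≈ g q * value p
      tight p q e p≢q pe qe = trans (*-congʳ (sym (y∘to p))) (trans
        (proportional (≤.antisym (T-Rayleigh.rayleigh y) (≤.trans T≤H (≤-respʳ (sym formT) sum≤sum))) p q e p≢q pe qe)
        (*-congʳ (y∘to q)))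

      spoke-tight : ∀ j → g (inj₁ zero) * value (inj₁ (suc j)) ≈ g (inj₁ (suc j)) * value (inj₁ zero)
      spoke-tight j = tight (inj₁ zero) (inj₁ (suc j)) (unkind (inj₁ j)) (λ ())
        (inj₂ (≡.sym (≡.cong [ hub , right ]′ (↔.strictlyInverseˡ kinds (inj₁ j)))))
        (inj₁ (≡.sym (≡.cong [ suc , left ]′ (↔.strictlyInverseˡ kinds (inj₁ j)))))

      -- If |v| were 0 at the hub, it would vanish at all old vertices by maximality, and at the new
      -- vertices by proportionality along their edges in T.
      hub-pos : 0# < g (inj₁ zero)
      hub-pos = nonneg∧≉0⇒pos (∣∣-nonneg _) λ g0≈0 → ∣∣≉0 (proj₂ v≉0) (begin
        ∣ v i ∣                        ≡⟨ ≡.cong (λ i → ∣ v i ∣) (↔.strictlyInverseˡ P.vertices i) ⟨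
        g (P.point i)                  ≈⟨ all-zero g0≈0 (P.point i) ⟩
        0#                             ∎)
        where
        i = proj₁ v≉0

        all-zero : g (inj₁ zero) ≈ 0# → ∀ u → g u ≈ 0#
        all-zero g0≈0 (inj₁ x)       = ≤.antisym (≤-respʳ g0≈0 (largest x)) (∣∣-nonneg _)
        all-zero g0≈0 (inj₂ (e , r)) = *-zero (begin
          value (inj₁ (windmillSrc e)) * g (inj₂ (e , r))  ≈⟨ *-comm _ _ ⟩
          g (inj₂ (e , r)) * value (inj₁ (windmillSrc e))  ≈⟨ tight (inj₁ (windmillSrc e)) (inj₂ (e , r)) e (λ ()) (inj₁ ≡.refl) ≡.refl ⟨
          g (inj₁ (windmillSrc e)) * value (inj₂ (e , r))  ≈⟨ *-congʳ (all-zero g0≈0 (inj₁ (windmillSrc e))) ⟩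
          0# * value (inj₂ (e , r))                        ≈⟨ zeroˡ _ ⟩
          0#                                               ∎) (pos⇒≉0 (value-pos (inj₁ (windmillSrc e))))

      spoke-pos : ∀ j → 0# < g (inj₁ (suc j))
      spoke-pos j = nonneg∧≉0⇒pos (∣∣-nonneg _) λ gj≈0 → pos⇒≉0
        (*-pos hub-pos (value-pos (inj₁ (suc j)))) (trans (spoke-tight j) (trans (*-congʳ gj≈0) (zeroˡ _)))

      gain≈0 : ∀ e → gain e ≈ 0#
      gain≈0 e = *-zero (trans (sym (pairSum-gain e)) (trans (+-congˡ (-‿cong
        (sum-≈⇒≈ (pairSum Δ g) (pairSum W g) pairSum-mono (≤.trans sum≤T T≤H) e))) (-‿inverseʳ _)))
        (pos⇒≉0 (ι-pos 1))

      -- The gain of the spoke is 0 and its first factor is positive, so |v| takes the same value at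
      -- `par j` and at the hub. But |v| is proportional to the Perron vector along spokes, and that
      -- vector is strictly larger at the hub than at any other old vertex.
      par≡hub : ∀ j → par j ≡ zero
      par≡hub j = at-hub (par j) (begin
        g (inj₁ zero)                                   ≈⟨ solve 2 (λ a b → a := (a :- b) :+ b) refl (g (inj₁ zero)) (g (inj₁ (par j))) ⟩
        g (inj₁ zero) - g (inj₁ (par j)) + g (inj₁ (par j))
                                                        ≈⟨ +-congʳ (*-zero gain-spoke (pos⇒≉0 (+-pos (spoke-pos j)
                                                             (sum-nonneg (λ r → g (inj₂ (e , r))) λ r → ∣∣-nonneg _)))) ⟩
        0# + g (inj₁ (par j))                           ≈⟨ +-identityˡ _ ⟩
        g (inj₁ (par j))                                ∎)
        where
        e = unkind (inj₁ j)

        gain-spoke : (g (inj₁ (suc j)) + new e) * (g (inj₁ zero) - g (inj₁ (par j))) ≈ 0#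
        gain-spoke = ≡.subst (λ κ → (g (inj₁ ([ suc , left ]′ κ)) + new e) *
            (g (inj₁ ([ hub , right ]′ κ)) - g (inj₁ ([ par , right ]′ κ))) ≈ 0#)
          (↔.strictlyInverseˡ kinds (inj₁ j)) (gain≈0 e)

        at-hub : ∀ x → g (inj₁ zero) ≈ g (inj₁ x) → x ≡ zero
        at-hub zero    _  = ≡.refl
        at-hub (suc j) eq = contradiction (*-cancelˡ (pos⇒≉0 hub-pos)
          (trans (spoke-tight j) (*-congʳ (sym eq)))) (proj₂ (value<hub j))

      isomorphic : H ≅ T
      isomorphic = presentations⇒≅ P Q λ x e → mk⇔
        (Sum.map (λ p → ≡.trans p (src≡ e)) (λ p → ≡.trans p (tgt≡hub e)))
        (Sum.map (λ p → ≡.trans p (≡.sym (src≡ e))) (λ p → ≡.trans p (≡.sym (tgt≡hub e))))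
        where
        tgt≡hub : ∀ e → Graph.tgt Δ e ≡ windmillTgt hub e
        tgt≡hub e = ≡.trans (tgt≡ e) (same (kind e))
          where
          same : ∀ κ → [ par , right ]′ κ ≡ [ hub , right ]′ κ
          same (inj₁ j) = par≡hub j
          same (inj₂ i) = ≡.refl

  private
    μ : Carrier
    μ = ι M

    0≤μ : 0# ≤ μ
    0≤μ = ι-nonneg M

    0≤γ : 0# ≤ γ
    0≤γ = proj₁ Pγ.0<w

  eigenvalue-bound : ∀ {w v} → Eigen T w v → (∃ λ i → ¬ v i ≈ 0#) → ∣ w ∣ ≤ γ
  eigenvalue-bound {w} {v} eigen (i , vi≉0) =
    *-cancelˡ-≤ (norm²-pos (∣_∣ ∘ v) i (∣∣≉0 vi≉0)) (≤-respˡ (*-comm _ _) (≤-respʳ (*-comm _ _)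
      (≤.trans (abs-form (adjacency T) (adjacency-nonneg T) w v eigen) (T-Rayleigh.rayleigh (∣_∣ ∘ v)))))

  at-point : ∀ {w} (root : polynomial w ≈ 0#) u →
    Solution.value w root (Q.point (↔.to Q.vertices u)) ≈ Solution.value w root u
  at-point {w} root u = reflexive (≡.cong (Solution.value w root) (↔.strictlyInverseʳ Q.vertices u))

  -- A nonzero hub coordinate makes the vector built from the root a genuine eigenvector.
  root-bound : ∀ {w} → polynomial w ≈ 0# → ¬ Solution.x w ≈ 0# → ∣ w ∣ ≤ γ
  root-bound {w} root x≉0 = eigenvalue-bound {w} (solution-eigenvector root)
    (↔.to Q.vertices (inj₁ zero) , λ e → x≉0 (trans (sym (at-point root (inj₁ zero))) e))

  -- The counterpart of `Positivity` for w = -(M + 3 + e): `s` and `t` are now negative, but their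
  -- product and `q` are positive.
  module Negative {w : Carrier} (lower≤-w : lower ≤ - w) where

    open Solution w

    private
      e : Carrier
      e = - w - lower

      0≤e : 0# ≤ e
      0≤e = ≤⇒0≤- lower≤-w

      eE : ∀ {n} → Polynomial n → Polynomial n → Polynomial n
      eE M w = :- w :- (M :+ # 3)

    0<ts : 0# < t * s
    0<ts = <-resp refl (solve 2 (λ M w → (# 2 :+ (# 2 :* M :+ eE M w)) :* (# 3 :+ (# 2 :* M :+ eE M w)) := tE M w :* sE M w) refl μ w)
      (*-pos (+-pos (ι-pos 1) 0≤2μ+e) (+-pos (ι-pos 2) 0≤2μ+e))
      where
      0≤2μ+e : 0# ≤ ι 2 * μ + e
      0≤2μ+e = +-nonneg (*-nonneg (ι-nonneg 2) 0≤μ) 0≤e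

    0<q : 0# < q
    0<q = <-resp refl (solve 2 (λ M w → # 8 :+ (# 2 :* (M :* M) :+ # 7 :* M :+ # 3 :* (M :* eE M w) :+ eE M w :* eE M w :+ # 6 :* eE M w) := qE M w) refl μ w)
      (+-pos (ι-pos 7) (+-nonneg (+-nonneg (+-nonneg (+-nonneg (*-nonneg (ι-nonneg 2) (*-nonneg 0≤μ 0≤μ))
        (*-nonneg (ι-nonneg 7) 0≤μ)) (*-nonneg (ι-nonneg 3) (*-nonneg 0≤μ 0≤e))) (*-nonneg 0≤e 0≤e)) (*-nonneg (ι-nonneg 6) 0≤e)))

    0<x : 0# < x
    0<x = <-resp refl (sym (*-assoc q t s)) (*-pos 0<q 0<ts)

    ∣y∣ : ∣ y ∣ ≈ (- w - 1#) * (t * s)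
    ∣y∣ = trans (sym (∣∣-neg y)) (trans (nonneg⇒∣∣ (≤-respʳ
      (solve 3 (λ w t s → (:- w :- # 1) :* (t :* s) := :- ((w :+ # 1) :* t :* s)) refl w t s)
      (*-nonneg (≤-respʳ (solve 2 (λ M w → # 2 :+ (M :+ eE M w) := :- w :- # 1) refl μ w)
        (+-nonneg (ι-nonneg 2) (+-nonneg 0≤μ 0≤e))) (proj₁ 0<ts))))
      (solve 3 (λ w t s → :- ((w :+ # 1) :* t :* s) := (:- w :- # 1) :* (t :* s)) refl w t s))

  -- If −γ were a root, the moduli of its eigenvector would be proportional to
  -- those of the Perron vector; but their ratios at the hub and at a corner differ.

  -γ-not-root : ¬ polynomial (- γ) ≈ 0#
  -γ-not-root root = contradiction ratios≈ (λ e → pos⇒≉0 0<difference (trans (+-congʳ e) (-‿inverseʳ _)))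
    where
    lower≤--γ : lower ≤ - - γ
    lower≤--γ = ≤-respʳ (solve 1 (λ g → g := :- :- g) refl γ) lower≤γ

    module N = Negative lower≤--γ
    module S = Solution (- γ)

    z : Vertex T → Carrier
    z = ∣_∣ ∘ S.value root ∘ Q.point

    z-form : form (adjacency T) z ≈ γ * norm² z
    z-form = ≤.antisym (T-Rayleigh.rayleigh z)
      (≤-respˡ (*-congʳ (trans (∣∣-neg γ) (nonneg⇒∣∣ 0≤γ)))
        (abs-form (adjacency T) (adjacency-nonneg T) (- γ) (S.value root ∘ Q.point) (solution-eigenvector root)))

    ratios : ∣ S.x ∣ * Sγ.y ≈ ∣ S.y ∣ * Sγ.x
    ratios = begin
      ∣ S.x ∣ * Sγ.y                              ≈⟨ *-congʳ (∣∣-cong (at-point root (inj₁ 0F))) ⟨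
      z (↔.to Q.vertices (inj₁ 0F)) * Sγ.y        ≈⟨ proportional {z} z-form (inj₁ 0F) (inj₁ 1F) 0F (λ ()) (inj₂ ≡.refl) (inj₁ ≡.refl) ⟩
      z (↔.to Q.vertices (inj₁ 1F)) * Sγ.x        ≈⟨ *-congʳ (∣∣-cong (at-point root (inj₁ 1F))) ⟩
      ∣ S.y ∣ * Sγ.x                              ∎

    ratios≈ : S.q * (S.t * S.s) * Sγ.y ≈ (- - γ - 1#) * (S.t * S.s) * Sγ.x
    ratios≈ = trans (*-congʳ (sym (trans (nonneg⇒∣∣ (proj₁ N.0<x)) (*-assoc S.q S.t S.s))))
      (trans ratios (*-congʳ N.∣y∣))

    0<difference : 0# < S.q * (S.t * S.s) * Sγ.y - (- - γ - 1#) * (S.t * S.s) * Sγ.x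
    -- Since q(-γ) = q(γ) + 2 M γ, the combination (γ + 1) q(-γ) - (γ - 1) q(γ) equals 2 q(γ) + 2 M
    -- γ (γ + 1); the other factors are common to both products.
    0<difference = <-resp refl (solve 2 (λ M g → let h = :- g in
        (Sγ.tE M h :* Sγ.sE M h) :* (Sγ.tE M g :* Sγ.sE M g) :* (# 2 :* Sγ.qE M g :+ # 2 :* (M :* g) :* (g :+ # 1)) :=
        Sγ.qE M h :* (Sγ.tE M h :* Sγ.sE M h) :* ((g :+ # 1) :* Sγ.tE M g :* Sγ.sE M g) :-
        (:- h :- # 1) :* (Sγ.tE M h :* Sγ.sE M h) :* (Sγ.qE M g :* Sγ.tE M g :* Sγ.sE M g)) refl μ γ)
      (*-pos (*-pos N.0<ts (*-pos Pγ.0<t Pγ.0<s)) (+-pos (*-pos (ι-pos 1) Pγ.0<q)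
        (*-nonneg (*-nonneg (ι-nonneg 2) (*-nonneg 0≤μ 0≤γ)) (proj₁ Pγ.0<w+1))))

  -- A root with |w| ≥ γ also has |w| ≥ m + 1, so its hub coordinate is nonzero and `root-bound`
  -- gives |w| = γ. Both w = γ and w = -γ are excluded.
  real-root : ∀ {w} → polynomial w ≈ 0# → ¬ w ≈ γ → ∣ w ∣ < γ
  real-root {w} root w≉γ = ≰⇒> λ γ≤∣w∣ → [ positive γ≤∣w∣ , negative γ≤∣w∣ ]′ (∣∣-sign w)
    where
    positive : γ ≤ ∣ w ∣ → ∣ w ∣ ≈ w → _
    positive γ≤∣w∣ e = w≉γ (trans (sym e) (≤.antisym (root-bound root (pos⇒≉0 (Positivity.0<x lower≤w))) γ≤∣w∣))
      where
      lower≤w : lower ≤ w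
      lower≤w = ≤.trans lower≤γ (≤-respʳ e γ≤∣w∣)
    negative : γ ≤ ∣ w ∣ → ∣ w ∣ ≈ - w → _
    negative γ≤∣w∣ e = -γ-not-root (trans (polynomial-cong -γ≈w) root)
      where
      lower≤-w : lower ≤ - w
      lower≤-w = ≤.trans lower≤γ (≤-respʳ e γ≤∣w∣)
      -γ≈w : - γ ≈ w
      -γ≈w = begin
        - γ      ≈⟨ -‿cong (≤.antisym γ≤∣w∣ (root-bound root (pos⇒≉0 (Negative.0<x lower≤-w)))) ⟩
        - ∣ w ∣  ≈⟨ -‿cong e ⟩
        - - w    ≈⟨ solve 1 (λ w → :- :- w := w) refl w ⟩
        w        ∎

  module ComplexRoots where

    private
      module ℂR = CommutativeRing ℂ-commutativeRing
      module ℂSums = Sums ℂ-commutativeRing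
      module ℂSolution = WindmillVector.Solution ℂ-commutativeRing ℓ M
      module fromℝ-homo = PolynomialHomomorphism commutativeRing ℂ-commutativeRing fromℝ

    polynomialᶜ : ℂ → ℂ
    polynomialᶜ = ℂ-T₂C-polynomial (2 ℕ.+ M) (9 ℕ.+ ℓ)

    private
      +-homo : ∀ x y → fromℝ (x + y) ℂR.≈ fromℝ x ℂR.+ fromℝ y
      +-homo x y = refl , sym (+-identityˡ 0#)

      *-homo : ∀ x y → fromℝ (x * y) ℂR.≈ fromℝ x ℂR.* fromℝ y
      *-homo x y = solve 2 (λ x y → x :* y := x :* y :- # 0 :* # 0) refl x y ,
                   solve 2 (λ x y → # 0 := x :* # 0 :+ # 0 :* y) refl x y

      neg-homo : ∀ x → fromℝ (- x) ℂR.≈ ℂR.- fromℝ x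
      neg-homo x = refl , solve 0 (# 0 := :- # 0) refl

    fromℝ-polynomial : ∀ {x z} → fromℝ x ℂR.≈ z → fromℝ (polynomial x) ℂR.≈ polynomialᶜ z
    fromℝ-polynomial = fromℝ-homo.polynomial-homo +-homo *-homo neg-homo ℂR.refl ℂR.refl (2 ℕ.+ M) (9 ℕ.+ ℓ)

    fromℝ-ι : ∀ n → fromℝ (ι n) ℂR.≈ RingExpressions.ι ℂR.rawRing n
    fromℝ-ι = fromℝ-homo.ι-homo +-homo *-homo neg-homo ℂR.refl ℂR.refl

    im-ι : ∀ n → im (RingExpressions.ι ℂR.rawRing n) ≈ 0#
    im-ι n = sym (proj₂ (fromℝ-ι n))

    nonzero-product : ∀ {z w} → ¬ z ℂR.≈ ℂR.0# → ¬ w ℂR.≈ ℂR.0# → ¬ z ℂR.* w ℂR.≈ ℂR.0#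
    nonzero-product z≉0 w≉0 zw≈0 = w≉0 (ℂ-no-zero-divisors zw≈0 z≉0)

    s-nonreal : ∀ {w} → ¬ im w ≈ 0# → ¬ im (ℂSolution.s w) ≈ 0#
    s-nonreal {w} im≉0 e = im≉0 (trans (trans (solve 1 (λ a → a := a :+ :- # 0) refl (im w))
      (+-congˡ (-‿cong (sym (im-ι M))))) e)

    t-nonreal : ∀ {w} → ¬ im w ≈ 0# → ¬ im (ℂSolution.t w) ≈ 0#
    t-nonreal {w} im≉0 e = s-nonreal {w} im≉0 (trans (sym (+-identityʳ _)) e)

    -- The discriminant M² + 8 M + 4 of q is positive.

    q-nonzero : ∀ {w} → ¬ im w ≈ 0# → ¬ ℂSolution.q w ℂR.≈ ℂR.0#
    q-nonzero {w} im≉0 q≈0 = pos⇒≉0 0<disc (begin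
      ι 4 * (β * β) + (μ * μ + ι 8 * μ + ι 4)
        ≈⟨ solve 3 (λ a b M → # 4 :* (b :* b) :+ (M :* M :+ # 8 :* M :+ # 4) :=
             (# 2 :* a :- M) :* (# 2 :* a :- M) :- # 4 :* reE a b M) refl α β μ ⟩
      (ι 2 * α - μ) * (ι 2 * α - μ) - ι 4 * re q′
        ≈⟨ +-cong (trans (*-congˡ 2α≈μ) (zeroʳ _)) (-‿cong (trans (*-congˡ (proj₁ q′≈0)) (zeroʳ _))) ⟩
      0# - 0#
        ≈⟨ -‿inverseʳ 0# ⟩
      0# ∎)
      where
      α = re w
      β = im w

      -- The complex numerals are replaced by images of real ones, so that real and imaginary parts
      -- become polynomials in α, β and M.
      q′ : ℂ
      q′ = ((w ℂR.- ℂR.1#) ℂR.* (w ℂR.- fromℝ μ ℂR.+ ℂR.1#)) ℂR.- fromℝ (ι 3) ℂR.* fromℝ μ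

      q′≈0 : q′ ℂR.≈ ℂR.0#
      q′≈0 = ℂR.trans (ℂR.+-cong (ℂR.*-congˡ (ℂR.+-congʳ (ℂR.+-congˡ (ℂR.-‿cong (fromℝ-ι M)))))
        (ℂR.-‿cong (ℂR.*-cong (fromℝ-ι 3) (fromℝ-ι M)))) q≈0

      reE : ∀ {n} → Polynomial n → Polynomial n → Polynomial n → Polynomial n
      reE a b M = (a :- # 1) :* (a :- M :+ # 1) :- (b :- # 0) :* (b :- # 0 :+ # 0) :- (# 3 :* M :- # 0 :* # 0)

      -- The imaginary part of `q` is β (2 α - M), and β is nonzero.
      2α≈μ : ι 2 * α - μ ≈ 0#
      2α≈μ = *-zero (trans (solve 3 (λ a b M → b :* (# 2 :* a :- M) :=
        ((a :- # 1) :* (b :- # 0 :+ # 0) :+ (b :- # 0) :* (a :- M :+ # 1)) :- (# 3 :* # 0 :+ # 0 :* M))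
        refl α β μ) (proj₂ q′≈0)) im≉0

      0<disc : 0# < ι 4 * (β * β) + (μ * μ + ι 8 * μ + ι 4)
      0<disc = +-pos (*-pos (ι-pos 3) (square-pos im≉0))
        (+-nonneg (+-nonneg (*-nonneg 0≤μ 0≤μ) (*-nonneg (ι-nonneg 8) 0≤μ)) (ι-nonneg 4))

    -- For a non-real root the factors s, t and q of the hub coordinate are all nonzero. The root is
    -- then an eigenvalue of a symmetric real matrix, hence real after all.
    root-real : ∀ {w} → polynomialᶜ w ℂR.≈ ℂR.0# → im w ≈ 0#
    root-real {w} root with im w ≤.≟ 0#
    ... | yes im≈0 = im≈0
    ... | no  im≉0 = proj₁ (eigenvalue-real (adjacency T) (adjacency-sym T) {w}
      ( z
      , ( ↔.to Q.vertices (inj₁ zero)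
        , λ e → nonzero-product (nonzero-product (q-nonzero {w} im≉0) (t-nonreal {w} im≉0 ∘ proj₂)) (s-nonreal {w} im≉0 ∘ proj₂)
            (ℂR.trans (ℂR.reflexive (≡.cong (ℂSolution.value w root)
              (≡.sym (↔.strictlyInverseʳ Q.vertices (inj₁ zero))))) e))
      , λ i → ℂR.trans (ℂSums.sum-cong λ j → entry (does (adjacent? T i j)) (z j)) (ℂSolution.solution w root Q i)))
      where
      z : Vertex T → ℂ
      z = ℂSolution.value w root ∘ Q.point

      entry : ∀ b x → fromℝ ([ b ] 1#) ℂR.* x ℂR.≈ (ℂSums.[ b ] x)
      entry true  x = ℂR.*-identityˡ x
      entry false x = ℂR.zeroˡ x

    γ-largest : IsLargestRoot polynomialᶜ (fromℝ γ)
    γ-largest =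
      ℂR.trans (ℂR.sym (fromℝ-polynomial ℂR.refl)) (γ-isRoot , refl) ,
      λ w root w≉γ → let im≈0 = root-real root in
        <-resp (sym (modulus-real {w} im≈0)) (sym (trans (modulus-real {fromℝ γ} refl) (nonneg⇒∣∣ 0≤γ)))
          (real-root (trans (proj₁ (fromℝ-polynomial {re w} {w} (refl , sym im≈0))) (proj₁ root))
            (λ re≈γ → w≉γ (re≈γ , im≈0)))

  open ComplexRoots public using (γ-largest)

  -- The spectral radius of T and the comparison of spectral radii

  private
    c : Carrier
    c = ι (suc M)

    0<c : 0# < c
    0<c = ι-pos M

  ρT : Carrier
  ρT = γ / c

  0≤ρT : 0# ≤ ρT
  0≤ρT = *-nonneg 0≤γ (proj₁ (⁻¹-pos 0<c))

  c*ρT : c * ρT ≈ γ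
  c*ρT = begin
    c * (γ * c ⁻¹)  ≈⟨ solve 3 (λ c g i → c :* (g :* i) := g :* (c :* i)) refl c γ (c ⁻¹) ⟩
    γ * (c * c ⁻¹)  ≈⟨ *-congˡ (⁻¹-inverseʳ (pos⇒≉0 0<c)) ⟩
    γ * 1#          ≈⟨ *-identityʳ γ ⟩
    γ               ∎

  ∣c*∣ : ∀ α → ∣ c * α ∣ ≈ c * ∣ α ∣
  ∣c*∣ α = trans (∣∣-* c α) (*-congʳ (nonneg⇒∣∣ (proj₁ 0<c)))

  ρT-isλ₁ : Isλ₁ (2 ℕ.+ M) T ρT
  ρT-isλ₁ = (fromℝ ρT , perron-eigenvalue , trans (modulus-real {fromℝ ρT} refl) (nonneg⇒∣∣ 0≤ρT)) , upper
    where
    A : Matrix (order T)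
    A = adjacencyMatrix (2 ℕ.+ M) T

    perron-eigenvalue : IsEigenvalue A (fromℝ ρT)
    perron-eigenvalue = fromℝ ∘ perron ,
      (↔.to Q.vertices (inj₁ zero) , λ e → pos⇒≉0 (value-pos (Q.point (↔.to Q.vertices (inj₁ zero)))) (proj₁ e)) ,
      λ i → trans (re-row (A i) (fromℝ ∘ perron)) (trans
              (eigenvector⇒A {d = M} T {γ} {perron} (solution-eigenvector γ-isRoot) i)
              (solve 2 (λ r x → r :* x := r :* x :- # 0 :* # 0) refl ρT (perron i))) ,
            trans (im-row (A i) (fromℝ ∘ perron)) (trans
              (sum-0 {f = λ j → A i j * 0#} (λ j → zeroʳ (A i j)))
              (solve 2 (λ r x → # 0 := r :* # 0 :+ # 0 :* x) refl ρT (perron i)))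

    upper : ∀ μ → IsEigenvalue A μ → modulus μ ≤ ρT
    upper μ isEigen =
      let (im≈0 , v , v≉0 , eigen) = eigenvalue-real A (adjacencyMatrix-sym {d = M} T) {μ} isEigen
      in ≤-respˡ (sym (modulus-real {μ} im≈0)) (*-cancelˡ-≤ 0<c (≤-respˡ (∣c*∣ (re μ)) (≤-respʳ (sym c*ρT)
           (eigenvalue-bound (A⇒eigenvector {d = M} T eigen) v≉0))))

  -- The root is chosen only after an eigenvector of H is known, so a windmill form must be
  -- available at every old vertex.
  module _ {H : Hypergraph} {n} {origin : Fin n → Vertex H} (inhabited : Fin n)
    (forms : ∀ u → ∃ λ (F : WindmillForm M H origin u) → WindmillForm.ℓ F ≡ ℓ) where

    bounded : ∀ {w v} → Eigen H w v → (∃ λ i → ¬ v i ≈ 0#) → ∣ w ∣ ≤ γ × (∣ w ∣ ≈ γ → H ≅ T)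
    bounded {w} {v} eigen v≉0 = compare (proj₁ (forms u)) (proj₂ (forms u))
      where
      maximum : ∃ λ u → ∀ x → ∣ v (origin x) ∣ ≤ ∣ v (origin u) ∣
      maximum = argmax (λ x → ∣ v (origin x) ∣) inhabited

      u : Fin n
      u = proj₁ maximum

      compare : (F : WindmillForm M H origin u) → WindmillForm.ℓ F ≡ ℓ → ∣ w ∣ ≤ γ × (∣ w ∣ ≈ γ → H ≅ T)
      compare F ≡.refl = C.∣w∣≤γ , C.Equality.isomorphic
        where
        module F = WindmillForm F

        largest : ∀ x → ∣ v (Presentation.base F.presentation x) ∣ ≤ ∣ v (Presentation.base F.presentation zero) ∣
        largest x = ≡.subst₂ (λ a b → ∣ v a ∣ ≤ ∣ v b ∣) (≡.sym (proj₂ (F.base-origin x))) (≡.sym F.base-zero)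
          (proj₂ maximum (proj₁ (F.base-origin x)))

        module C = Comparison {H} {F.graph} {F.par} F.presentation F.src≡ F.tgt≡ {w} {v} eigen v≉0 largest

    ρT-maximal : ∀ ρH → Isλ₁ (2 ℕ.+ M) H ρH → ρH ≤ ρT × (ρH ≈ ρT → H ≅ T)
    ρT-maximal ρH ((μ , isEigen , modulus≈ρH) , _) =
      *-cancelˡ-≤ 0<c (≤-respˡ ∣w∣≈ (≤-respʳ (sym c*ρT) (proj₁ bound))) ,
      λ ρH≈ρT → proj₂ bound (trans ∣w∣≈ (trans (*-congˡ ρH≈ρT) c*ρT))
      where
      A : Matrix (order H)
      A = adjacencyMatrix (2 ℕ.+ M) H

      real : im μ ≈ 0# × ∃ λ v → (∃ λ i → ¬ v i ≈ 0#) × (∀ i → sum (λ j → A i j * v j) ≈ re μ * v i)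
      real = eigenvalue-real A (adjacencyMatrix-sym {d = M} H) {μ} isEigen

      bound : ∣ c * re μ ∣ ≤ γ × (∣ c * re μ ∣ ≈ γ → H ≅ T)
      bound = let (_ , v , v≉0 , eigen) = real in
        bounded {c * re μ} {v} (A⇒eigenvector {d = M} H {re μ} {v} eigen) v≉0

      ∣w∣≈ : ∣ c * re μ ∣ ≈ c * ρH
      ∣w∣≈ = trans (∣c*∣ (re μ)) (*-congˡ (trans (sym (modulus-real {μ} (proj₁ real))) modulus≈ρH))

-- The number of edges is a variable with an equation, which can be matched with `refl`; for
-- `size H` itself this would be impossible.
extremal : (ℝ : RealNumbers) (M ℓ k : ℕ) → k ≡ 9 ℕ.+ ℓ →
  ∀ {T} → Presentation M (windmill ℓ) T →
  ∀ {H n} {origin : Fin n → Vertex H} → Fin n →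
  (∀ u → ∃ λ (F : WindmillForm M H origin u) → WindmillForm.ℓ F ≡ ℓ) →
  let open Spectral ℝ in
  ∃ λ ρT → Isλ₁ (2 ℕ.+ M) T ρT
    × (∀ ρH → Isλ₁ (2 ℕ.+ M) H ρH → ρH ≤ ρT × (ρH ≈ ρT → H ≅ T))
    × (∃ λ γ → IsLargestRoot (ℂ-T₂C-polynomial (2 ℕ.+ M) k) (fromℝ γ)
         × ρT ≈ γ / ι (suc M)
         × γ < γ-bound (2 ℕ.+ M) k)
extremal ℝ M ℓ k ≡.refl {T} Q inhabited forms =
  ρT , ρT-isλ₁ , ρT-maximal inhabited forms , γ , γ-largest , RealNumbers.refl ℝ , γ<bound
  where
  open Extremal ℝ ℓ M T Q

theorem5p2p1 : (ℝ : RealNumbers) (m : ℕ) (2≤m : 2 ≤ℕ m) (H : Hypergraph) →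
    Uniform m H → Linear H → IsPower m H →
    Connected H → ThreeCyclic H → TypeII m H →
    let open Spectral ℝ
        k = size H
        T = T₂C m 2≤m (c₁= (k ∸ 9))
    in
    ∃ λ ρT → Isλ₁ m T ρT
      × (∀ ρH → Isλ₁ m H ρH → ρH ≤ ρT × (ρH ≈ ρT → H ≅ T))
      × (∃ λ γ → IsLargestRoot (ℂ-T₂C-polynomial m k) (fromℝ γ)
           × ρT ≈ γ / ι (m ∸ 1)
           × γ < γ-bound m k)
theorem5p2p1 ℝ (suc (suc M)) 2≤m@(s≤s (s≤s z≤n)) H _ _ isPower conn three type-II =
  extremal ℝ M ℓ (size H)
    (≡.trans (WindmillForm.size≡ (F baseVertex₀)) (≡.cong (9 ℕ.+_) (ℓ≡ baseVertex₀)))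
    (T₂C-presentation 2≤m ℓ) baseVertex₀ (λ u → F u , ℓ≡ u)
  where
  ℓ : ℕ
  ℓ = size H ∸ 9

  baseVertex₀ = baseVertex-exists isPower conn three type-II

  F : ∀ u → WindmillForm M H (baseVertex isPower conn three type-II) u
  F = windmillForm isPower conn three type-II

  -- Each form has 9 + ℓ edges, so the truncated subtraction is exact and `ℓ` is the same for every
  -- root.
  ℓ≡ : ∀ u → WindmillForm.ℓ (F u) ≡ ℓ
  ℓ≡ u = ≡.sym (≡.trans (≡.cong (_∸ 9) (WindmillForm.size≡ (F u))) (ℕ.m+n∸m≡n 9 (WindmillForm.ℓ (F u))))
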